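{- For every $d\ge1$, there are at most $(d!)^{d+1}\,2^{3^d\,d!}$ distinct $\mathrm{GL}_d(\mathbb Z)$-orbits of $d$-dimensional symmetric lattice polytopes $P\subset\mathbb R^d$ whose interior contains no nonzero element of $\mathbb Z^d$.
   Context: A lattice polytope is the convex hull of finitely many points of $\mathbb Z^d$; it is $d$-dimensional if it has nonempty interior; it is symmetric if $P=-P$. $\mathrm{GL}_d(\mathbb Z)$ acts linearly on $\mathbb R^d$ and hence on such polytopes. -}

module Defs where

open import Level using (0ℓ)
open import Algebra.Bundles.Raw using (RawMonoid)
import Algebra.Definitions.RawMonoid as RawMonoidDefs
open import Data.Bool.Base using (if_then_else_)
open import Data.Fin.Base using (Fin)
import Data.Fin.Properties as Fin
open import Data.Integer.Base as ℤ using (ℤ; 0ℤ; 1ℤ)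
open import Data.Nat.Base as ℕ using (ℕ; suc; _⊔_)
import Data.Nat.Properties as ℕ
open import Data.Product.Base using (∃; ∃₂; _×_; _,_)
open import Data.Rational.Base as ℚ using (ℚ; 0ℚ; 1ℚ; ½)
import Data.Rational.Properties as ℚ
open import Data.Rational.Solver using (module +-*-Solver)
open import Data.Vec.Functional using (Vector)
open import Relation.Binary.PropositionalEquality
  using (_≡_; _≢_; refl; sym; trans; cong; subst)
open import Relation.Nullary.Decidable using (⌊_⌋)
open import Relation.Nullary.Negation using (¬_)
open import Relation.Unary using (Pred; _≐_; _∈_; _∉_)

------------------------------------------------------------------------
-- Real numbers: Cauchy sequences of rationals, with the equality _≃_
-- and pointwise operations

IsCauchy : (ℕ → ℚ) → Set
IsCauchy x = ∀ ε → 0ℚ ℚ.< ε →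
  ∃ λ N → ∀ m n → N ℕ.≤ m → N ℕ.≤ n → ℚ.∣ x m ℚ.- x n ∣ ℚ.< ε

record ℝ : Set where
  constructor mkℝ
  field
    seq    : ℕ → ℚ
    cauchy : IsCauchy seq

open ℝ public

infix 4 _≃_ _<_ _≤_

_≃_ : ℝ → ℝ → Set
x ≃ y = ∀ ε → 0ℚ ℚ.< ε →
  ∃ λ N → ∀ n → N ℕ.≤ n → ℚ.∣ seq x n ℚ.- seq y n ∣ ℚ.< ε

_<_ : ℝ → ℝ → Set
x < y = ∃ λ ε → 0ℚ ℚ.< ε ×
  (∃ λ N → ∀ n → N ℕ.≤ n → seq x n ℚ.+ ε ℚ.< seq y n)

_≤_ : ℝ → ℝ → Set
x ≤ y = ∀ ε → 0ℚ ℚ.< ε →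
  ∃ λ N → ∀ n → N ℕ.≤ n → seq x n ℚ.< seq y n ℚ.+ ε

private
  ½*-pos : ∀ {ε} → 0ℚ ℚ.< ε → 0ℚ ℚ.< ½ ℚ.* ε
  ½*-pos {ε} 0<ε = ℚ.positive⁻¹ (½ ℚ.* ε)
    {{ℚ.pos*pos⇒pos ½ ε {{ℚ.positive 0<ε}}}}

  ½+½ : ∀ ε → ½ ℚ.* ε ℚ.+ ½ ℚ.* ε ≡ ε
  ½+½ ε = trans (sym (ℚ.*-distribʳ-+ ε ½ ½)) (ℚ.*-identityˡ ε)

  +-rearrange : ∀ a b c d →
    (a ℚ.+ c) ℚ.- (b ℚ.+ d) ≡ (a ℚ.- b) ℚ.+ (c ℚ.- d)
  +-rearrange = solve 4 (λ a b c d →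
    (a :+ c) :- (b :+ d) := (a :- b) :+ (c :- d)) refl
    where open +-*-Solver

  neg-rearrange : ∀ a b → (ℚ.- a) ℚ.- (ℚ.- b) ≡ ℚ.- (a ℚ.- b)
  neg-rearrange = solve 2 (λ a b → (:- a) :- (:- b) := :- (a :- b)) refl
    where open +-*-Solver

  *-rearrange : ∀ a b c d →
    a ℚ.* c ℚ.- b ℚ.* d ≡ a ℚ.* (c ℚ.- d) ℚ.+ d ℚ.* (a ℚ.- b)
  *-rearrange = solve 4 (λ a b c d →
    a :* c :- b :* d := a :* (c :- d) :+ d :* (a :- b)) refl
    where open +-*-Solver

  cancel : ∀ a b → b ℚ.+ (a ℚ.- b) ≡ a
  cancel = solve 2 (λ a b → b :+ (a :- b) := a) refl
    where open +-*-Solver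

  eventuallyBounded : ∀ (x : ℝ) → ∃ λ A → 0ℚ ℚ.< A ×
    (∃ λ N → ∀ n → N ℕ.≤ n → ℚ.∣ seq x n ∣ ℚ.≤ A)
  eventuallyBounded x with cauchy x 1ℚ (ℚ.positive⁻¹ 1ℚ)
  ... | N , close = A , 0<A , N , bound
    where
    open ℚ.≤-Reasoning
    A = ℚ.∣ seq x N ∣ ℚ.+ 1ℚ
    0<A : 0ℚ ℚ.< A
    0<A = ℚ.+-mono-≤-< (ℚ.0≤∣p∣ (seq x N)) (ℚ.positive⁻¹ 1ℚ)
    bound : ∀ n → N ℕ.≤ n → ℚ.∣ seq x n ∣ ℚ.≤ A
    bound n N≤n = begin
      ℚ.∣ seq x n ∣
        ≡⟨ cong ℚ.∣_∣ (sym (cancel (seq x n) (seq x N))) ⟩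
      ℚ.∣ seq x N ℚ.+ (seq x n ℚ.- seq x N) ∣
        ≤⟨ ℚ.∣p+q∣≤∣p∣+∣q∣ (seq x N) (seq x n ℚ.- seq x N) ⟩
      ℚ.∣ seq x N ∣ ℚ.+ ℚ.∣ seq x n ℚ.- seq x N ∣
        ≤⟨ ℚ.+-monoʳ-≤ ℚ.∣ seq x N ∣ (ℚ.<⇒≤ (close n N N≤n ℕ.≤-refl)) ⟩
      A ∎

  quotient : ∀ C ε → 0ℚ ℚ.< C → 0ℚ ℚ.< ε →
    ∃ λ δ → 0ℚ ℚ.< δ × C ℚ.* δ ≡ ε
  quotient C ε 0<C 0<ε = C⁻¹ ℚ.* ε , 0<C⁻¹ε , C*C⁻¹ε≡ε
    where
    instance
      C-pos : ℚ.Positive C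
      C-pos = ℚ.positive 0<C
      C≢0 : ℚ.NonZero C
      C≢0 = ℚ.pos⇒nonZero C
    C⁻¹ = ℚ.1/ C
    0<C⁻¹ε : 0ℚ ℚ.< C⁻¹ ℚ.* ε
    0<C⁻¹ε = ℚ.positive⁻¹ (C⁻¹ ℚ.* ε)
      {{ℚ.pos*pos⇒pos C⁻¹ {{ℚ.1/pos⇒pos C}} ε {{ℚ.positive 0<ε}}}}
    C*C⁻¹ε≡ε : C ℚ.* (C⁻¹ ℚ.* ε) ≡ ε
    C*C⁻¹ε≡ε = trans (sym (ℚ.*-assoc C C⁻¹ ε))
      (trans (cong (ℚ._* ε) (ℚ.*-inverseʳ C)) (ℚ.*-identityˡ ε))

  product-bound : ∀ p q C δ → 0ℚ ℚ.< C → ℚ.∣ p ∣ ℚ.≤ C → ℚ.∣ q ∣ ℚ.< δ →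
             ℚ.∣ p ℚ.* q ∣ ℚ.< C ℚ.* δ
  product-bound p q C δ 0<C p≤C q<δ = begin-strict
    ℚ.∣ p ℚ.* q ∣         ≡⟨ ℚ.∣p*q∣≡∣p∣*∣q∣ p q ⟩
    ℚ.∣ p ∣ ℚ.* ℚ.∣ q ∣
      ≤⟨ ℚ.*-monoʳ-≤-nonNeg ℚ.∣ q ∣ {{ℚ.nonNegative (ℚ.0≤∣p∣ q)}} p≤C ⟩
    C ℚ.* ℚ.∣ q ∣         <⟨ ℚ.*-monoʳ-<-pos C {{ℚ.positive 0<C}} q<δ ⟩
    C ℚ.* δ               ∎
    where open ℚ.≤-Reasoning

  product-close : ∀ a b c d A B δ → 0ℚ ℚ.< A → 0ℚ ℚ.< B →
    ℚ.∣ a ∣ ℚ.≤ A → ℚ.∣ d ∣ ℚ.≤ B →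
    ℚ.∣ a ℚ.- b ∣ ℚ.< δ → ℚ.∣ c ℚ.- d ∣ ℚ.< δ →
    ℚ.∣ a ℚ.* c ℚ.- b ℚ.* d ∣ ℚ.< (A ℚ.+ B) ℚ.* δ
  product-close a b c d A B δ 0<A 0<B a≤A d≤B ab cd = begin-strict
    ℚ.∣ a ℚ.* c ℚ.- b ℚ.* d ∣
      ≡⟨ cong ℚ.∣_∣ (*-rearrange a b c d) ⟩
    ℚ.∣ a ℚ.* (c ℚ.- d) ℚ.+ d ℚ.* (a ℚ.- b) ∣
      ≤⟨ ℚ.∣p+q∣≤∣p∣+∣q∣ (a ℚ.* (c ℚ.- d)) (d ℚ.* (a ℚ.- b)) ⟩
    ℚ.∣ a ℚ.* (c ℚ.- d) ∣ ℚ.+ ℚ.∣ d ℚ.* (a ℚ.- b) ∣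
      <⟨ ℚ.+-mono-< (product-bound a (c ℚ.- d) A δ 0<A a≤A cd)
                    (product-bound d (a ℚ.- b) B δ 0<B d≤B ab) ⟩
    A ℚ.* δ ℚ.+ B ℚ.* δ
      ≡⟨ sym (ℚ.*-distribʳ-+ δ A B) ⟩
    (A ℚ.+ B) ℚ.* δ ∎
    where open ℚ.≤-Reasoning

  *-isCauchy : ∀ x y → IsCauchy (λ n → seq x n ℚ.* seq y n)
  *-isCauchy x y ε 0<ε = bounds (eventuallyBounded x) (eventuallyBounded y)
    where
    Goal = ∃ λ N → ∀ m n → N ℕ.≤ m → N ℕ.≤ n →
      ℚ.∣ seq x m ℚ.* seq y m ℚ.- seq x n ℚ.* seq y n ∣ ℚ.< ε

    EventuallyBounded : ℝ → Set
    EventuallyBounded z = ∃ λ A → 0ℚ ℚ.< A ×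
      (∃ λ N → ∀ n → N ℕ.≤ n → ℚ.∣ seq z n ∣ ℚ.≤ A)

    EventuallyWithin : ℚ → ℝ → Set
    EventuallyWithin δ z = ∃ λ N → ∀ m n → N ℕ.≤ m → N ℕ.≤ n →
      ℚ.∣ seq z m ℚ.- seq z n ∣ ℚ.< δ

    bounds : EventuallyBounded x → EventuallyBounded y → Goal
    bounds (A , 0<A , N₁ , boundx) (B , 0<B , N₂ , boundy) =
      scale (quotient (A ℚ.+ B) ε (ℚ.+-mono-< 0<A 0<B) 0<ε)
      where
      conclude : ∀ δ → (A ℚ.+ B) ℚ.* δ ≡ ε →
                 EventuallyWithin δ x → EventuallyWithin δ y → Goal
      conclude δ eq (N₃ , closex) (N₄ , closey) =
        (N₁ ⊔ N₂) ⊔ (N₃ ⊔ N₄) , λ m n N≤m N≤n →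
        let N₁₂≤ = λ k → ℕ.m⊔n≤o⇒m≤o {k} (N₁ ⊔ N₂) (N₃ ⊔ N₄)
            N₃₄≤ = λ k → ℕ.m⊔n≤o⇒n≤o {k} (N₁ ⊔ N₂) (N₃ ⊔ N₄)
        in subst (ℚ.∣ seq x m ℚ.* seq y m ℚ.- seq x n ℚ.* seq y n ∣ ℚ.<_) eq
          (product-close (seq x m) (seq x n) (seq y m) (seq y n)
            A B δ 0<A 0<B
            (boundx m (ℕ.m⊔n≤o⇒m≤o N₁ N₂ (N₁₂≤ m N≤m)))
            (boundy n (ℕ.m⊔n≤o⇒n≤o N₁ N₂ (N₁₂≤ n N≤n)))
            (closex m n (ℕ.m⊔n≤o⇒m≤o N₃ N₄ (N₃₄≤ m N≤m))
                        (ℕ.m⊔n≤o⇒m≤o N₃ N₄ (N₃₄≤ n N≤n)))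
            (closey m n (ℕ.m⊔n≤o⇒n≤o N₃ N₄ (N₃₄≤ m N≤m))
                        (ℕ.m⊔n≤o⇒n≤o N₃ N₄ (N₃₄≤ n N≤n))))

      scale : (∃ λ δ → 0ℚ ℚ.< δ × (A ℚ.+ B) ℚ.* δ ≡ ε) → Goal
      scale (δ , 0<δ , eq) = conclude δ eq (cauchy x δ 0<δ) (cauchy y δ 0<δ)

fromℚ : ℚ → ℝ
fromℚ q = mkℝ (λ _ → q) λ ε 0<ε → 0 , λ _ _ _ _ →
  subst (ℚ._< ε) (sym (cong ℚ.∣_∣ (ℚ.+-inverseʳ q))) 0<ε

fromℤ : ℤ → ℝ
fromℤ z = fromℚ (z ℚ./ 1)

0ℝ 1ℝ : ℝ
0ℝ = fromℚ 0ℚ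
1ℝ = fromℚ 1ℚ

infix  8 -_
infixl 7 _*_
infixl 6 _+_ _-_

_+_ : ℝ → ℝ → ℝ
seq    (x + y) n = seq x n ℚ.+ seq y n
cauchy (x + y) ε 0<ε
  with cauchy x (½ ℚ.* ε) (½*-pos 0<ε) | cauchy y (½ ℚ.* ε) (½*-pos 0<ε)
... | N₁ , closex | N₂ , closey = N₁ ⊔ N₂ , λ m n N≤m N≤n →
  let a = seq x m ; b = seq x n ; c = seq y m ; d = seq y n in begin-strict
  ℚ.∣ (a ℚ.+ c) ℚ.- (b ℚ.+ d) ∣
    ≡⟨ cong ℚ.∣_∣ (+-rearrange a b c d) ⟩
  ℚ.∣ (a ℚ.- b) ℚ.+ (c ℚ.- d) ∣
    ≤⟨ ℚ.∣p+q∣≤∣p∣+∣q∣ (a ℚ.- b) (c ℚ.- d) ⟩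
  ℚ.∣ a ℚ.- b ∣ ℚ.+ ℚ.∣ c ℚ.- d ∣
    <⟨ ℚ.+-mono-<
         (closex m n (ℕ.m⊔n≤o⇒m≤o N₁ N₂ N≤m) (ℕ.m⊔n≤o⇒m≤o N₁ N₂ N≤n))
         (closey m n (ℕ.m⊔n≤o⇒n≤o N₁ N₂ N≤m) (ℕ.m⊔n≤o⇒n≤o N₁ N₂ N≤n)) ⟩
  ½ ℚ.* ε ℚ.+ ½ ℚ.* ε
    ≡⟨ ½+½ ε ⟩
  ε ∎
  where open ℚ.≤-Reasoning

-_ : ℝ → ℝ
seq    (- x) n = ℚ.- seq x n
cauchy (- x) ε 0<ε with cauchy x ε 0<ε
... | N , close = N , λ m n N≤m N≤n →
  subst (ℚ._< ε)
    (sym (trans (cong ℚ.∣_∣ (neg-rearrange (seq x m) (seq x n)))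
                (ℚ.∣-p∣≡∣p∣ (seq x m ℚ.- seq x n))))
    (close m n N≤m N≤n)

_-_ : ℝ → ℝ → ℝ
x - y = x + (- y)

_*_ : ℝ → ℝ → ℝ
seq    (x * y) n = seq x n ℚ.* seq y n
cauchy (x * y)   = *-isCauchy x y

+-0-rawMonoid : RawMonoid 0ℓ 0ℓ
+-0-rawMonoid = record { _≈_ = _≃_ ; _∙_ = _+_ ; ε = 0ℝ }

∑ : ∀ {n} → Vector ℝ n → ℝ
∑ = RawMonoidDefs.sum +-0-rawMonoid

∑ℤ : ∀ {n} → Vector ℤ n → ℤ
∑ℤ = RawMonoidDefs.sum ℤ.+-0-rawMonoid

------------------------------------------------------------------------
-- ℝᵈ and its subsets

ℝ^_ ℤ^_ : ℕ → Set
ℝ^ d = Vector ℝ d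
ℤ^ d = Vector ℤ d

Region : ℕ → Set₁
Region d = Pred (ℝ^ d) 0ℓ

infix 4 _≋_

_≋_ : ∀ {d} → ℝ^ d → ℝ^ d → Set
x ≋ y = ∀ k → x k ≃ y k

embed : ∀ {d} → ℤ^ d → ℝ^ d
embed z k = fromℤ (z k)

conv : ∀ {d n} → Vector (ℝ^ d) n → Region d
conv v x = ∃ λ c →
  (∀ i → 0ℝ ≤ c i) × (∑ c ≃ 1ℝ) × (x ≋ λ k → ∑ λ i → c i * v i k)

-- The open boxes around x form a neighbourhood basis at x for the
-- Euclidean topology.
Interior : ∀ {d} → Region d → Region d
Interior P x = ∃ λ ε → 0ℝ < ε ×
  (∀ y → (∀ k → x k - ε < y k × y k < x k + ε) → y ∈ P)

infix 8 ⊖_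

⊖_ : ∀ {d} → Region d → Region d
(⊖ P) y = ∃ λ x → x ∈ P × (y ≋ λ k → - x k)

IsLatticePolytope : ∀ {d} → Region d → Set
IsLatticePolytope {d} P =
  ∃₂ λ n (v : Vector (ℤ^ d) n) → P ≐ conv (λ i → embed (v i))

FullDimensional : ∀ {d} → Region d → Set
FullDimensional P = ∃ λ x → x ∈ Interior P

Symmetric : ∀ {d} → Region d → Set
Symmetric P = P ≐ ⊖ P

NoNonzeroInteriorLatticePoint : ∀ {d} → Region d → Set
NoNonzeroInteriorLatticePoint {d} P =
  ∀ (z : ℤ^ d) → ¬ (∀ k → z k ≡ 0ℤ) → embed z ∉ Interior P

------------------------------------------------------------------------
-- GL_d(ℤ) and its orbits

Matrix : ℕ → Set
Matrix d = Fin d → Fin d → ℤ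

_⊡_ : ∀ {d} → Matrix d → Matrix d → Matrix d
(A ⊡ B) i j = ∑ℤ λ k → A i k ℤ.* B k j

𝟙 : ∀ {d} → Matrix d
𝟙 i j = if ⌊ i Fin.≟ j ⌋ then 1ℤ else 0ℤ

record GL (d : ℕ) : Set where
  field
    matrix   : Matrix d
    inverse  : Matrix d
    inverseˡ : ∀ i j → (inverse ⊡ matrix) i j ≡ 𝟙 i j
    inverseʳ : ∀ i j → (matrix ⊡ inverse) i j ≡ 𝟙 i j

_·_ : ∀ {d} → GL d → ℝ^ d → ℝ^ d
(U · x) k = ∑ λ j → fromℤ (GL.matrix U k j) * x j

_·ᴿ_ : ∀ {d} → GL d → Region d → Region d
(U ·ᴿ P) y = ∃ λ x → x ∈ P × (y ≋ U · x)

SameOrbit : ∀ {d} → Region d → Region d → Set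
SameOrbit {d} P Q = ∃ λ (U : GL d) → Q ≐ U ·ᴿ P

-- The members of 𝒞 form at most N distinct orbits: any N + 1 members,
-- listed with indices, include two from the same orbit.
AtMostOrbits : ∀ {d} → ℕ → (Region d → Set) → Set₁
AtMostOrbits {d} N 𝒞 =
  ∀ (P : Fin (suc N) → Region d) → (∀ i → 𝒞 (P i)) →
  ∃₂ λ i j → i ≢ j × SameOrbit (P i) (P j)

{-# OPTIONS --safe #-}

module Submission where

-- Let P = conv {w₁, …, wₙ} be such a polytope. Since P is full-dimensional, d
-- of its vertices are independent; let L be the lattice that they span. The
-- interior of the cross polytope on these vertices contains no lattice point
-- but 0, so a packing argument in the style of Minkowski, with balls for the
-- ℓ¹ norm counted by Delannoy numbers, bounds the index of L in ℤᵈ by d!.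
-- If some vertex has a coordinate of absolute value > 1 with respect to the
-- chosen ones, exchanging it for that basis vector increases the index, so
-- after finitely many exchanges all coordinates are at most 1 in absolute value.
-- Up to GL_d(ℤ) the basis is a matrix H in Hermite normal form of determinant
-- at most d!, for which there are at most (d!)^(d+1) possibilities. All vertices
-- then lie in a parallelotope with at most 3ᵈ det H relevant lattice points,
-- and P is determined by H and the subset of these points that are vertices.
-- Orbits are thus distinguished by a code in a set of the required size, and
-- everything is decidable because it takes place on the list of vertices.

-- The points listed as `w₁, …, wₙ` may repeat or fail to be vertices, and neither they nor the
-- basis chosen among them are canonical. A polytope may thus have many codes. This is harmless,
-- since the pigeonhole principle only asks that equal codes force the same orbit. The order on the
-- reals is not decidable, so every case distinction is made on integer vectors. Reals enter only to
-- exclude an integer functional that vanishes on all `wᵢ`, to show that symmetry puts the lattice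
-- points of the open cross polytope into the interior of P, and to carry convex combinations from
-- one polytope to another. Fractions are avoided by multiplying coordinates with respect to a basis
-- by its index. The constant d! comes from the volume (2 r)ᵈ / d! of an ℓ¹ ball of radius r. In
-- place of a limit over ever finer packings, one explicit refinement makes the error smaller than
-- the gap between consecutive integers. The factor 3ᵈ counts the integer parts -1, 0, 1 of
-- coordinates in [-1, 1]; together with the coset they determine a point.

module IntegerLinearAlgebra where

  open import Data.Nat.Base as ℕ using (ℕ; zero; suc)
  import Data.Nat.Properties as ℕ
  open import Data.Nat.Induction using (<-wellFounded)
  open import Induction.WellFounded using (Acc; acc)
  open import Data.Integer.Base hiding (suc; _⊔_; _⊖_)
  import Data.Integer.Properties as ℤ
  open import Data.Integer.DivMod using (_/_; _%_; a≡a%n+[a/n]*n; n%d<d)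
  open import Data.Integer.Tactic.RingSolver using (solve-∀)
  open import Data.Fin.Base using (Fin; zero; suc)
  open import Data.Product.Base using (∃; ∃₂; _,_)
  open import Data.Vec.Base using (Vec; []; _∷_; head; tail; map; zipWith; replicate; lookup)
  open import Function.Base using (_∘_)
  open import Relation.Binary.PropositionalEquality
  open import Algebra.Properties.AbelianGroup ℤ.+-0-abelianGroup using (∙-cancelˡ)
  open ≡-Reasoning

  -- Integer vectors, unimodular maps and the Euclidean algorithm.

  infixl 6 _⊕_ _⊖_
  infixr 7 _⊙_

  _⊕_ _⊖_ : ∀ {n} → Vec ℤ n → Vec ℤ n → Vec ℤ n
  _⊕_ = zipWith _+_
  _⊖_ = zipWith _-_

  _⊙_ : ∀ {n} → ℤ → Vec ℤ n → Vec ℤ n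
  k ⊙ x = map (k *_) x

  𝟘 : ∀ {n} → Vec ℤ n
  𝟘 = replicate _ 0ℤ

  ⊕-assoc : ∀ {n} (x y z : Vec ℤ n) → (x ⊕ y) ⊕ z ≡ x ⊕ (y ⊕ z)
  ⊕-assoc [] [] [] = refl
  ⊕-assoc (a ∷ x) (b ∷ y) (c ∷ z) = cong₂ _∷_ (ℤ.+-assoc a b c) (⊕-assoc x y z)

  ⊕-comm : ∀ {n} (x y : Vec ℤ n) → x ⊕ y ≡ y ⊕ x
  ⊕-comm [] [] = refl
  ⊕-comm (a ∷ x) (b ∷ y) = cong₂ _∷_ (ℤ.+-comm a b) (⊕-comm x y)

  ⊕-identityˡ : ∀ {n} (x : Vec ℤ n) → 𝟘 ⊕ x ≡ x
  ⊕-identityˡ [] = refl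
  ⊕-identityˡ (a ∷ x) = cong₂ _∷_ (ℤ.+-identityˡ a) (⊕-identityˡ x)

  ⊕-identityʳ : ∀ {n} (x : Vec ℤ n) → x ⊕ 𝟘 ≡ x
  ⊕-identityʳ x = trans (⊕-comm x 𝟘) (⊕-identityˡ x)

  ⊕-interchange : ∀ {n} (a b c d : Vec ℤ n) → (a ⊕ b) ⊕ (c ⊕ d) ≡ (a ⊕ c) ⊕ (b ⊕ d)
  ⊕-interchange [] [] [] [] = refl
  ⊕-interchange (a ∷ as) (b ∷ bs) (c ∷ cs) (d ∷ ds) =
    cong₂ _∷_ (lemma a b c d) (⊕-interchange as bs cs ds)
    where
    lemma : ∀ a b c d → (a + b) + (c + d) ≡ (a + c) + (b + d)
    lemma = solve-∀

  ⊕-cancelˡ : ∀ {n} (x : Vec ℤ n) {y z} → x ⊕ y ≡ x ⊕ z → y ≡ z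
  ⊕-cancelˡ [] {[]} {[]} _ = refl
  ⊕-cancelˡ (a ∷ x) {b ∷ y} {c ∷ z} eq =
    cong₂ _∷_ (∙-cancelˡ a b c (cong head eq)) (⊕-cancelˡ x (cong tail eq))

  ⊖-⊕-cancel : ∀ {n} (x y : Vec ℤ n) → (x ⊖ y) ⊕ y ≡ x
  ⊖-⊕-cancel [] [] = refl
  ⊖-⊕-cancel (a ∷ x) (b ∷ y) = cong₂ _∷_ (lemma a b) (⊖-⊕-cancel x y)
    where
    lemma : ∀ a b → a - b + b ≡ a
    lemma = solve-∀

  ⊖-self : ∀ {n} (x : Vec ℤ n) → x ⊖ x ≡ 𝟘
  ⊖-self [] = refl
  ⊖-self (a ∷ x) = cong₂ _∷_ (ℤ.+-inverseʳ a) (⊖-self x)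

  ⊖-as-⊕ : ∀ {n} (x y : Vec ℤ n) → x ⊖ y ≡ x ⊕ -1ℤ ⊙ y
  ⊖-as-⊕ [] [] = refl
  ⊖-as-⊕ (a ∷ x) (b ∷ y) = cong₂ _∷_ (cong (λ t → a + t) (sym (ℤ.-1*i≡-i b))) (⊖-as-⊕ x y)

  ⊖≡𝟘⇒≡ : ∀ {n} {x y : Vec ℤ n} → x ⊖ y ≡ 𝟘 → x ≡ y
  ⊖≡𝟘⇒≡ {x = x} {y} eq =
    trans (sym (⊖-⊕-cancel x y)) (trans (cong (_⊕ y) eq) (⊕-identityˡ y))

  ⊙-distribˡ-⊕ : ∀ {n} k (x y : Vec ℤ n) → k ⊙ (x ⊕ y) ≡ k ⊙ x ⊕ k ⊙ y
  ⊙-distribˡ-⊕ k [] [] = refl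
  ⊙-distribˡ-⊕ k (a ∷ x) (b ∷ y) = cong₂ _∷_ (ℤ.*-distribˡ-+ k a b) (⊙-distribˡ-⊕ k x y)

  ⊙-distribʳ-+ : ∀ {n} k l (x : Vec ℤ n) → (k + l) ⊙ x ≡ k ⊙ x ⊕ l ⊙ x
  ⊙-distribʳ-+ k l [] = refl
  ⊙-distribʳ-+ k l (a ∷ x) = cong₂ _∷_ (ℤ.*-distribʳ-+ a k l) (⊙-distribʳ-+ k l x)

  ⊙-assoc : ∀ {n} k l (x : Vec ℤ n) → k ⊙ l ⊙ x ≡ (k * l) ⊙ x
  ⊙-assoc k l [] = refl
  ⊙-assoc k l (a ∷ x) = cong₂ _∷_ (sym (ℤ.*-assoc k l a)) (⊙-assoc k l x)

  ⊙-comm : ∀ {n} k l (x : Vec ℤ n) → k ⊙ l ⊙ x ≡ l ⊙ k ⊙ x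
  ⊙-comm k l x = trans (⊙-assoc k l x) (trans (cong (_⊙ x) (ℤ.*-comm k l)) (sym (⊙-assoc l k x)))

  ⊙-identity : ∀ {n} (x : Vec ℤ n) → 1ℤ ⊙ x ≡ x
  ⊙-identity [] = refl
  ⊙-identity (a ∷ x) = cong₂ _∷_ (ℤ.*-identityˡ a) (⊙-identity x)

  ⊙-zeroˡ : ∀ {n} (x : Vec ℤ n) → 0ℤ ⊙ x ≡ 𝟘
  ⊙-zeroˡ [] = refl
  ⊙-zeroˡ (a ∷ x) = cong (0ℤ ∷_) (⊙-zeroˡ x)

  ⊙-zeroʳ : ∀ {n} k → k ⊙ 𝟘 {n} ≡ 𝟘
  ⊙-zeroʳ {zero}  k = refl
  ⊙-zeroʳ {suc n} k = cong₂ _∷_ (ℤ.*-zeroʳ k) (⊙-zeroʳ k)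

  ⊙-cancelˡ : ∀ {n} k .{{_ : NonZero k}} {x y : Vec ℤ n} → k ⊙ x ≡ k ⊙ y → x ≡ y
  ⊙-cancelˡ k {[]} {[]} _ = refl
  ⊙-cancelˡ k {a ∷ x} {b ∷ y} eq =
    cong₂ _∷_ (ℤ.*-cancelˡ-≡ k a b (cong head eq)) (⊙-cancelˡ k (cong tail eq))

  head∷tail : ∀ {n} (x : Vec ℤ (suc n)) → head x ∷ tail x ≡ x
  head∷tail (_ ∷ _) = refl

  lookup-𝟘 : ∀ {n} (i : Fin n) → lookup 𝟘 i ≡ 0ℤ
  lookup-𝟘 zero    = refl
  lookup-𝟘 (suc i) = lookup-𝟘 i

  lookup-⊕ : ∀ {n} (x y : Vec ℤ n) i → lookup (x ⊕ y) i ≡ lookup x i + lookup y i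
  lookup-⊕ (_ ∷ _) (_ ∷ _) zero    = refl
  lookup-⊕ (_ ∷ x) (_ ∷ y) (suc i) = lookup-⊕ x y i

  lookup-⊙ : ∀ {n} k (x : Vec ℤ n) i → lookup (k ⊙ x) i ≡ k * lookup x i
  lookup-⊙ k (_ ∷ _) zero    = refl
  lookup-⊙ k (_ ∷ x) (suc i) = lookup-⊙ k x i

  -- Families of vectors are functions, so that the columns of a tuple can
  -- be reindexed freely, while vectors have propositional equality.
  comb : ∀ {m n} → (Fin m → Vec ℤ n) → Vec ℤ m → Vec ℤ n
  comb V []       = 𝟘
  comb V (k ∷ ks) = k ⊙ V zero ⊕ comb (V ∘ suc) ks

  comb-cong : ∀ {m n} {V W : Fin m → Vec ℤ n} → (∀ i → V i ≡ W i) → ∀ x → comb V x ≡ comb W x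
  comb-cong eq []       = refl
  comb-cong eq (k ∷ ks) = cong₂ _⊕_ (cong (k ⊙_) (eq zero)) (comb-cong (eq ∘ suc) ks)

  record Linear {m n} (f : Vec ℤ m → Vec ℤ n) : Set where
    field
      homo-⊕ : ∀ x y → f (x ⊕ y) ≡ f x ⊕ f y
      homo-⊙ : ∀ k x → f (k ⊙ x) ≡ k ⊙ f x

    homo-⊖ : ∀ x y → f (x ⊖ y) ≡ f x ⊖ f y
    homo-⊖ x y = begin
      f (x ⊖ y)            ≡⟨ cong f (⊖-as-⊕ x y) ⟩
      f (x ⊕ -1ℤ ⊙ y)      ≡⟨ homo-⊕ x (-1ℤ ⊙ y) ⟩
      f x ⊕ f (-1ℤ ⊙ y)    ≡⟨ cong (f x ⊕_) (homo-⊙ -1ℤ y) ⟩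
      f x ⊕ -1ℤ ⊙ f y      ≡⟨ ⊖-as-⊕ (f x) (f y) ⟨
      f x ⊖ f y            ∎

    homo-𝟘 : f 𝟘 ≡ 𝟘
    homo-𝟘 = begin
      f 𝟘           ≡⟨ cong f (⊙-zeroˡ 𝟘) ⟨
      f (0ℤ ⊙ 𝟘)    ≡⟨ homo-⊙ 0ℤ 𝟘 ⟩
      0ℤ ⊙ f 𝟘      ≡⟨ ⊙-zeroˡ (f 𝟘) ⟩
      𝟘             ∎

    homo-comb : ∀ {l} (V : Fin l → Vec ℤ m) x → f (comb V x) ≡ comb (f ∘ V) x
    homo-comb V []       = homo-𝟘
    homo-comb V (k ∷ ks) = begin
      f (k ⊙ V zero ⊕ comb (V ∘ suc) ks)        ≡⟨ homo-⊕ _ _ ⟩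
      f (k ⊙ V zero) ⊕ f (comb (V ∘ suc) ks)    ≡⟨ cong₂ _⊕_ (homo-⊙ k _) (homo-comb (V ∘ suc) ks) ⟩
      k ⊙ f (V zero) ⊕ comb (f ∘ V ∘ suc) ks    ∎

  comb-linear : ∀ {m n} (V : Fin m → Vec ℤ n) → Linear (comb V)
  comb-linear V = record { homo-⊕ = homo-⊕ V ; homo-⊙ = homo-⊙ V }
    where
    homo-⊕ : ∀ {m n} (V : Fin m → Vec ℤ n) x y → comb V (x ⊕ y) ≡ comb V x ⊕ comb V y
    homo-⊕ V [] [] = sym (⊕-identityˡ 𝟘)
    homo-⊕ V (k ∷ x) (l ∷ y) = begin
      (k + l) ⊙ V zero ⊕ comb (V ∘ suc) (x ⊕ y)
        ≡⟨ cong₂ _⊕_ (⊙-distribʳ-+ k l (V zero)) (homo-⊕ (V ∘ suc) x y) ⟩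
      (k ⊙ V zero ⊕ l ⊙ V zero) ⊕ (comb (V ∘ suc) x ⊕ comb (V ∘ suc) y)
        ≡⟨ ⊕-interchange (k ⊙ V zero) _ _ _ ⟩
      (k ⊙ V zero ⊕ comb (V ∘ suc) x) ⊕ (l ⊙ V zero ⊕ comb (V ∘ suc) y) ∎
    homo-⊙ : ∀ {m n} (V : Fin m → Vec ℤ n) k x → comb V (k ⊙ x) ≡ k ⊙ comb V x
    homo-⊙ V k [] = sym (⊙-zeroʳ k)
    homo-⊙ V k (l ∷ x) = begin
      (k * l) ⊙ V zero ⊕ comb (V ∘ suc) (k ⊙ x)
        ≡⟨ cong₂ _⊕_ (sym (⊙-assoc k l (V zero))) (homo-⊙ (V ∘ suc) k x) ⟩
      k ⊙ l ⊙ V zero ⊕ k ⊙ comb (V ∘ suc) x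
        ≡⟨ ⊙-distribˡ-⊕ k (l ⊙ V zero) (comb (V ∘ suc) x) ⟨
      k ⊙ (l ⊙ V zero ⊕ comb (V ∘ suc) x) ∎

  e : ∀ {n} → Fin n → Vec ℤ n
  e zero    = 1ℤ ∷ 𝟘
  e (suc i) = 0ℤ ∷ e i

  comb-∷0 : ∀ {m n} (V : Fin m → Vec ℤ n) x → comb (λ i → 0ℤ ∷ V i) x ≡ 0ℤ ∷ comb V x
  comb-∷0 V []       = refl
  comb-∷0 V (k ∷ ks) = begin
    (k * 0ℤ ∷ k ⊙ V zero) ⊕ comb (λ i → 0ℤ ∷ V (suc i)) ks
      ≡⟨ cong₂ _⊕_ (cong (_∷ k ⊙ V zero) (ℤ.*-zeroʳ k)) (comb-∷0 (V ∘ suc) ks) ⟩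
    0ℤ ∷ (k ⊙ V zero ⊕ comb (V ∘ suc) ks) ∎

  comb-e : ∀ {n} (x : Vec ℤ n) → comb e x ≡ x
  comb-e []       = refl
  comb-e (k ∷ ks) = begin
    (k * 1ℤ ∷ k ⊙ 𝟘) ⊕ comb (λ i → 0ℤ ∷ e i) ks
      ≡⟨ cong₂ _⊕_ (cong₂ _∷_ (ℤ.*-identityʳ k) (⊙-zeroʳ k)) (comb-∷0 e ks) ⟩
    (k + 0ℤ) ∷ (𝟘 ⊕ comb e ks)
      ≡⟨ cong₂ _∷_ (ℤ.+-identityʳ k) (trans (⊕-identityˡ _) (comb-e ks)) ⟩
    k ∷ ks ∎

  linear-comb : ∀ {m n} {f : Vec ℤ m → Vec ℤ n} → Linear f → ∀ x → f x ≡ comb (f ∘ e) x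
  linear-comb {f = f} f-linear x =
    trans (cong f (sym (comb-e x))) (Linear.homo-comb f-linear e x)

  Injective₀ : ∀ {m n} → (Vec ℤ m → Vec ℤ n) → Set
  Injective₀ f = ∀ x → f x ≡ 𝟘 → x ≡ 𝟘

  -- Elements of GL over ℤ as pairs of mutually inverse functions, so that composition and inversion
  -- need no matrix products. Matrices are only read off at the very end. Linearity of `from`
  -- follows from that of `to`.
  record Iso (n : ℕ) : Set where
    field
      to from : Vec ℤ n → Vec ℤ n
      linear  : Linear to
      to∘from : ∀ x → to (from x) ≡ x
      from∘to : ∀ x → from (to x) ≡ x
    open Linear linear public

    from-linear : Linear from
    from-linear = record
      { homo-⊕ = λ x y → begin
          from (x ⊕ y)                      ≡⟨ cong from (cong₂ _⊕_ (to∘from x) (to∘from y)) ⟨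
          from (to (from x) ⊕ to (from y))  ≡⟨ cong from (homo-⊕ (from x) (from y)) ⟨
          from (to (from x ⊕ from y))       ≡⟨ from∘to _ ⟩
          from x ⊕ from y                   ∎
      ; homo-⊙ = λ k x → begin
          from (k ⊙ x)              ≡⟨ cong (from ∘ (k ⊙_)) (to∘from x) ⟨
          from (k ⊙ to (from x))    ≡⟨ cong from (homo-⊙ k (from x)) ⟨
          from (to (k ⊙ from x))    ≡⟨ from∘to _ ⟩
          k ⊙ from x                ∎
      }

    to-injective : ∀ {x y} → to x ≡ to y → x ≡ y
    to-injective {x} {y} eq = trans (sym (from∘to x)) (trans (cong from eq) (from∘to y))

    to-injective₀ : Injective₀ to
    to-injective₀ x eq = to-injective (trans eq (sym homo-𝟘))

  id-iso : ∀ {n} → Iso n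
  id-iso = record
    { to = λ x → x ; from = λ x → x
    ; linear = record { homo-⊕ = λ _ _ → refl ; homo-⊙ = λ _ _ → refl }
    ; to∘from = λ _ → refl ; from∘to = λ _ → refl }

  _⁻¹ : ∀ {n} → Iso n → Iso n
  T ⁻¹ = record { to = from ; from = to ; linear = from-linear ; to∘from = from∘to ; from∘to = to∘from }
    where open Iso T

  infixr 9 _∙_

  _∙_ : ∀ {n} → Iso n → Iso n → Iso n
  S ∙ T = record
    { to = S.to ∘ T.to ; from = T.from ∘ S.from
    ; linear = record
        { homo-⊕ = λ x y → trans (cong S.to (T.homo-⊕ x y)) (S.homo-⊕ _ _)
        ; homo-⊙ = λ k x → trans (cong S.to (T.homo-⊙ k x)) (S.homo-⊙ k _) }
    ; to∘from = λ x → trans (cong S.to (T.to∘from _)) (S.to∘from x)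
    ; from∘to = λ x → trans (cong T.from (S.from∘to _)) (T.from∘to x) }
    where
    module S = Iso S
    module T = Iso T

  extend : ∀ {n} → Iso n → Iso (suc n)
  extend T = record
    { to = λ x → head x ∷ to (tail x) ; from = λ x → head x ∷ from (tail x)
    ; linear = record
        { homo-⊕ = λ { (_ ∷ _) (_ ∷ _) → cong (_ ∷_) (homo-⊕ _ _) }
        ; homo-⊙ = λ { k (a ∷ x) → cong (k * a ∷_) (homo-⊙ k x) } }
    ; to∘from = λ { (_ ∷ _) → cong (_ ∷_) (to∘from _) }
    ; from∘to = λ { (_ ∷ _) → cong (_ ∷_) (from∘to _) } }
    where open Iso T

  swap-iso : ∀ {n} → Iso (suc (suc n))
  swap-iso = record
    { to = swap ; from = swap
    ; linear = record
        { homo-⊕ = λ { (_ ∷ _ ∷ _) (_ ∷ _ ∷ _) → refl }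
        ; homo-⊙ = λ { _ (_ ∷ _ ∷ _) → refl } }
    ; to∘from = λ { (_ ∷ _ ∷ _) → refl }
    ; from∘to = λ { (_ ∷ _ ∷ _) → refl } }
    where
    swap : ∀ {n} → Vec ℤ (suc (suc n)) → Vec ℤ (suc (suc n))
    swap x = head (tail x) ∷ head x ∷ tail (tail x)

  negate-head : ∀ {n} → Iso (suc n)
  negate-head = record
    { to = negate ; from = negate
    ; linear = record
        { homo-⊕ = λ { (a ∷ _) (b ∷ _) → cong (_∷ _) (ℤ.neg-distrib-+ a b) }
        ; homo-⊙ = λ { k (a ∷ _) → cong (_∷ _) (ℤ.neg-distribʳ-* k a) } }
    ; to∘from = λ { (a ∷ _) → cong (_∷ _) (ℤ.neg-involutive a) }
    ; from∘to = λ { (a ∷ _) → cong (_∷ _) (ℤ.neg-involutive a) } }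
    where
    negate : ∀ {n} → Vec ℤ (suc n) → Vec ℤ (suc n)
    negate x = - head x ∷ tail x

  shear : ∀ {n} → Vec ℤ n → Iso (suc n)
  shear q = record
    { to = λ x → head x ∷ (tail x ⊖ head x ⊙ q)
    ; from = λ x → head x ∷ (tail x ⊕ head x ⊙ q)
    ; linear = record
        { homo-⊕ = λ { (a ∷ x) (b ∷ y) → cong (_ ∷_) (sub-⊕ a b x y q) }
        ; homo-⊙ = λ { k (a ∷ x) → cong (_ ∷_) (sub-⊙ k a x q) } }
    ; to∘from = λ { (a ∷ x) → cong (a ∷_) (⊕-⊖-cancel x (a ⊙ q)) }
    ; from∘to = λ { (a ∷ x) → cong (a ∷_) (⊖-⊕-cancel x (a ⊙ q)) } }
    where
    sub-⊕ : ∀ {n} a b (x y q : Vec ℤ n) →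
            (x ⊕ y) ⊖ (a + b) ⊙ q ≡ (x ⊖ a ⊙ q) ⊕ (y ⊖ b ⊙ q)
    sub-⊕ a b [] [] [] = refl
    sub-⊕ a b (x ∷ xs) (y ∷ ys) (q ∷ qs) = cong₂ _∷_ (lemma a b x y q) (sub-⊕ a b xs ys qs)
      where
      lemma : ∀ a b x y q → (x + y) - (a + b) * q ≡ (x - a * q) + (y - b * q)
      lemma = solve-∀
    sub-⊙ : ∀ {n} k a (x q : Vec ℤ n) → k ⊙ x ⊖ (k * a) ⊙ q ≡ k ⊙ (x ⊖ a ⊙ q)
    sub-⊙ k a [] [] = refl
    sub-⊙ k a (x ∷ xs) (q ∷ qs) = cong₂ _∷_ (lemma k a x q) (sub-⊙ k a xs qs)
      where
      lemma : ∀ k a x q → k * x - (k * a) * q ≡ k * (x - a * q)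
      lemma = solve-∀
    ⊕-⊖-cancel : ∀ {n} (x y : Vec ℤ n) → (x ⊕ y) ⊖ y ≡ x
    ⊕-⊖-cancel [] [] = refl
    ⊕-⊖-cancel (a ∷ x) (b ∷ y) = cong₂ _∷_ (lemma a b) (⊕-⊖-cancel x y)
      where
      lemma : ∀ a b → a + b - b ≡ a
      lemma = solve-∀

  ⊖-⊙𝟘 : ∀ {n} (x : Vec ℤ n) k → x ⊖ k ⊙ 𝟘 ≡ x
  ⊖-⊙𝟘 [] k = refl
  ⊖-⊙𝟘 (a ∷ x) k = cong₂ _∷_ (lemma a k) (⊖-⊙𝟘 x k)
    where
    lemma : ∀ a k → a - k * 0ℤ ≡ a
    lemma = solve-∀

  -- A swap followed by a shear turns the leading pair (x, y) into (y, x % y), and the second entry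
  -- decreases in absolute value. The division step is a separate function because `%` wants an
  -- instance of `NonZero y`, which appears only after matching on the sign of `y`.
  euclid : ∀ {n} x y (z : Vec ℤ n) → Acc ℕ._<_ ∣ y ∣ →
           ∃₂ λ (T : Iso (suc (suc n))) g → Iso.to T (x ∷ y ∷ z) ≡ g ∷ 0ℤ ∷ z
  euclid-step : ∀ {n} x y .{{_ : NonZero y}} (z : Vec ℤ n) →
    (∀ {k} → k ℕ.< ∣ y ∣ → Acc ℕ._<_ k) →
    ∃₂ λ (T : Iso (suc (suc n))) g → Iso.to T (x ∷ y ∷ z) ≡ g ∷ 0ℤ ∷ z

  euclid x (+ 0)        z _        = id-iso , x , refl
  euclid x y@(+[1+ _ ]) z (acc rs) = euclid-step x y z rs
  euclid x y@(-[1+ _ ]) z (acc rs) = euclid-step x y z rs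

  euclid-step x y z rs with euclid y (+ (x % y)) z (rs (n%d<d x y))
  ... | T , g , eq = T ∙ shear (x / y ∷ 𝟘) ∙ swap-iso , g , (begin
    Iso.to T (y ∷ x - y * (x / y) ∷ (z ⊖ y ⊙ 𝟘))
      ≡⟨ cong (λ w → Iso.to T (y ∷ w)) (cong₂ _∷_ remainder (⊖-⊙𝟘 z y)) ⟩
    Iso.to T (y ∷ + (x % y) ∷ z)
      ≡⟨ eq ⟩
    g ∷ 0ℤ ∷ z ∎)
    where
    lemma : ∀ r q y → r + q * y - y * q ≡ r
    lemma = solve-∀
    remainder : x - y * (x / y) ≡ + (x % y)
    remainder = trans (cong (λ t → t - y * (x / y)) (a≡a%n+[a/n]*n x y)) (lemma (+ (x % y)) (x / y) y)

  clear : ∀ {n} (v : Vec ℤ (suc n)) → ∃₂ λ (T : Iso (suc n)) g → Iso.to T v ≡ g ∷ 𝟘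
  clear (x ∷ []) = id-iso , x , refl
  clear (x ∷ w@(_ ∷ _)) with clear w
  ... | S , y , eqS with euclid x y 𝟘 (<-wellFounded ∣ y ∣)
  ... | T , g , eqT = T ∙ extend S , g , trans (cong (λ u → Iso.to T (x ∷ u)) eqS) eqT

  -- There is one vector fewer than the dimension, so they all lie in some hyperplane; a unimodular
  -- map makes it a coordinate hyperplane. This is what lets `hermite` split off a dimension.
  kill-heads : ∀ {n} (V : Fin n → Vec ℤ (suc n)) →
               ∃ λ (T : Iso (suc n)) → ∀ i → head (Iso.to T (V i)) ≡ 0ℤ
  kill-heads {zero}  V = id-iso , λ ()
  kill-heads {suc n} V with clear (V zero)
  ... | S , g , eqS with kill-heads (λ i → tail (Iso.to S (V (suc i))))
  -- After `S` the first vector has only a leading entry, and the recursion clears the second entry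
  -- of the others. The swap moves this cleared second entry to the front.
  ... | T , eqT = swap-iso ∙ extend T ∙ S , λ
    { zero    → trans (cong (head ∘ Iso.to T ∘ tail) eqS) (cong head (Iso.homo-𝟘 T))
    ; (suc i) → eqT i }

-- Hermite normal forms and the cosets of the lattices they generate.

module TriangularMatrices where

  open import Data.Nat.Base as ℕ using (ℕ; zero; suc)
  import Data.Nat.Properties as ℕ
  open import Data.Integer.Base hiding (suc; _⊔_; _⊖_)
  import Data.Integer.Properties as ℤ
  open import Data.Integer.DivMod using (_/ℕ_; _%ℕ_; a≡a%ℕn+[a/ℕn]*n; n%ℕd<d)
  open import Data.Integer.Tactic.RingSolver using (solve-∀)
  open import Data.Fin.Base using (Fin; zero; suc; toℕ; fromℕ<; combine; quotient; remainder)
  open import Data.Fin.Properties using (toℕ<n; toℕ-fromℕ<; toℕ-injective; remQuot-combine; combine-remQuot; injective⇒≤)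
  open import Data.Product.Base using (∃; ∃₂; _×_; _,_; proj₁; proj₂)
  open import Data.Vec.Base using (Vec; []; _∷_; head; tail; map)
  open import Function.Base using (_∘_)
  open import Relation.Binary.PropositionalEquality
  open import Relation.Nullary using (yes; no; contradiction)
  open ≡-Reasoning
  open IntegerLinearAlgebra

  -- Lower triangular matrices in Hermite normal form: tri h r H has first
  -- diagonal entry suc h, and below it the column r, reduced modulo suc h.
  data Tri : ℕ → Set where
    []  : Tri 0
    tri : ∀ {d} (h : ℕ) (r : Vec (Fin (suc h)) d) (H : Tri d) → Tri (suc d)

  toℤs : ∀ {h d} → Vec (Fin h) d → Vec ℤ d
  toℤs = map (λ i → + toℕ i)

  apply : ∀ {d} → Tri d → Vec ℤ d → Vec ℤ d
  apply []          []       = []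
  apply (tri h r H) (x ∷ xs) = +[1+ h ] * x ∷ (x ⊙ toℤs r ⊕ apply H xs)

  det : ∀ {d} → Tri d → ℕ
  det []          = 1
  det (tri h _ H) = suc h ℕ.* det H

  det-nonZero : ∀ {d} (H : Tri d) → ℕ.NonZero (det H)
  det-nonZero []          = _
  det-nonZero (tri h _ H) = ℕ.m*n≢0 (suc h) (det H) {{_}} {{det-nonZero H}}

  apply-linear : ∀ {d} (H : Tri d) → Linear (apply H)
  apply-linear H = record { homo-⊕ = homo-⊕ H ; homo-⊙ = homo-⊙ H }
    where
    homo-⊕ : ∀ {d} (H : Tri d) x y → apply H (x ⊕ y) ≡ apply H x ⊕ apply H y
    homo-⊕ [] [] [] = refl
    homo-⊕ (tri h r H) (x ∷ xs) (y ∷ ys) = cong₂ _∷_ (ℤ.*-distribˡ-+ +[1+ h ] x y) (begin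
      (x + y) ⊙ toℤs r ⊕ apply H (xs ⊕ ys)
        ≡⟨ cong₂ _⊕_ (⊙-distribʳ-+ x y (toℤs r)) (homo-⊕ H xs ys) ⟩
      (x ⊙ toℤs r ⊕ y ⊙ toℤs r) ⊕ (apply H xs ⊕ apply H ys)
        ≡⟨ ⊕-interchange (x ⊙ toℤs r) _ _ _ ⟩
      (x ⊙ toℤs r ⊕ apply H xs) ⊕ (y ⊙ toℤs r ⊕ apply H ys) ∎)
    homo-⊙ : ∀ {d} (H : Tri d) k x → apply H (k ⊙ x) ≡ k ⊙ apply H x
    homo-⊙ [] k [] = refl
    homo-⊙ (tri h r H) k (x ∷ xs) = cong₂ _∷_ (lemma +[1+ h ] k x) (begin
      (k * x) ⊙ toℤs r ⊕ apply H (k ⊙ xs)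
        ≡⟨ cong₂ _⊕_ (sym (⊙-assoc k x (toℤs r))) (homo-⊙ H k xs) ⟩
      k ⊙ x ⊙ toℤs r ⊕ k ⊙ apply H xs
        ≡⟨ ⊙-distribˡ-⊕ k (x ⊙ toℤs r) (apply H xs) ⟨
      k ⊙ (x ⊙ toℤs r ⊕ apply H xs) ∎)
      where
      lemma : ∀ h k x → h * (k * x) ≡ k * (h * x)
      lemma = solve-∀

  apply-injective : ∀ {d} (H : Tri d) {x y} → apply H x ≡ apply H y → x ≡ y
  apply-injective []          {[]} {[]} _ = refl
  apply-injective (tri h r H) {x ∷ xs} {y ∷ ys} eq
    with refl ← ℤ.*-cancelˡ-≡ +[1+ h ] x y (cong head eq) =
    cong (x ∷_) (apply-injective H (⊕-cancelˡ (x ⊙ toℤs r) (cong tail eq)))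

  -- The adjugate det H · H⁻¹, computed by forward substitution: the integral substitute for the
  -- inverse.
  adj : ∀ {d} → Tri d → Vec ℤ d → Vec ℤ d
  adj []          []       = []
  adj (tri h r H) (y ∷ ys) = + det H * y ∷ adj H (+[1+ h ] ⊙ ys ⊖ y ⊙ toℤs r)

  apply-adj : ∀ {d} (H : Tri d) y → apply H (adj H y) ≡ + det H ⊙ y
  apply-adj []          []       = refl
  apply-adj (tri h r H) (y ∷ ys) = cong₂ _∷_ head-eq (begin
    (+ det H * y) ⊙ toℤs r ⊕ apply H (adj H (+[1+ h ] ⊙ ys ⊖ y ⊙ toℤs r))
      ≡⟨ cong ((+ det H * y) ⊙ toℤs r ⊕_) (apply-adj H _) ⟩
    (+ det H * y) ⊙ toℤs r ⊕ + det H ⊙ (+[1+ h ] ⊙ ys ⊖ y ⊙ toℤs r)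
      ≡⟨ expand (+ det H) y +[1+ h ] (toℤs r) ys ⟩
    (+[1+ h ] * + det H) ⊙ ys
      ≡⟨ cong (_⊙ ys) (sym (ℤ.pos-* (suc h) (det H))) ⟩
    + (suc h ℕ.* det H) ⊙ ys ∎)
    where
    head-eq : +[1+ h ] * (+ det H * y) ≡ + (suc h ℕ.* det H) * y
    head-eq = trans (sym (ℤ.*-assoc +[1+ h ] (+ det H) y)) (cong (_* y) (sym (ℤ.pos-* (suc h) (det H))))
    expand : ∀ {n} m y h (r ys : Vec ℤ n) → (m * y) ⊙ r ⊕ m ⊙ (h ⊙ ys ⊖ y ⊙ r) ≡ (h * m) ⊙ ys
    expand m y h []       []       = refl
    expand m y h (r ∷ rs) (z ∷ zs) = cong₂ _∷_ (lemma m y h r z) (expand m y h rs zs)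
      where
      lemma : ∀ m y h r z → m * y * r + m * (h * z - y * r) ≡ h * m * z
      lemma = solve-∀

  adj-unique : ∀ {d} (H : Tri d) {x y} → apply H x ≡ + det H ⊙ y → x ≡ adj H y
  adj-unique H {x} {y} eq = apply-injective H (trans eq (sym (apply-adj H y)))

  adj-apply : ∀ {d} (H : Tri d) x → adj H (apply H x) ≡ + det H ⊙ x
  adj-apply H x = sym (adj-unique H (Linear.homo-⊙ (apply-linear H) (+ det H) x))

  adj-linear : ∀ {d} (H : Tri d) → Linear (adj H)
  adj-linear H = record
    { homo-⊕ = λ x y → sym (adj-unique H (begin
        apply H (adj H x ⊕ adj H y)              ≡⟨ homo-⊕ _ _ ⟩
        apply H (adj H x) ⊕ apply H (adj H y)    ≡⟨ cong₂ _⊕_ (apply-adj H x) (apply-adj H y) ⟩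
        + det H ⊙ x ⊕ + det H ⊙ y                ≡⟨ ⊙-distribˡ-⊕ (+ det H) x y ⟨
        + det H ⊙ (x ⊕ y)                        ∎))
    ; homo-⊙ = λ k x → sym (adj-unique H (begin
        apply H (k ⊙ adj H x)    ≡⟨ homo-⊙ k (adj H x) ⟩
        k ⊙ apply H (adj H x)    ≡⟨ cong (k ⊙_) (apply-adj H x) ⟩
        k ⊙ + det H ⊙ x          ≡⟨ ⊙-comm k (+ det H) x ⟩
        + det H ⊙ k ⊙ x          ∎)) }
    where open Linear (apply-linear H)

  -- The integer box whose sides are the diagonal entries represents ℤᵈ modulo the columns of `H`;
  -- hence `det H` is the index of the lattice. `red` finds the representative by dividing one
  -- coordinate after the other.
  rep : ∀ {d} (H : Tri d) → Fin (det H) → Vec ℤ d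
  rep []          _ = []
  rep (tri h r H) i = + toℕ (quotient {suc h} (det H) i) ∷ rep H (remainder {suc h} (det H) i)

  red : ∀ {d} (H : Tri d) → Vec ℤ d → Fin (det H)
  red []          _        = zero
  red (tri h r H) (y ∷ ys) =
    combine (fromℕ< (n%ℕd<d y (suc h))) (red H (ys ⊖ (y /ℕ suc h) ⊙ toℤs r))

  rep-red : ∀ {d} (H : Tri d) y → ∃ λ q → y ≡ rep H (red H y) ⊕ apply H q
  rep-red []          []       = [] , refl
  rep-red (tri h r H) (y ∷ ys) with rep-red H (ys ⊖ (y /ℕ suc h) ⊙ toℤs r)
  ... | q , eq = y /ℕ suc h ∷ q , sym (begin
    (+ toℕ (quotient {suc h} (det H) i) ∷ rep H (remainder {suc h} (det H) i)) ⊕ apply (tri h r H) (q₀ ∷ q)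
      ≡⟨ cong (λ p → (+ toℕ (proj₁ p) ∷ rep H (proj₂ p)) ⊕ apply (tri h r H) (q₀ ∷ q)) (remQuot-combine a b) ⟩
    + toℕ a + +[1+ h ] * q₀ ∷ (rep H b ⊕ (q₀ ⊙ toℤs r ⊕ apply H q))
      ≡⟨ cong₂ _∷_ head-eq tail-eq ⟩
    y ∷ ys ∎)
    where
    q₀ = y /ℕ suc h
    a  = fromℕ< (n%ℕd<d y (suc h))
    b  = red H (ys ⊖ q₀ ⊙ toℤs r)
    i  = combine a b
    head-eq : + toℕ a + +[1+ h ] * q₀ ≡ y
    head-eq = begin
      + toℕ a + +[1+ h ] * q₀         ≡⟨ cong₂ _+_ (cong +_ (toℕ-fromℕ< (n%ℕd<d y (suc h)))) (ℤ.*-comm +[1+ h ] q₀) ⟩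
      + (y %ℕ suc h) + q₀ * +[1+ h ]  ≡⟨ a≡a%ℕn+[a/ℕn]*n y (suc h) ⟨
      y                               ∎
    tail-eq : rep H b ⊕ (q₀ ⊙ toℤs r ⊕ apply H q) ≡ ys
    tail-eq = begin
      rep H b ⊕ (q₀ ⊙ toℤs r ⊕ apply H q)    ≡⟨ cong (rep H b ⊕_) (⊕-comm (q₀ ⊙ toℤs r) (apply H q)) ⟩
      rep H b ⊕ (apply H q ⊕ q₀ ⊙ toℤs r)    ≡⟨ ⊕-assoc (rep H b) (apply H q) _ ⟨
      rep H b ⊕ apply H q ⊕ q₀ ⊙ toℤs r      ≡⟨ cong (_⊕ q₀ ⊙ toℤs r) eq ⟨
      (ys ⊖ q₀ ⊙ toℤs r) ⊕ q₀ ⊙ toℤs r       ≡⟨ ⊖-⊕-cancel ys _ ⟩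
      ys                                     ∎

  red-≡⇒ : ∀ {d} (H : Tri d) {x y} → red H x ≡ red H y → ∃ λ t → x ≡ y ⊕ apply H t
  red-≡⇒ H {x} {y} eq with rep-red H x | rep-red H y
  ... | q , eqx | p , eqy = q ⊖ p , (begin
    x                                                    ≡⟨ eqx ⟩
    rep H (red H x) ⊕ apply H q                          ≡⟨ cong (λ i → rep H i ⊕ apply H q) eq ⟩
    rep H (red H y) ⊕ apply H q                          ≡⟨ shift (rep H (red H y)) (apply H q) (apply H p) ⟩
    (rep H (red H y) ⊕ apply H p) ⊕ (apply H q ⊖ apply H p)
      ≡⟨ cong₂ _⊕_ eqy (Linear.homo-⊖ (apply-linear H) q p) ⟨
    y ⊕ apply H (q ⊖ p)                                  ∎)
    where
    shift : ∀ {n} (a b c : Vec ℤ n) → a ⊕ b ≡ (a ⊕ c) ⊕ (b ⊖ c)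
    shift [] [] [] = refl
    shift (a ∷ as) (b ∷ bs) (c ∷ cs) = cong₂ _∷_ (lemma a b c) (shift as bs cs)
      where
      lemma : ∀ a b c → a + b ≡ a + c + (b - c)
      lemma = solve-∀

  residue-unique : ∀ {h} (a b : Fin (suc h)) t → + toℕ a ≡ + toℕ b + +[1+ h ] * t → a ≡ b × t ≡ 0ℤ
  residue-unique {h} a b (+ zero) eq = toℕ-injective (ℤ.+-injective (trans eq
    (trans (cong (λ z → + toℕ b + z) (ℤ.*-zeroʳ +[1+ h ])) (ℤ.+-identityʳ _)))) , refl
  residue-unique {h} a b +[1+ t ] eq = contradiction (toℕ<n a) (ℕ.≤⇒≯ large)
    where
    large : suc h ℕ.≤ toℕ a
    large = subst (suc h ℕ.≤_) (sym (ℤ.+-injective eq))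
      (ℕ.≤-trans (ℕ.m≤m*n (suc h) (suc t)) (ℕ.m≤n+m _ (toℕ b)))
  residue-unique {h} a b -[1+ t ] eq = contradiction (toℕ<n b) (ℕ.≤⇒≯ large)
    where
    lemma : ∀ b h t → b + h * (- t) + h * t ≡ b
    lemma = solve-∀
    eq′ : + (toℕ a ℕ.+ suc h ℕ.* suc t) ≡ + toℕ b
    eq′ = begin
      + toℕ a + +[1+ h ] * +[1+ t ]                          ≡⟨ cong (_+ +[1+ h ] * +[1+ t ]) eq ⟩
      + toℕ b + +[1+ h ] * -[1+ t ] + +[1+ h ] * +[1+ t ]    ≡⟨ lemma (+ toℕ b) +[1+ h ] +[1+ t ] ⟩
      + toℕ b                                                ∎
    large : suc h ℕ.≤ toℕ b
    large = subst (suc h ℕ.≤_) (ℤ.+-injective eq′)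
      (ℕ.≤-trans (ℕ.m≤m*n (suc h) (suc t)) (ℕ.m≤n+m _ (toℕ a)))

  -- The leading entries are residues modulo the same diagonal entry, so they agree and the leading
  -- coefficient of `t` is 0. The first column then contributes nothing, and the question passes to
  -- the smaller form.
  rep-unique : ∀ {d} (H : Tri d) i j t → rep H i ≡ rep H j ⊕ apply H t → i ≡ j
  rep-unique []          zero zero _ _ = refl
  rep-unique (tri h r H) i j (t ∷ ts) eq
    with residue-unique (quotient {suc h} (det H) i) (quotient {suc h} (det H) j) t (cong head eq)
  ... | eq₀ , refl = begin
    i                                        ≡⟨ combine-remQuot {suc h} (det H) i ⟨
    combine (quotient {suc h} (det H) i) i′  ≡⟨ cong₂ combine eq₀ eq₁ ⟩
    combine (quotient {suc h} (det H) j) j′  ≡⟨ combine-remQuot {suc h} (det H) j ⟩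
    j                                        ∎
    where
    i′ = remainder {suc h} (det H) i
    j′ = remainder {suc h} (det H) j
    eq₁ : i′ ≡ j′
    eq₁ = rep-unique H i′ j′ ts (trans (cong tail eq) (cong (rep H j′ ⊕_)
      (trans (cong (_⊕ apply H ts) (⊙-zeroˡ (toℤs r))) (⊕-identityˡ _))))

  -- A sublattice has at least as many cosets.
  det-mono : ∀ {d} (H H′ : Tri d) (T : Iso d) →
             (∀ y → ∃ λ x → Iso.to T (apply H′ y) ≡ apply H x) → det H ℕ.≤ det H′
  -- Representatives for `H`, pulled back by `T`, stay inequivalent modulo `H′`: a congruence modulo
  -- the sublattice would also hold modulo the larger lattice.
  det-mono H H′ T sub = injective⇒≤ {f = λ i → red H′ (from (rep H i))} injective
    where
    open Iso T
    injective : ∀ {i j} → red H′ (from (rep H i)) ≡ red H′ (from (rep H j)) → i ≡ j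
    injective {i} {j} eq with red-≡⇒ H′ eq
    ... | t , eqt with sub t
    ... | x , eqx = rep-unique H i j x (begin
      rep H i                                ≡⟨ to∘from _ ⟨
      to (from (rep H i))                    ≡⟨ cong to eqt ⟩
      to (from (rep H j) ⊕ apply H′ t)       ≡⟨ homo-⊕ _ _ ⟩
      to (from (rep H j)) ⊕ to (apply H′ t)  ≡⟨ cong₂ _⊕_ (to∘from _) eqx ⟩
      rep H j ⊕ apply H x                    ∎)

  -- A shear by the quotients reduces the column modulo its leading entry, after a change of sign if
  -- that entry is negative. Both maps fix vectors with leading entry 0, so the columns already
  -- brought into Hermite form are not disturbed.
  reduce-column : ∀ {d} a .{{_ : NonZero a}} (c : Vec ℤ d) →
    ∃ λ (S : Iso (suc d)) → ∃₂ λ h (r : Vec (Fin (suc h)) d) →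
      suc h ≡ ∣ a ∣ × Iso.to S (a ∷ c) ≡ +[1+ h ] ∷ toℤs r × (∀ y → Iso.to S (0ℤ ∷ y) ≡ 0ℤ ∷ y)
  reduce-column +[1+ h ] c =
    shear (map (_/ℕ suc h) c) , h , map (λ x → fromℕ< (n%ℕd<d x (suc h))) c ,
    refl , cong (+[1+ h ] ∷_) (residues c) , λ y → cong (0ℤ ∷_) (fixed y (map (_/ℕ suc h) c))
    where
    residues : ∀ {d} (c : Vec ℤ d) →
      c ⊖ +[1+ h ] ⊙ map (_/ℕ suc h) c ≡ toℤs (map (λ x → fromℕ< (n%ℕd<d x (suc h))) c)
    residues []      = refl
    residues (x ∷ c) = cong₂ _∷_ (begin
      x - +[1+ h ] * (x /ℕ suc h)
        ≡⟨ cong (λ z → z - +[1+ h ] * (x /ℕ suc h)) (a≡a%ℕn+[a/ℕn]*n x (suc h)) ⟩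
      + (x %ℕ suc h) + (x /ℕ suc h) * +[1+ h ] - +[1+ h ] * (x /ℕ suc h)
        ≡⟨ lemma (+ (x %ℕ suc h)) (x /ℕ suc h) +[1+ h ] ⟩
      + (x %ℕ suc h)
        ≡⟨ cong +_ (toℕ-fromℕ< (n%ℕd<d x (suc h))) ⟨
      + toℕ (fromℕ< (n%ℕd<d x (suc h))) ∎) (residues c)
      where
      lemma : ∀ r q h → r + q * h - h * q ≡ r
      lemma = solve-∀
    fixed : ∀ {d} (y q : Vec ℤ d) → y ⊖ 0ℤ ⊙ q ≡ y
    fixed []      []      = refl
    fixed (y ∷ ys) (q ∷ qs) = cong₂ _∷_ (ℤ.+-identityʳ y) (fixed ys qs)
  reduce-column -[1+ h ] c with reduce-column +[1+ h ] c
  ... | S , h′ , r , eqh , eqS , fixS = S ∙ negate-head , h′ , r , eqh , eqS , fixS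

  -- Serves both for building Hermite forms and for the exchange of a basis vector. In the exchange,
  -- the formula for the determinant compares two first columns over the same lower block `H`.
  assemble : ∀ {d} (V : Fin (suc d) → Vec ℤ (suc d)) (T : Iso d) (H : Tri d) →
    .{{_ : NonZero (head (V zero))}} → (∀ i → head (V (suc i)) ≡ 0ℤ) →
    (∀ x → Iso.to T (comb (tail ∘ V ∘ suc) x) ≡ apply H x) →
    ∃ λ (S : Iso (suc d)) → ∃ λ (H′ : Tri (suc d)) →
      det H′ ≡ ∣ head (V zero) ∣ ℕ.* det H × (∀ x → Iso.to S (comb V x) ≡ apply H′ x)
  assemble {d} V T H heads eqT with reduce-column (head (V zero)) (Iso.to T (tail (V zero)))
  ... | S , h , r , eqh , eqS , fixS = S ∙ extend T , tri h r H , cong (ℕ._* det H) eqh , λ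
    { (x ∷ xs) → begin
      to (head (x ⊙ V zero ⊕ comb (V ∘ suc) xs) ∷ Iso.to T (tail (x ⊙ V zero ⊕ comb (V ∘ suc) xs)))
        ≡⟨ cong (λ v → to (head v ∷ Iso.to T (tail v))) (split x xs) ⟩
      to (x * head (V zero) + 0ℤ ∷ Iso.to T (x ⊙ tail (V zero) ⊕ comb V′ xs))
        ≡⟨ cong (λ v → to (x * head (V zero) + 0ℤ ∷ v))
             (trans (Iso.homo-⊕ T _ _) (cong₂ _⊕_ (Iso.homo-⊙ T x _) (eqT xs))) ⟩
      to (x ⊙ (head (V zero) ∷ Iso.to T (tail (V zero))) ⊕ (0ℤ ∷ apply H xs))
        ≡⟨ trans (homo-⊕ _ _) (cong₂ _⊕_ (trans (homo-⊙ x _) (cong (x ⊙_) eqS)) (fixS _)) ⟩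
      x ⊙ (+[1+ h ] ∷ toℤs r) ⊕ (0ℤ ∷ apply H xs)
        ≡⟨ cong (_∷ (x ⊙ toℤs r ⊕ apply H xs)) (trans (ℤ.+-identityʳ _) (ℤ.*-comm x +[1+ h ])) ⟩
      apply (tri h r H) (x ∷ xs) ∎ }
    where
    open Iso S
    V′ : Fin d → Vec ℤ d
    V′ = tail ∘ V ∘ suc
    zero-heads : ∀ xs → comb (V ∘ suc) xs ≡ 0ℤ ∷ comb V′ xs
    zero-heads xs = trans
      (comb-cong (λ i → trans (sym (head∷tail _)) (cong (_∷ V′ i) (heads i))) xs) (comb-∷0 V′ xs)
    split : ∀ x xs → x ⊙ V zero ⊕ comb (V ∘ suc) xs ≡
                     x * head (V zero) + 0ℤ ∷ (x ⊙ tail (V zero) ⊕ comb V′ xs)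
    split x xs = cong₂ _⊕_ (cong (x ⊙_) (sym (head∷tail (V zero)))) (zero-heads xs)

  -- All operations act on the target, none on the columns. The same coefficient vector `x`
  -- therefore occurs on both sides, and coordinates with respect to `V` can be computed from `H`.
  hermite : ∀ {d} (V : Fin d → Vec ℤ d) → Injective₀ (comb V) →
            ∃₂ λ (T : Iso d) (H : Tri d) → ∀ x → Iso.to T (comb V x) ≡ apply H x
  hermite {zero}  V inj = id-iso , [] , λ { [] → refl }
  hermite {suc d} V inj with kill-heads (V ∘ suc)
  ... | S , heads = finish (hermite V′ inj′)
    where
    open Iso S
    W : Fin (suc d) → Vec ℤ (suc d)
    W = to ∘ V
    V′ : Fin d → Vec ℤ d
    V′ = tail ∘ W ∘ suc
    W-injective : Injective₀ (comb W)
    W-injective x eq = inj x (to-injective₀ _ (trans (homo-comb V x) eq))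
    W-suc : ∀ y → comb (W ∘ suc) y ≡ 0ℤ ∷ comb V′ y
    W-suc y = trans
      (comb-cong (λ i → trans (sym (head∷tail _)) (cong (_∷ V′ i) (heads i))) y) (comb-∷0 V′ y)
    inj′ : Injective₀ (comb V′)
    inj′ y eq = cong tail (W-injective (0ℤ ∷ y) (begin
      0ℤ ⊙ W zero ⊕ comb (W ∘ suc) y    ≡⟨ cong₂ _⊕_ (⊙-zeroˡ (W zero)) (W-suc y) ⟩
      𝟘 ⊕ (0ℤ ∷ comb V′ y)              ≡⟨ ⊕-identityˡ _ ⟩
      0ℤ ∷ comb V′ y                    ≡⟨ cong (0ℤ ∷_) eq ⟩
      𝟘                                 ∎))
    finish : (∃₂ λ (T : Iso d) (H : Tri d) → ∀ x → Iso.to T (comb V′ x) ≡ apply H x) →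
             ∃₂ λ (T : Iso (suc d)) (H : Tri (suc d)) → ∀ x → Iso.to T (comb V x) ≡ apply H x
    finish (T , H , eqT) with head (W zero) ℤ.≟ 0ℤ
    ... | no a≢0 with assemble W T H {{≢-nonZero a≢0}} heads eqT
    ...   | R , H′ , _ , eqR = R ∙ S , H′ , λ x → trans (cong (Iso.to R) (homo-comb V x)) (eqR x)
    -- Otherwise W zero = (0 , w), and det H · w is a combination of V'.
    finish (T , H , eqT) | yes a≡0 = contradiction (cong head (W-injective (+ det H ∷ y) dependent)) det≢0
      where
      det≢0 : + det H ≢ 0ℤ
      det≢0 = ℕ.≢-nonZero⁻¹ (det H) {{det-nonZero H}} ∘ ℤ.+-injective
      w = tail (W zero)
      y = -1ℤ ⊙ adj H (Iso.to T w)
      combV′ : comb V′ y ≡ -1ℤ ⊙ + det H ⊙ w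
      combV′ = Iso.to-injective T (begin
        Iso.to T (comb V′ y)                        ≡⟨ eqT y ⟩
        apply H y                                   ≡⟨ Linear.homo-⊙ (apply-linear H) -1ℤ _ ⟩
        -1ℤ ⊙ apply H (adj H (Iso.to T w))          ≡⟨ cong (-1ℤ ⊙_) (apply-adj H _) ⟩
        -1ℤ ⊙ + det H ⊙ Iso.to T w                  ≡⟨ cong (-1ℤ ⊙_) (Iso.homo-⊙ T (+ det H) w) ⟨
        -1ℤ ⊙ Iso.to T (+ det H ⊙ w)                ≡⟨ Iso.homo-⊙ T -1ℤ _ ⟨
        Iso.to T (-1ℤ ⊙ + det H ⊙ w)                ∎)
      dependent : comb W (+ det H ∷ y) ≡ 𝟘
      dependent = begin
        + det H ⊙ W zero ⊕ comb (W ∘ suc) y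
          ≡⟨ cong₂ _⊕_ (cong (+ det H ⊙_) (trans (sym (head∷tail (W zero))) (cong (_∷ w) a≡0))) (W-suc y) ⟩
        + det H * 0ℤ + 0ℤ ∷ (+ det H ⊙ w ⊕ comb V′ y)
          ≡⟨ cong₂ _∷_ (trans (ℤ.+-identityʳ _) (ℤ.*-zeroʳ (+ det H))) (begin
               + det H ⊙ w ⊕ comb V′ y               ≡⟨ cong (+ det H ⊙ w ⊕_) combV′ ⟩
               + det H ⊙ w ⊕ -1ℤ ⊙ + det H ⊙ w       ≡⟨ ⊖-as-⊕ _ _ ⟨
               + det H ⊙ w ⊖ + det H ⊙ w             ≡⟨ ⊖-self _ ⟩
               𝟘                                     ∎) ⟩
        𝟘 ∎

-- The bound d! on the index: counting points of ℓ¹ balls and packing them.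

module Minkowski where

  open import Data.Nat.Base
  open import Data.Nat.Properties
  open import Data.Nat.Tactic.RingSolver using (solve-∀)
  import Data.Integer.Base as ℤ
  open ℤ using (ℤ; +_; -[1+_]; +[1+_]; 0ℤ; -1ℤ; ∣_∣)
  import Data.Integer.Properties as ℤ
  import Data.Integer.Tactic.RingSolver as ℤ-Solver
  open import Data.Empty using (⊥)
  open import Data.Unit.Base using (⊤; tt)
  open import Data.Fin.Base using (Fin; zero; suc; splitAt; combine; quotient; remainder; _↑ˡ_; _↑ʳ_)
  open import Data.Fin.Properties using (combine-remQuot; injective⇒≤; join-splitAt)
  open import Data.Product.Base using (_×_; _,_; proj₁; proj₂)
  open import Data.Sum.Base using (_⊎_; inj₁; inj₂; [_,_]′)
  open import Data.Vec.Base using (Vec; []; _∷_; head; tail; replicate)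
  open import Function.Base using (_∘_; id)
  open import Relation.Binary.PropositionalEquality
  open import Relation.Nullary using (contradiction)
  open IntegerLinearAlgebra
  open TriangularMatrices

  norm : ∀ {d} → Vec ℤ d → ℕ
  norm []      = 0
  norm (a ∷ x) = ∣ a ∣ + norm x

  norm-𝟘 : ∀ {d} → norm (𝟘 {d}) ≡ 0
  norm-𝟘 {zero}  = refl
  norm-𝟘 {suc d} = norm-𝟘 {d}

  norm-⊖ : ∀ {d} (x y : Vec ℤ d) → norm (x ⊖ y) ≤ norm x + norm y
  norm-⊖ []      []      = z≤n
  norm-⊖ (a ∷ x) (b ∷ y) = begin
    ∣ a ℤ.- b ∣ + norm (x ⊖ y)                ≤⟨ +-mono-≤ (ℤ.∣i-j∣≤∣i∣+∣j∣ a b) (norm-⊖ x y) ⟩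
    (∣ a ∣ + ∣ b ∣) + (norm x + norm y)       ≡⟨ lemma ∣ a ∣ ∣ b ∣ (norm x) (norm y) ⟩
    (∣ a ∣ + norm x) + (∣ b ∣ + norm y)       ∎
    where
    open ≤-Reasoning
    lemma : ∀ a b c d → (a + b) + (c + d) ≡ (a + c) + (b + d)
    lemma = solve-∀

  record Many {A : Set} (P : A → Set) (n : ℕ) : Set where
    field
      elt       : Fin n → A
      injective : ∀ {i j} → elt i ≡ elt j → i ≡ j
      sat       : ∀ i → P (elt i)

  many-image : ∀ {A B : Set} {P : A → Set} {Q : B → Set} {n} (f : A → B) →
    (∀ {x y} → f x ≡ f y → x ≡ y) → (∀ x → P x → Q (f x)) → Many P n → Many Q n
  many-image f f-injective PQ M = record
    { elt = f ∘ elt ; injective = injective ∘ f-injective ; sat = λ i → PQ (elt i) (sat i) }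
    where open Many M

  many-⊎ : ∀ {A : Set} {P Q : A → Set} {m n} → (∀ x → P x → Q x → ⊥) →
    Many P m → Many Q n → Many (λ x → P x ⊎ Q x) (m + n)
  many-⊎ {A} {P} {Q} {m} {n} disjoint M N = record
    { elt       = elt ∘ splitAt m
    ; injective = λ {i} {j} eq → trans (sym (join-splitAt m n i))
        (trans (cong [ _↑ˡ n , m ↑ʳ_ ]′ (elt-injective (splitAt m i) (splitAt m j) eq)) (join-splitAt m n j))
    ; sat       = λ i → sat (splitAt m i) }
    where
    module M = Many M
    module N = Many N
    elt : Fin m ⊎ Fin n → A
    elt = [ M.elt , N.elt ]′
    elt-injective : ∀ s t → elt s ≡ elt t → s ≡ t
    elt-injective (inj₁ i) (inj₁ j) eq = cong inj₁ (M.injective eq)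
    elt-injective (inj₁ i) (inj₂ j) eq = contradiction (N.sat j) (disjoint _ (subst P eq (M.sat i)))
    elt-injective (inj₂ i) (inj₁ j) eq = contradiction (subst Q eq (N.sat i)) (disjoint _ (M.sat j))
    elt-injective (inj₂ i) (inj₂ j) eq = cong inj₂ (N.injective eq)
    sat : ∀ s → P (elt s) ⊎ Q (elt s)
    sat (inj₁ i) = inj₁ (M.sat i)
    sat (inj₂ j) = inj₂ (N.sat j)

  -- The Delannoy numbers.
  D : ℕ → ℕ → ℕ
  D zero    n       = 1
  D (suc d) zero    = 1
  D (suc d) (suc n) = D (suc d) n + (D d (suc n) + D d n)

  -- Moves every integer one step away from -1/2. The absolute value grows by exactly 1, and
  -- precisely the values 0 and -1 are missed.
  bump : ℤ → ℤ
  bump (+ n)    = +[1+ n ]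
  bump -[1+ n ] = -[1+ suc n ]

  bump-injective : ∀ {a b} → bump a ≡ bump b → a ≡ b
  bump-injective {+ _}      {+ _}      refl = refl
  bump-injective { -[1+ _ ]} { -[1+ _ ]} refl = refl

  -- The three terms of the Delannoy recurrence sort points by their first coordinate. Outside 0 and
  -- -1 it is a `bump`, which costs radius 1 in the same dimension; at 0 the full radius remains for
  -- the other coordinates, and at -1 one less.
  ball : ∀ d n → Many (λ (x : Vec ℤ d) → norm x ≤ n) (D d n)
  ball zero    n    = record
    { elt = λ _ → [] ; injective = λ { {zero} {zero} _ → refl } ; sat = λ _ → z≤n }
  ball (suc d) zero = record
    { elt = λ _ → 𝟘 ; injective = λ { {zero} {zero} _ → refl } ; sat = λ _ → ≤-reflexive (norm-𝟘 {suc d}) }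
  ball (suc d) (suc n) = many-image id id (λ _ → [ proj₂ , [ proj₂ , proj₂ ]′ ]′)
    (many-⊎ far-near (many-image push push-injective push-far (ball (suc d) n))
      (many-⊎ (λ x p q → zero-one x (proj₁ p) (proj₁ q))
        (many-image (0ℤ ∷_) (cong tail) (λ _ le → refl , le) (ball d (suc n)))
        (many-image (-1ℤ ∷_) (cong tail) (λ _ le → refl , s≤s le) (ball d n))))
    where
    push : ∀ {d} → Vec ℤ (suc d) → Vec ℤ (suc d)
    push (a ∷ x) = bump a ∷ x
    push-injective : ∀ {d} {x y : Vec ℤ (suc d)} → push x ≡ push y → x ≡ y
    push-injective {x = a ∷ x} {b ∷ y} eq = cong₂ _∷_ (bump-injective (cong head eq)) (cong tail eq)
    Far : ℤ → Set
    Far +[1+ _ ]     = ⊤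
    Far -[1+ suc _ ] = ⊤
    Far _            = ⊥
    push-far : ∀ (x : Vec ℤ (suc d)) → norm x ≤ n → Far (head (push x)) × norm (push x) ≤ suc n
    push-far (+ _      ∷ _) le = tt , s≤s le
    push-far (-[1+ _ ] ∷ _) le = tt , s≤s le
    zero-one : ∀ (x : Vec ℤ (suc d)) → head x ≡ 0ℤ → head x ≡ -1ℤ → ⊥
    zero-one (_ ∷ _) refl ()
    far-near : ∀ (x : Vec ℤ (suc d)) → Far (head x) × norm x ≤ suc n →
      (head x ≡ 0ℤ × norm x ≤ suc n) ⊎ (head x ≡ -1ℤ × norm x ≤ suc n) → ⊥
    far-near (_ ∷ _) (() , _) (inj₁ (refl , _))
    far-near (_ ∷ _) (() , _) (inj₂ (refl , _))

  -- The first two binomial terms of `(2 + y) ^ suc d`. In the inductive step the extra summand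
  -- `4 * suc d * y ^ d` completes a product with `2 + y`.
  bernoulli : ∀ d y → y ^ suc d + 2 * suc d * y ^ d ≤ (2 + y) ^ suc d
  bernoulli zero    y = ≤-reflexive (lemma y)
    where
    lemma : ∀ y → y * 1 + 2 ≡ (2 + y) * 1
    lemma = solve-∀
  bernoulli (suc d) y = begin
    y * y ^ suc d + 2 * suc (suc d) * y ^ suc d
      ≤⟨ m≤m+n _ (4 * suc d * y ^ d) ⟩
    y * (y * y ^ d) + 2 * suc (suc d) * (y * y ^ d) + 4 * suc d * y ^ d
      ≡⟨ lemma y d (y ^ d) ⟩
    (2 + y) * (y * y ^ d + 2 * suc d * y ^ d)
      ≤⟨ *-monoʳ-≤ (2 + y) (bernoulli d y) ⟩
    (2 + y) ^ suc (suc d) ∎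
    where
    open ≤-Reasoning
    lemma : ∀ y d p → y * (y * p) + 2 * suc (suc d) * (y * p) + 4 * suc d * p ≡
                      (2 + y) * (y * p + 2 * suc d * p)
    lemma = solve-∀

  -- The trapezoidal rule overestimates the integral of the convex function
  -- t ↦ (d + 1) tᵈ over the interval from y to y + 2.
  trapezoid : ∀ d y → (2 + y) ^ suc d ≤ y ^ suc d + suc d * ((2 + y) ^ d + y ^ d)
  trapezoid zero    y = ≤-reflexive (lemma y)
    where
    lemma : ∀ y → (2 + y) * 1 ≡ y * 1 + 1 * (1 + 1)
    lemma = solve-∀
  trapezoid (suc d) y = begin
    (2 + y) * (2 + y) ^ suc d
      ≤⟨ *-monoʳ-≤ (2 + y) (trapezoid d y) ⟩
    (2 + y) * (y * y ^ d + suc d * ((2 + y) ^ d + y ^ d))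
      ≡⟨ lemma₁ y d (y ^ d) ((2 + y) ^ d) ⟩
    suc d * ((2 + y) * (2 + y) ^ d) + (y * y ^ d + 2 * suc d * y ^ d) +
      (y * (y * y ^ d) + suc (suc d) * (y * y ^ d))
      ≤⟨ +-monoˡ-≤ _ (+-monoʳ-≤ (suc d * ((2 + y) * (2 + y) ^ d)) (bernoulli d y)) ⟩
    suc d * ((2 + y) * (2 + y) ^ d) + (2 + y) * (2 + y) ^ d +
      (y * (y * y ^ d) + suc (suc d) * (y * y ^ d))
      ≡⟨ lemma₂ y d (y ^ d) ((2 + y) ^ suc d) ⟩
    y * (y * y ^ d) + suc (suc d) * ((2 + y) ^ suc d + y * y ^ d) ∎
    where
    open ≤-Reasoning
    lemma₁ : ∀ y d p q → (2 + y) * (y * p + suc d * (q + p)) ≡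
      suc d * ((2 + y) * q) + (y * p + 2 * suc d * p) + (y * (y * p) + suc (suc d) * (y * p))
    lemma₁ = solve-∀
    lemma₂ : ∀ y d p r → suc d * r + r + (y * (y * p) + suc (suc d) * (y * p)) ≡
      y * (y * p) + suc (suc d) * (r + y * p)
    lemma₂ = solve-∀

  -- The volume (2 r)ᵈ / d! of the ℓ¹ ball with r = n + 1/2 is a lower bound for the number of its
  -- lattice points. The induction follows the recurrence for `D`; one step of `n` moves 2 n + 1 by
  -- 2, which is the interval of `trapezoid`.
  ball-size : ∀ d n → suc (2 * n) ^ d ≤ d ! * D d n
  ball-size zero    n       = ≤-refl
  ball-size (suc d) zero    = begin
    1 ^ suc d        ≡⟨ ^-zeroˡ (suc d) ⟩
    1                ≤⟨ 1≤n! (suc d) ⟩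
    (suc d) !        ≡⟨ *-identityʳ _ ⟨
    (suc d) ! * 1    ∎
    where open ≤-Reasoning
  ball-size (suc d) (suc n) = begin
    suc (2 * suc n) ^ suc d
      ≡⟨ cong (_^ suc d) (lemma₁ n) ⟩
    (2 + y) ^ suc d
      ≤⟨ trapezoid d y ⟩
    y ^ suc d + suc d * ((2 + y) ^ d + y ^ d)
      ≡⟨ cong (λ w → y ^ suc d + suc d * (w ^ d + y ^ d)) (lemma₁ n) ⟨
    y ^ suc d + suc d * (suc (2 * suc n) ^ d + y ^ d)
      ≤⟨ +-mono-≤ (ball-size (suc d) n) (*-monoʳ-≤ (suc d) (+-mono-≤ (ball-size d (suc n)) (ball-size d n))) ⟩
    suc d * d ! * D (suc d) n + suc d * (d ! * D d (suc n) + d ! * D d n)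
      ≡⟨ lemma₂ d (d !) (D (suc d) n) (D d (suc n)) (D d n) ⟩
    suc d * d ! * (D (suc d) n + (D d (suc n) + D d n)) ∎
    where
    open ≤-Reasoning
    y = suc (2 * n)
    lemma₁ : ∀ n → suc (2 * suc n) ≡ 2 + suc (2 * n)
    lemma₁ = solve-∀
    lemma₂ : ∀ d f a b c → suc d * f * a + suc d * (f * b + f * c) ≡ suc d * f * (a + (b + c))
    lemma₂ = solve-∀

  -- The mean value bound for the power function. It measures the loss between the modulus N = 2 n +
  -- 2 of the packing and the number N - 1 = 2 n + 1 in `ball-size`.
  power-step : ∀ x e → suc x ^ suc e ≤ x ^ suc e + suc e * suc x ^ e
  power-step x zero    = ≤-reflexive (lemma x)
    where
    lemma : ∀ x → suc x * 1 ≡ x * 1 + 1 * 1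
    lemma = solve-∀
  power-step x (suc e) = begin
    suc x * suc x ^ suc e
      ≡⟨⟩
    suc x ^ suc e + x * suc x ^ suc e
      ≤⟨ +-monoʳ-≤ (suc x ^ suc e) (*-monoʳ-≤ x (power-step x e)) ⟩
    suc x ^ suc e + x * (x * x ^ e + suc e * suc x ^ e)
      ≤⟨ m≤n+m _ (suc e * suc x ^ e) ⟩
    suc e * suc x ^ e + (suc x * suc x ^ e + x * (x * x ^ e + suc e * suc x ^ e))
      ≡⟨ lemma x e (x ^ e) (suc x ^ e) ⟩
    x * (x * x ^ e) + suc (suc e) * (suc x * suc x ^ e) ∎
    where
    open ≤-Reasoning
    lemma : ∀ x e p q → suc e * q + (suc x * q + x * (x * p + suc e * q)) ≡
                        x * (x * p) + suc (suc e) * (suc x * q)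
    lemma = solve-∀

  diagonal : ℕ → ∀ d → Tri d
  diagonal h zero    = []
  diagonal h (suc d) = tri h (replicate d zero) (diagonal h d)

  det-diagonal : ∀ h d → det (diagonal h d) ≡ suc h ^ d
  det-diagonal h zero    = refl
  det-diagonal h (suc d) = cong (suc h *_) (det-diagonal h d)

  apply-diagonal : ∀ h {d} (x : Vec ℤ d) → apply (diagonal h d) x ≡ +[1+ h ] ⊙ x
  apply-diagonal h []                  = refl
  apply-diagonal h {suc d} (a ∷ x) = cong (+[1+ h ] ℤ.* a ∷_)
    (trans (cong₂ _⊕_ (trans (cong (a ⊙_) (toℤs-zeros d)) (⊙-zeroʳ a)) (apply-diagonal h x)) (⊕-identityˡ _))
    where
    toℤs-zeros : ∀ d → toℤs {suc h} (replicate d zero) ≡ 𝟘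
    toℤs-zeros zero    = refl
    toℤs-zeros (suc d) = cong (0ℤ ∷_) (toℤs-zeros d)

  -- With the denominator `N` cleared: z = Σ (aᵢ / N) Hᵢ with Σ ∣aᵢ∣ < N says that z lies in the
  -- open cross polytope on the columns of `H`.
  NoSmallMultiple : ∀ {d} → Tri d → Set
  NoSmallMultiple H = ∀ N a z → apply H a ≡ + N ⊙ z → norm a < N → z ≡ 𝟘

  -- A packing argument: the translates of a ball by 1/N times the lattice
  -- points are disjoint modulo the lattice N ℤᵈ, where N = 2 n + 2.
  packing : ∀ {d} (H : Tri d) M n → NoSmallMultiple H → det H * M ≡ suc (suc (2 * n)) →
            det H * D d n ≤ suc (suc (2 * n)) ^ d
  packing {d} H M n free N≡ = subst (det H * D d n ≤_) (det-diagonal (suc (2 * n)) d)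
    (injective⇒≤ {f = residue} injective)
    where
    open ≡-Reasoning
    module Ball = Many (ball d n)
    module H = Linear (apply-linear H)
    N = suc (suc (2 * n))
    -- Everything is written in coordinates with respect to `H`, scaled by N = det H · M. The coset
    -- representative becomes an integer vector, the ball keeps its integer points, and the lattice
    -- of `H` becomes N ℤᵈ.
    point : Fin (det H) → Fin (D d n) → Vec ℤ d
    point r a = + M ⊙ adj H (rep H r) ⊕ Ball.elt a
    residue : Fin (det H * D d n) → Fin (det (diagonal (suc (2 * n)) d))
    residue i = red (diagonal (suc (2 * n)) d)
      (point (quotient {det H} (D d n) i) (remainder {det H} (D d n) i))
    apply-point : ∀ r a → apply H (point r a) ≡ + N ⊙ rep H r ⊕ apply H (Ball.elt a)
    apply-point r a = begin
      apply H (+ M ⊙ adj H (rep H r) ⊕ Ball.elt a)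
        ≡⟨ trans (H.homo-⊕ _ _) (cong (_⊕ apply H (Ball.elt a)) (H.homo-⊙ (+ M) _)) ⟩
      + M ⊙ apply H (adj H (rep H r)) ⊕ apply H (Ball.elt a)
        ≡⟨ cong (λ v → + M ⊙ v ⊕ apply H (Ball.elt a)) (apply-adj H (rep H r)) ⟩
      + M ⊙ + det H ⊙ rep H r ⊕ apply H (Ball.elt a)
        ≡⟨ cong (_⊕ apply H (Ball.elt a)) (trans (⊙-comm (+ M) (+ det H) _) (⊙-assoc (+ det H) (+ M) _)) ⟩
      (+ det H ℤ.* + M) ⊙ rep H r ⊕ apply H (Ball.elt a)
        ≡⟨ cong (λ k → k ⊙ rep H r ⊕ apply H (Ball.elt a)) (trans (sym (ℤ.pos-* (det H) M)) (cong +_ N≡)) ⟩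
      + N ⊙ rep H r ⊕ apply H (Ball.elt a) ∎
    separate : ∀ {n} k (r s u v w : Vec ℤ n) → k ⊙ r ⊕ u ≡ (k ⊙ s ⊕ v) ⊕ k ⊙ w → v ⊖ u ≡ k ⊙ (r ⊖ (s ⊕ w))
    separate k []      []      []      []      []      _  = refl
    separate k (r ∷ rs) (s ∷ ss) (u ∷ us) (v ∷ vs) (w ∷ ws) eq =
      cong₂ _∷_ (trans (lemma₁ k r s v w u) (trans (cong (λ t → t ℤ.- u ℤ.- k ℤ.* (s ℤ.+ w)) (sym (cong head eq)))
        (lemma₂ k r s w u))) (separate k rs ss us vs ws (cong tail eq))
      where
      lemma₁ : ∀ k r s v w u → v ℤ.- u ≡ k ℤ.* s ℤ.+ v ℤ.+ k ℤ.* w ℤ.- u ℤ.- k ℤ.* (s ℤ.+ w)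
      lemma₁ = ℤ-Solver.solve-∀
      lemma₂ : ∀ k r s w u → k ℤ.* r ℤ.+ u ℤ.- u ℤ.- k ℤ.* (s ℤ.+ w) ≡ k ℤ.* (r ℤ.- (s ℤ.+ w))
      lemma₂ = ℤ-Solver.solve-∀
    distinct : ∀ r s a b t → point r a ≡ point s b ⊕ + N ⊙ t → r ≡ s × a ≡ b
    distinct r s a b t eq = rep-unique H r s t (⊖≡𝟘⇒≡ z≡𝟘) , Ball.injective (sym (⊖≡𝟘⇒≡ b-a≡𝟘))
      where
      x = Ball.elt a
      y = Ball.elt b
      z = rep H r ⊖ (rep H s ⊕ apply H t)
      multiple : apply H (y ⊖ x) ≡ + N ⊙ z
      multiple = trans (H.homo-⊖ y x) (separate (+ N) (rep H r) (rep H s) (apply H x) (apply H y) (apply H t) (begin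
        + N ⊙ rep H r ⊕ apply H x                        ≡⟨ apply-point r a ⟨
        apply H (point r a)                              ≡⟨ cong (apply H) eq ⟩
        apply H (point s b ⊕ + N ⊙ t)                    ≡⟨ H.homo-⊕ _ _ ⟩
        apply H (point s b) ⊕ apply H (+ N ⊙ t)          ≡⟨ cong₂ _⊕_ (apply-point s b) (H.homo-⊙ (+ N) t) ⟩
        (+ N ⊙ rep H s ⊕ apply H y) ⊕ + N ⊙ apply H t    ∎))
      -- Two points of the ball of radius n differ by at most 2 n, which is less than 2 n + 2.
      small : norm (y ⊖ x) < N
      small = s≤s (≤-trans (norm-⊖ y x) (≤-trans (+-mono-≤ (Ball.sat b) (Ball.sat a))
        (≤-trans (≤-reflexive (cong (_+_ n) (sym (+-identityʳ n)))) (n≤1+n (2 * n)))))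
      z≡𝟘 : z ≡ 𝟘
      z≡𝟘 = free N (y ⊖ x) z multiple small
      b-a≡𝟘 : y ⊖ x ≡ 𝟘
      b-a≡𝟘 = apply-injective H (trans multiple
        (trans (cong (+ N ⊙_) z≡𝟘) (trans (⊙-zeroʳ (+ N)) (sym H.homo-𝟘))))
    injective : ∀ {i j} → residue i ≡ residue j → i ≡ j
    injective {i} {j} eq with red-≡⇒ (diagonal (suc (2 * n)) d) eq
    ... | t , eqt with distinct (quotient {det H} (D d n) i) (quotient {det H} (D d n) j)
                        (remainder {det H} (D d n) i) (remainder {det H} (D d n) j) t
                        (trans eqt (cong (point _ _ ⊕_) (apply-diagonal (suc (2 * n)) t)))
    ... | eq₁ , eq₂ = trans (sym (combine-remQuot {det H} (D d n) i))
                        (trans (cong₂ combine eq₁ eq₂) (combine-remQuot {det H} (D d n) j))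

  -- With m = det H, comparing `packing` with `ball-size` gives m N ≤ d! N + m d. Since N = 2 m d
  -- exceeds m d, this excludes m ≥ d! + 1.
  minkowski : ∀ {d} (H : Tri (suc d)) → NoSmallMultiple H → det H ≤ (suc d) !
  minkowski {e} H free = ≮⇒≥ λ d!<m → <-irrefl refl (≤-trans (exceeds d!<m) m·N≤)
    where
    open ≤-Reasoning
    d = suc e
    m = det H
    f = d !
    instance
      m·d≢0 : NonZero (m * d)
      m·d≢0 = m*n≢0 m d {{det-nonZero H}}
    -- Chosen so that N = 2 n + 2 equals 2 m d, which is a multiple of m, as `packing` demands, and
    -- exceeds the error term m d.
    n = pred (m * d)
    N = suc (suc (2 * n))
    N≡2md : N ≡ m * d + m * d
    N≡2md = trans (lemma n) (cong₂ _+_ (suc-pred (m * d)) (suc-pred (m * d)))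
      where
      lemma : ∀ n → suc (suc (2 * n)) ≡ suc n + suc n
      lemma = solve-∀
    packed : m * D d n ≤ N ^ d
    packed = packing H (2 * d) n free (trans (lemma m d) (sym N≡2md))
      where
      lemma : ∀ m d → m * (2 * d) ≡ m * d + m * d
      lemma = solve-∀
    m·N≤ : m * N ≤ f * N + m * d
    m·N≤ = *-cancelʳ-≤ (m * N) (f * N + m * d) (N ^ e) {{m^n≢0 N e}} (begin
      m * N * N ^ e                              ≡⟨ *-assoc m N (N ^ e) ⟩
      m * N ^ d                                  ≤⟨ *-monoʳ-≤ m (power-step (suc (2 * n)) e) ⟩
      m * (suc (2 * n) ^ d + d * N ^ e)          ≤⟨ *-monoʳ-≤ m (+-monoˡ-≤ (d * N ^ e) (ball-size d n)) ⟩
      m * (f * D d n + d * N ^ e)                ≡⟨ lemma₁ m f (D d n) d (N ^ e) ⟩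
      f * (m * D d n) + m * d * N ^ e            ≤⟨ +-monoˡ-≤ _ (*-monoʳ-≤ f packed) ⟩
      f * (N * N ^ e) + m * d * N ^ e            ≡⟨ lemma₂ f N (N ^ e) (m * d) ⟩
      (f * N + m * d) * N ^ e                    ∎)
      where
      lemma₁ : ∀ m f D d p → m * (f * D + d * p) ≡ f * (m * D) + m * d * p
      lemma₁ = solve-∀
      lemma₂ : ∀ f N p k → f * (N * p) + k * p ≡ (f * N + k) * p
      lemma₂ = solve-∀
    exceeds : f < m → suc (f * N + m * d) ≤ m * N
    exceeds f<m = begin
      suc (f * N + m * d)         ≡⟨ +-suc (f * N) (m * d) ⟨
      f * N + suc (m * d)         ≤⟨ +-monoʳ-≤ (f * N) (m<m+n (m * d) (>-nonZero⁻¹ (m * d))) ⟩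
      f * N + (m * d + m * d)     ≡⟨ cong (λ k → f * N + k) N≡2md ⟨
      f * N + N                   ≡⟨ +-comm (f * N) N ⟩
      suc f * N                   ≤⟨ *-monoˡ-≤ N f<m ⟩
      m * N                       ∎

-- Bases chosen among given vectors, and the exchange argument.

module LatticeBases where

  open import Data.Nat.Base as ℕ using (ℕ; zero; suc)
  import Data.Nat.Properties as ℕ
  open import Data.Integer.Base hiding (suc; _⊔_; _⊖_)
  import Data.Integer.Properties as ℤ
  open import Data.Integer.Tactic.RingSolver using (solve-∀)
  open import Data.Fin.Base using (Fin; zero; suc; punchIn)
  open import Data.Fin.Properties using (any?)
  open import Data.Product.Base using (∃; ∃₂; _×_; _,_)
  open import Data.Sum.Base using (_⊎_; inj₁; inj₂)
  open import Data.Vec.Base using (Vec; []; _∷_; head; tail; lookup; insertAt; removeAt)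
  open import Data.Vec.Properties using (removeAt-insertAt; insertAt-lookup)
  open import Function.Base using (_∘_)
  open import Relation.Binary.PropositionalEquality
  open import Relation.Nullary using (¬_; ¬?; yes; no; contradiction)
  open import Relation.Nullary.Decidable using (decidable-stable)
  open ≡-Reasoning
  open IntegerLinearAlgebra
  open TriangularMatrices

  dot : ∀ {n} → Vec ℤ n → Vec ℤ n → ℤ
  dot []      []      = 0ℤ
  dot (a ∷ f) (b ∷ v) = a * b + dot f v

  dot-𝟘 : ∀ {n} (v : Vec ℤ n) → dot 𝟘 v ≡ 0ℤ
  dot-𝟘 []      = refl
  dot-𝟘 (b ∷ v) = trans (ℤ.+-identityˡ _) (dot-𝟘 v)

  dot-⊙ : ∀ {n} k (f v : Vec ℤ n) → dot (k ⊙ f) v ≡ k * dot f v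
  dot-⊙ k []      []      = sym (ℤ.*-zeroʳ k)
  dot-⊙ k (a ∷ f) (b ∷ v) = trans (cong (λ z → k * a * b + z) (dot-⊙ k f v)) (lemma k a b (dot f v))
    where
    lemma : ∀ k a b c → k * a * b + k * c ≡ k * (a * b + c)
    lemma = solve-∀

  dot-eliminate : ∀ {n} a b (f v t : Vec ℤ n) → dot f (a ⊙ v ⊖ b ⊙ t) ≡ a * dot f v - b * dot f t
  dot-eliminate a b []      []      []      = lemma a b
    where
    lemma : ∀ a b → 0ℤ ≡ a * 0ℤ - b * 0ℤ
    lemma = solve-∀
  dot-eliminate a b (f ∷ fs) (v ∷ vs) (t ∷ ts) =
    trans (cong (λ z → f * (a * v - b * t) + z) (dot-eliminate a b fs vs ts)) (lemma a b f v t (dot fs vs) (dot fs ts))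
    where
    lemma : ∀ a b f v t x y → f * (a * v - b * t) + (a * x - b * y) ≡ a * (f * v + x) - b * (f * t + y)
    lemma = solve-∀

  -- Fraction-free Gaussian elimination: the projection along `p` to the hyperplane of leading entry
  -- 0, multiplied by `head p`. It sends `p` itself to 0.
  eliminate : ∀ {n} → Vec ℤ (suc n) → Vec ℤ (suc n) → Vec ℤ n
  eliminate p v = head p ⊙ tail v ⊖ head v ⊙ tail p

  eliminate-linear : ∀ {n} (p : Vec ℤ (suc n)) → Linear (eliminate p)
  eliminate-linear (a ∷ t) = record
    { homo-⊕ = λ { (b ∷ x) (c ∷ y) → homo-⊕ b c x y t }
    ; homo-⊙ = λ { k (b ∷ x) → homo-⊙ k b x t } }
    where
    homo-⊕ : ∀ {n} b c (x y t : Vec ℤ n) →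
      a ⊙ (x ⊕ y) ⊖ (b + c) ⊙ t ≡ (a ⊙ x ⊖ b ⊙ t) ⊕ (a ⊙ y ⊖ c ⊙ t)
    homo-⊕ b c [] [] [] = refl
    homo-⊕ b c (x ∷ xs) (y ∷ ys) (t ∷ ts) = cong₂ _∷_ (lemma a b c x y t) (homo-⊕ b c xs ys ts)
      where
      lemma : ∀ a b c x y t → a * (x + y) - (b + c) * t ≡ (a * x - b * t) + (a * y - c * t)
      lemma = solve-∀
    homo-⊙ : ∀ {n} k b (x t : Vec ℤ n) → a ⊙ k ⊙ x ⊖ (k * b) ⊙ t ≡ k ⊙ (a ⊙ x ⊖ b ⊙ t)
    homo-⊙ k b [] [] = refl
    homo-⊙ k b (x ∷ xs) (t ∷ ts) = cong₂ _∷_ (lemma a k b x t) (homo-⊙ k b xs ts)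
      where
      lemma : ∀ a k b x t → a * (k * x) - k * b * t ≡ k * (a * x - b * t)
      lemma = solve-∀

  -- Elimination with a pivot `w p` of nonzero head. If the projected vectors contain a basis,
  -- adding the pivot gives one in the full space: `eliminate` removes its coefficient from a
  -- relation, so the others vanish first. If a functional vanishes on the projections, it pulls
  -- back.
  independent-or-vanishing : ∀ {d n} (w : Fin n → Vec ℤ d) →
    (∃ λ (idx : Fin d → Fin n) → Injective₀ (comb (w ∘ idx))) ⊎
    (∃ λ f → f ≢ 𝟘 × ∀ j → dot f (w j) ≡ 0ℤ)
  independent-or-vanishing {zero} w = inj₁ ((λ ()) , λ { [] _ → refl })
  independent-or-vanishing {suc d} {n} w with any? (λ j → ¬? (head (w j) ℤ.≟ 0ℤ))
  ... | no none = inj₂ (1ℤ ∷ 𝟘 , (λ ()) , λ j → begin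
    dot (1ℤ ∷ 𝟘) (w j)                         ≡⟨ cong (dot (1ℤ ∷ 𝟘)) (head∷tail (w j)) ⟨
    1ℤ * head (w j) + dot 𝟘 (tail (w j))       ≡⟨ cong₂ _+_ (ℤ.*-identityˡ (head (w j))) (dot-𝟘 (tail (w j))) ⟩
    head (w j) + 0ℤ                            ≡⟨ ℤ.+-identityʳ _ ⟩
    head (w j)                                 ≡⟨ decidable-stable (head (w j) ℤ.≟ 0ℤ) (λ ≢0 → none (j , ≢0)) ⟩
    0ℤ                                         ∎)
  ... | yes (p , a≢0) with independent-or-vanishing (eliminate (w p) ∘ w)
  -- The coefficients of the composite of `f` with `eliminate (w p)`; it is nonzero because `a` and
  -- `f` are.
  ...   | inj₂ (f , f≢𝟘 , vanish) = inj₂ (- dot f t ∷ a ⊙ f , (λ eq → f≢𝟘 (a⊙f≡𝟘⇒ (cong tail eq))) , λ j → begin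
    dot (- dot f t ∷ a ⊙ f) (w j)
      ≡⟨ cong (dot (- dot f t ∷ a ⊙ f)) (head∷tail (w j)) ⟨
    - dot f t * head (w j) + dot (a ⊙ f) (tail (w j))
      ≡⟨ cong (λ z → - dot f t * head (w j) + z) (dot-⊙ a f (tail (w j))) ⟩
    - dot f t * head (w j) + a * dot f (tail (w j))
      ≡⟨ lemma (dot f t) (head (w j)) (a * dot f (tail (w j))) ⟩
    a * dot f (tail (w j)) - head (w j) * dot f t
      ≡⟨ dot-eliminate a (head (w j)) f (tail (w j)) t ⟨
    dot f (eliminate (w p) (w j))
      ≡⟨ vanish j ⟩
    0ℤ ∎)
    where
    a = head (w p)
    t = tail (w p)
    a⊙f≡𝟘⇒ : a ⊙ f ≡ 𝟘 → f ≡ 𝟘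
    a⊙f≡𝟘⇒ eq = ⊙-cancelˡ a {{≢-nonZero a≢0}} (trans eq (sym (⊙-zeroʳ a)))
    lemma : ∀ x y z → - x * y + z ≡ z - y * x
    lemma = solve-∀
  ...   | inj₁ (idx , inj) = inj₁ (idx′ , injective)
    where
    idx′ : Fin (suc d) → Fin n
    idx′ zero    = p
    idx′ (suc i) = idx i
    module E = Linear (eliminate-linear (w p))
    injective : Injective₀ (comb (w ∘ idx′))
    injective (x ∷ xs) eq = cong₂ _∷_ x≡0 xs≡𝟘
      where
      xs≡𝟘 : xs ≡ 𝟘
      xs≡𝟘 = inj xs (begin
        comb (eliminate (w p) ∘ w ∘ idx) xs
          ≡⟨ E.homo-comb (w ∘ idx) xs ⟨
        eliminate (w p) (comb (w ∘ idx) xs)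
          ≡⟨ ⊕-identityˡ _ ⟨
        𝟘 ⊕ eliminate (w p) (comb (w ∘ idx) xs)
          ≡⟨ cong (_⊕ eliminate (w p) (comb (w ∘ idx) xs)) (trans (cong (x ⊙_) (⊖-self _)) (⊙-zeroʳ x)) ⟨
        x ⊙ eliminate (w p) (w p) ⊕ eliminate (w p) (comb (w ∘ idx) xs)
          ≡⟨ trans (E.homo-⊕ (x ⊙ w p) _) (cong (_⊕ eliminate (w p) (comb (w ∘ idx) xs)) (E.homo-⊙ x (w p))) ⟨
        eliminate (w p) (comb (w ∘ idx′) (x ∷ xs))
          ≡⟨ trans (cong (eliminate (w p)) eq) E.homo-𝟘 ⟩
        𝟘 ∎)
      x⊙wp≡𝟘 : x ⊙ w p ≡ 𝟘
      x⊙wp≡𝟘 = begin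
        x ⊙ w p                            ≡⟨ ⊕-identityʳ _ ⟨
        x ⊙ w p ⊕ 𝟘                        ≡⟨ cong (x ⊙ w p ⊕_) (Linear.homo-𝟘 (comb-linear (w ∘ idx))) ⟨
        x ⊙ w p ⊕ comb (w ∘ idx) 𝟘         ≡⟨ cong (λ y → x ⊙ w p ⊕ comb (w ∘ idx) y) xs≡𝟘 ⟨
        x ⊙ w p ⊕ comb (w ∘ idx) xs        ≡⟨ eq ⟩
        𝟘                                  ∎
      x≡0 : x ≡ 0ℤ
      x≡0 = ℤ.*-cancelʳ-≡ x 0ℤ (head (w p)) {{≢-nonZero a≢0}}
        (trans (cong (λ v → head (x ⊙ v)) (head∷tail (w p)) ) (trans (cong head x⊙wp≡𝟘) refl))

  comb-basis : ∀ {m n} (V : Fin m → Vec ℤ n) i → comb V (e i) ≡ V i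
  comb-basis V zero    = trans (cong₂ _⊕_ (⊙-identity _) (Linear.homo-𝟘 (comb-linear (V ∘ suc)))) (⊕-identityʳ _)
  comb-basis V (suc i) = trans (cong₂ _⊕_ (⊙-zeroˡ (V zero)) (comb-basis (V ∘ suc) i)) (⊕-identityˡ _)

  front : ∀ {n} → Fin (suc n) → Fin (suc n) → Fin (suc n)
  front i zero    = i
  front i (suc l) = punchIn i l

  comb-front : ∀ {m n} (V : Fin (suc m) → Vec ℤ n) i x →
    comb (V ∘ front i) (lookup x i ∷ removeAt x i) ≡ comb V x
  comb-front V zero    (k ∷ ks)             = refl
  comb-front V (suc i) (k ∷ ks@(_ ∷ _))    = begin
    lookup ks i ⊙ V (suc i) ⊕ (k ⊙ V zero ⊕ rest)
      ≡⟨ ⊕-assoc (lookup ks i ⊙ V (suc i)) (k ⊙ V zero) rest ⟨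
    (lookup ks i ⊙ V (suc i) ⊕ k ⊙ V zero) ⊕ rest
      ≡⟨ cong (_⊕ rest) (⊕-comm (lookup ks i ⊙ V (suc i)) (k ⊙ V zero)) ⟩
    (k ⊙ V zero ⊕ lookup ks i ⊙ V (suc i)) ⊕ rest
      ≡⟨ ⊕-assoc (k ⊙ V zero) (lookup ks i ⊙ V (suc i)) rest ⟩
    k ⊙ V zero ⊕ (lookup ks i ⊙ V (suc i) ⊕ rest)
      ≡⟨ cong (k ⊙ V zero ⊕_) (comb-front (V ∘ suc) i ks) ⟩
    k ⊙ V zero ⊕ comb (V ∘ suc) ks ∎
    where
    rest = comb (λ l → V (suc (punchIn i l))) (removeAt ks i)

  comb-front⁻¹ : ∀ {m n} (V : Fin (suc m) → Vec ℤ n) i k ks →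
    comb (V ∘ front i) (k ∷ ks) ≡ comb V (insertAt ks i k)
  comb-front⁻¹ V i k ks = trans
    (cong₂ (λ l ls → comb (V ∘ front i) (l ∷ ls)) (sym (insertAt-lookup ks i k)) (sym (removeAt-insertAt ks i k)))
    (comb-front V i (insertAt ks i k))

  removeAt-𝟘 : ∀ {n} (i : Fin (suc n)) → removeAt (𝟘 {suc n}) i ≡ 𝟘
  removeAt-𝟘         zero    = refl
  removeAt-𝟘 {suc n} (suc i) = cong (0ℤ ∷_) (removeAt-𝟘 i)

  insertAt≡𝟘⇒ : ∀ {n} (ks : Vec ℤ n) i k → insertAt ks i k ≡ 𝟘 → k ∷ ks ≡ 𝟘
  insertAt≡𝟘⇒ ks i k eq = cong₂ _∷_
    (trans (sym (insertAt-lookup ks i k)) (trans (cong (λ x → lookup x i) eq) (lookup-𝟘 i)))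
    (trans (sym (removeAt-insertAt ks i k)) (trans (cong (λ x → removeAt x i) eq) (removeAt-𝟘 i)))

  -- The Hermite form is stored instead of a proof of independence: it implies independence, gives
  -- coordinates, and its determinant is the index to be maximised.
  record Frame {d n} (w : Fin n → Vec ℤ d) : Set where
    field
      idx       : Fin d → Fin n
      iso       : Iso d
      form      : Tri d
      isHermite : ∀ x → Iso.to iso (comb (w ∘ idx) x) ≡ apply form x

    injective : Injective₀ (comb (w ∘ idx))
    injective x eq = apply-injective form (trans (sym (isHermite x))
      (trans (cong (Iso.to iso) eq) (trans (Iso.homo-𝟘 iso) (sym (Linear.homo-𝟘 (apply-linear form))))))

    -- The coordinates of `v` times `det form`, integral by Cramer's rule.
    coords : Vec ℤ d → Vec ℤ d
    coords v = adj form (Iso.to iso v)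

    comb-coords : ∀ v → comb (w ∘ idx) (coords v) ≡ + det form ⊙ v
    comb-coords v = Iso.to-injective iso (trans (isHermite (coords v))
      (trans (apply-adj form (Iso.to iso v)) (sym (Iso.homo-⊙ iso (+ det form) v))))

  module _ {d n} (w : Fin n → Vec ℤ (suc d)) where

    -- Exchanging the i-th column for w j multiplies the determinant by the
    -- absolute value of the i-th coordinate of w j. To see this the i-th
    -- column is moved to the front, where it only affects one diagonal entry.
    exchange : (F : Frame w) → ∀ j i → let open Frame F in
      det form ℕ.< ∣ lookup (coords (w j)) i ∣ → ∃ λ F′ → det form ℕ.< det (Frame.form F′)
    exchange F j i large = finish (hermite (V ∘ front i) moved-injective)
      where
      open Frame F
      V = w ∘ idx
      moved-injective : Injective₀ (comb (V ∘ front i))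
      moved-injective (k ∷ ks) eq =
        insertAt≡𝟘⇒ ks i k (injective (insertAt ks i k) (trans (sym (comb-front⁻¹ V i k ks)) eq))
      finish : (∃₂ λ (T : Iso (suc d)) (H : Tri (suc d)) → ∀ x → Iso.to T (comb (V ∘ front i) x) ≡ apply H x) →
        ∃ λ F′ → det form ℕ.< det (Frame.form F′)
      finish (T , H@(tri h r H₁) , eqT) = result (assemble W id-iso H₁ {{a-nonZero}} W-heads W-tails)
        where
        open Iso T
        k = coords (w j)
        a = head (to (w j))
        idx′ : Fin (suc d) → Fin n
        idx′ zero    = j
        idx′ (suc l) = idx (punchIn i l)
        W : Fin (suc d) → Vec ℤ (suc d)
        W = to ∘ w ∘ idx′
        -- Reordering the columns does not change the lattice they span, so `det-mono` applies.
        form≤H : det form ℕ.≤ det H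
        form≤H = det-mono form H (iso ∙ T ⁻¹) λ { (y ∷ ys) → insertAt ys i y , (begin
          Iso.to iso (from (apply H (y ∷ ys)))                       ≡⟨ cong (Iso.to iso ∘ from) (eqT (y ∷ ys)) ⟨
          Iso.to iso (from (to (comb (V ∘ front i) (y ∷ ys))))       ≡⟨ cong (Iso.to iso) (from∘to _) ⟩
          Iso.to iso (comb (V ∘ front i) (y ∷ ys))                   ≡⟨ cong (Iso.to iso) (comb-front⁻¹ V i y ys) ⟩
          Iso.to iso (comb V (insertAt ys i y))                      ≡⟨ isHermite _ ⟩
          apply form (insertAt ys i y)                               ∎) }
        scaled : apply H (lookup k i ∷ removeAt k i) ≡ + det form ⊙ to (w j)
        scaled = begin
          apply H (lookup k i ∷ removeAt k i)                  ≡⟨ eqT _ ⟨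
          to (comb (V ∘ front i) (lookup k i ∷ removeAt k i))  ≡⟨ cong to (comb-front V i k) ⟩
          to (comb V k)                                        ≡⟨ cong to (comb-coords (w j)) ⟩
          to (+ det form ⊙ w j)                                ≡⟨ homo-⊙ (+ det form) (w j) ⟩
          + det form ⊙ to (w j)                                ∎
        head-⊙ : ∀ {n} c (v : Vec ℤ (suc n)) → head (c ⊙ v) ≡ c * head v
        head-⊙ c (_ ∷ _) = refl
        -- In the first row of `scaled` only the column moved to the front contributes. The i-th
        -- coordinate of `w j` is therefore, up to sign, the quotient of the new leading entry `a`
        -- by the old one.
        ratio : suc h ℕ.* ∣ lookup k i ∣ ≡ det form ℕ.* ∣ a ∣
        ratio = begin
          suc h ℕ.* ∣ lookup k i ∣         ≡⟨ ℤ.abs-* +[1+ h ] (lookup k i) ⟨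
          ∣ +[1+ h ] * lookup k i ∣        ≡⟨ cong ∣_∣ (trans (cong head scaled) (head-⊙ (+ det form) (to (w j)))) ⟩
          ∣ + det form * a ∣               ≡⟨ ℤ.abs-* (+ det form) a ⟩
          det form ℕ.* ∣ a ∣               ∎
        sh<a : suc h ℕ.< ∣ a ∣
        sh<a = ℕ.*-cancelˡ-< (det form) (suc h) ∣ a ∣
          (subst₂ ℕ._<_ (ℕ.*-comm (suc h) (det form)) ratio (ℕ.*-monoʳ-< (suc h) large))
        a-nonZero : NonZero a
        a-nonZero = ℕ.>-nonZero (ℕ.≤-<-trans ℕ.z≤n sh<a)
        W-heads : ∀ l → head (W (suc l)) ≡ 0ℤ
        W-heads l = begin
          head (to (V (punchIn i l)))                  ≡⟨ cong (head ∘ to) (comb-basis (V ∘ front i) (suc l)) ⟨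
          head (to (comb (V ∘ front i) (e (suc l))))   ≡⟨ cong head (eqT (e (suc l))) ⟩
          +[1+ h ] * 0ℤ                                ≡⟨ ℤ.*-zeroʳ +[1+ h ] ⟩
          0ℤ                                           ∎
        tail-linear : ∀ {n} → Linear (tail {A = ℤ} {n})
        tail-linear = record { homo-⊕ = λ { (_ ∷ _) (_ ∷ _) → refl } ; homo-⊙ = λ { _ (_ ∷ _) → refl } }
        W-tails : ∀ x → comb (tail ∘ W ∘ suc) x ≡ apply H₁ x
        W-tails x = begin
          comb (tail ∘ W ∘ suc) x
            ≡⟨ Linear.homo-comb tail-linear (W ∘ suc) x ⟨
          tail (comb (W ∘ suc) x)
            ≡⟨ cong tail (homo-comb (w ∘ idx′ ∘ suc) x) ⟨
          tail (to (comb (V ∘ front i ∘ suc) x))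
            ≡⟨ cong (tail ∘ to) (trans (cong (_⊕ comb (V ∘ front i ∘ suc) x) (⊙-zeroˡ (V i))) (⊕-identityˡ _)) ⟨
          tail (to (comb (V ∘ front i) (0ℤ ∷ x)))
            ≡⟨ cong tail (eqT (0ℤ ∷ x)) ⟩
          0ℤ ⊙ toℤs r ⊕ apply H₁ x
            ≡⟨ trans (cong (_⊕ apply H₁ x) (⊙-zeroˡ (toℤs r))) (⊕-identityˡ _) ⟩
          apply H₁ x ∎
        result : (∃₂ λ (S : Iso (suc d)) (H′ : Tri (suc d)) →
            det H′ ≡ ∣ a ∣ ℕ.* det H₁ × (∀ x → Iso.to S (comb W x) ≡ apply H′ x)) →
          ∃ λ F′ → det form ℕ.< det (Frame.form F′)
        result (S , H′ , det≡ , eqS) = F′ , ℕ.≤-<-trans form≤H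
          (subst (det H ℕ.<_) (sym det≡) (ℕ.*-monoˡ-< (det H₁) {{det-nonZero H₁}} sh<a))
          where
          F′ : Frame w
          F′ = record { idx = idx′ ; iso = S ∙ T ; form = H′ ; isHermite = λ x →
            trans (cong (Iso.to S) (homo-comb (w ∘ idx′) x)) (eqS x) }

    Maximal : Frame w → Set
    Maximal F = let open Frame F in ∀ j i → ∣ lookup (coords (w j)) i ∣ ℕ.≤ det form

    -- Every exchange raises the determinant, which stays at most `B`, so `B` units of fuel suffice.
    -- The invariant is that determinant plus fuel exceeds `B`; without fuel it contradicts the
    -- bound.
    maximal-frame : ∀ B → (∀ F → det (Frame.form F) ℕ.≤ B) → Frame w → ∃ Maximal
    maximal-frame B bound F₀ = search B F₀ (ℕ.m<n+m B (ℕ.>-nonZero⁻¹ _ {{det-nonZero (Frame.form F₀)}}))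
      where
      search : ∀ fuel F → B ℕ.< det (Frame.form F) ℕ.+ fuel → ∃ Maximal
      search zero       F B< = contradiction (bound F) (ℕ.<⇒≱ (subst (B ℕ.<_) (ℕ.+-identityʳ _) B<))
      search (suc fuel) F B< with any? (λ j → any? (λ i → det form ℕ.<? ∣ lookup (coords (w j)) i ∣))
        where open Frame F
      ... | no none = F , λ j i → ℕ.≮⇒≥ (λ large → none (j , i , large))
      ... | yes (j , i , large) with exchange F j i large
      ...   | F′ , less = search fuel F′ (ℕ.<-≤-trans B< (subst (ℕ._≤ det (Frame.form F′) ℕ.+ fuel)
        (sym (ℕ.+-suc _ fuel)) (ℕ.+-monoˡ-≤ fuel less)))

-- Counting Hermite forms and subsets of the parallelotope.

module Codes where

  open import Data.Nat.Base hiding (_/_)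
  open import Data.Nat.Properties hiding (_≟_)
  open import Data.Nat.DivMod using (_/_; m*n/n≡m; /-monoˡ-≤; m/n*n≤m)
  open import Data.Nat.Tactic.RingSolver using (solve-∀)
  import Data.Integer.Base as ℤ
  open ℤ using (ℤ; +_; -[1+_]; ∣_∣)
  import Data.Integer.Properties as ℤ
  import Data.Integer.Tactic.RingSolver as ℤ-Solver
  open import Data.Bool.Base using (if_then_else_)
  open import Data.Fin.Base using (Fin; zero; suc; fromℕ<; combine; inject≤; funToFin; finToFun)
  open import Data.Fin.Properties using (_≟_; any?; fromℕ<-injective; combine-injective; inject≤-injective; finToFun-funToFin)
  open import Data.Product.Base using (∃; _,_)
  open import Data.Vec.Base using (Vec; []; lookup)
  open import Data.Vec.Properties using (tabulate∘lookup; tabulate-cong)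
  open import Function.Base using (_∘_)
  open import Relation.Binary.PropositionalEquality
  open import Relation.Nullary using (Dec; does; yes; no)
  open import Relation.Nullary.Decidable using (dec-true)
  open IntegerLinearAlgebra
  open TriangularMatrices

  funToFin-injective : ∀ {m n} (f g : Fin m → Fin n) → funToFin f ≡ funToFin g → ∀ i → f i ≡ g i
  funToFin-injective f g eq i = begin
    f i                        ≡⟨ finToFun-funToFin f i ⟨
    finToFun (funToFin f) i    ≡⟨ cong (λ x → finToFun x i) eq ⟩
    finToFun (funToFin g) i    ≡⟨ finToFun-funToFin g i ⟩
    g i                        ∎
    where open ≡-Reasoning

  lookup-ext : ∀ {A : Set} {n} {x y : Vec A n} → (∀ i → lookup x i ≡ lookup y i) → x ≡ y
  lookup-ext {x = x} {y} eq = trans (sym (tabulate∘lookup x)) (trans (tabulate-cong eq) (tabulate∘lookup y))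

  -- The left side is (a b)ᵈ b. In `encode`, aᵈ counts the columns below a diagonal entry a, and the
  -- power of b counts the codes of the remaining form.
  column-count : ∀ a .{{_ : NonZero a}} b X d → a * b ≤ X → a ^ d * b ^ suc d ≤ X ^ suc d
  column-count a b X zero    a*b≤X = begin
    1 * (b * 1)    ≡⟨ *-identityˡ _ ⟩
    b * 1          ≤⟨ *-monoˡ-≤ 1 (≤-trans (m≤n*m b a) a*b≤X) ⟩
    X * 1          ∎
    where open ≤-Reasoning
  column-count a b X (suc d) a*b≤X = begin
    a * a ^ d * (b * b ^ suc d)      ≡⟨ lemma a (a ^ d) b (b ^ suc d) ⟩
    a * b * (a ^ d * b ^ suc d)      ≤⟨ *-mono-≤ a*b≤X (column-count a b X d a*b≤X) ⟩
    X * X ^ suc d                    ∎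
    where
    open ≤-Reasoning
    lemma : ∀ a p b q → a * p * (b * q) ≡ a * b * (p * q)
    lemma = solve-∀

  module _ {d h} (r : Vec (Fin (suc h)) d) (H : Tri d) {X} (le : det (tri h r H) ≤ X) where

    h<X : h < X
    h<X = ≤-trans (m≤m*n (suc h) (det H) {{det-nonZero H}}) le

    det≤ : det H ≤ X / suc h
    det≤ = begin
      det H                      ≡⟨ m*n/n≡m (det H) (suc h) ⟨
      det H * suc h / suc h      ≤⟨ /-monoˡ-≤ (suc h) (≤-trans (≤-reflexive (*-comm (det H) (suc h))) le) ⟩
      X / suc h                  ∎
      where open ≤-Reasoning

    columns≤ : suc h ^ d * (X / suc h) ^ suc d ≤ X ^ suc d
    columns≤ = column-count (suc h) (X / suc h) X d (≤-trans (≤-reflexive (*-comm (suc h) (X / suc h))) (m/n*n≤m X (suc h)))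

  -- Below the diagonal entry h of a form of determinant at most X there are
  -- h ^ d possible columns, followed by a form of determinant at most X / h.
  encode : ∀ {d} (H : Tri d) X → det H ≤ X → Fin (X ^ suc d)
  -- The empty form already occupies a factor X, and each further dimension takes one more; hence
  -- the exponent d + 1.
  encode []          X le = fromℕ< (≤-trans le (≤-reflexive (sym (*-identityʳ X))))
  encode (tri h r H) X le = combine (fromℕ< (h<X r H le))
    (inject≤ (combine (funToFin (lookup r)) (encode H (X / suc h) (det≤ r H le))) (columns≤ r H le))

  encode-injective : ∀ {d} (H H′ : Tri d) X le le′ → encode H X le ≡ encode H′ X le′ → H ≡ H′
  encode-injective []          []             X le le′ eq = refl
  encode-injective (tri h r H) (tri h′ r′ H′) X le le′ eq with combine-injective (fromℕ< (h<X r H le)) _ _ _ eq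
  ... | eqh , eq₁ with fromℕ<-injective h h′ (h<X r H le) (h<X r′ H′ le′) eqh
  ... | refl with combine-injective (funToFin (lookup r)) _ (funToFin (lookup r′)) _
                    (inject≤-injective (columns≤ r H le) (columns≤ r′ H′ le′) _ _ eq₁)
  ... | eqr , eqH = cong₂ (tri h) (lookup-ext (funToFin-injective (lookup r) (lookup r′) eqr))
                      (encode-injective H H′ (X / suc h) _ _ eqH)

  -- The integer part of k / m for ∣ k ∣ ≤ m, plus one.
  digit : ℕ → ℤ → Fin 3
  digit m -[1+ _ ] = zero
  digit m (+ n) with n <? m
  ... | yes _ = suc zero
  ... | no  _ = suc (suc zero)

  ∣m⊖n∣< : ∀ {a b m} → a < m → b < m → ∣ a ℤ.⊖ b ∣ < m
  ∣m⊖n∣< {a} {b} a<m b<m = ≤-<-trans (ℤ.∣m⊝n∣≤m⊔n a b) (⊔-lub a<m b<m)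

  -- The digits stand for [-m, 0), [0, m) and, because of the bound on the absolute value, the
  -- single point m. Any two integers in one of these sets differ by less than m.
  digit-close : ∀ m .{{_ : NonZero m}} k l → ∣ k ∣ ≤ m → ∣ l ∣ ≤ m → digit m k ≡ digit m l → ∣ k ℤ.- l ∣ < m
  digit-close m -[1+ a ] -[1+ b ] k≤ l≤ eq =
    subst (λ z → ∣ z ∣ < m) (sym (ℤ.[1+m]⊖[1+n]≡m⊖n b a)) (∣m⊖n∣< l≤ k≤)
  digit-close m (+ a) -[1+ b ] k≤ l≤ eq with a <? m
  digit-close m (+ a) -[1+ b ] k≤ l≤ () | yes _
  digit-close m (+ a) -[1+ b ] k≤ l≤ () | no _
  digit-close m -[1+ a ] (+ b) k≤ l≤ eq with b <? m
  digit-close m -[1+ a ] (+ b) k≤ l≤ () | yes _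
  digit-close m -[1+ a ] (+ b) k≤ l≤ () | no _
  digit-close m (+ a) (+ b) k≤ l≤ eq with a <? m | b <? m
  ... | yes a<m | yes b<m = subst (λ z → ∣ z ∣ < m) (sym (ℤ.m-n≡m⊖n a b)) (∣m⊖n∣< a<m b<m)
  ... | no  a≮m | no  b≮m = subst (λ z → ∣ z ∣ < m)
    (sym (trans (cong (λ z → + a ℤ.- + z) (trans (≤-antisym l≤ (≮⇒≥ b≮m)) (≤-antisym (≮⇒≥ a≮m) k≤)))
      (ℤ.+-inverseʳ (+ a)))) (>-nonZero⁻¹ m)
  digit-close m (+ a) (+ b) k≤ l≤ () | yes _ | no _
  digit-close m (+ a) (+ b) k≤ l≤ () | no _  | yes _

  -- Membership in the parallelotope of points with all coordinates in [-1, 1], the denominator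
  -- `det H` being cleared.
  Bounded : ∀ {d} → Tri d → Vec ℤ d → Set
  Bounded H p = ∀ i → ∣ lookup (adj H p) i ∣ ≤ det H

  -- A point of the parallelotope is determined by its coset and by the
  -- integer parts of its coordinates.
  encode-point : ∀ {d} (H : Tri d) → Vec ℤ d → Fin (3 ^ d * det H)
  encode-point H p = combine (funToFin (λ i → digit (det H) (lookup (adj H p) i))) (red H p)

  -- Equal cosets give p = q + H t, so the scaled coordinates differ by `det H` times those of `t`.
  -- Equal digits keep these differences below `det H`, hence t = 0.
  encode-point-injective : ∀ {d} (H : Tri d) p q → Bounded H p → Bounded H q →
    encode-point H p ≡ encode-point H q → p ≡ q
  encode-point-injective {d} H p q p≤ q≤ eq
    with combine-injective (funToFin (λ i → digit (det H) (lookup (adj H p) i))) _ _ _ eq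
  ... | eqdigits , eqred with red-≡⇒ H eqred
  ... | t , p≡q+Ht = begin
    p                ≡⟨ p≡q+Ht ⟩
    q ⊕ apply H t    ≡⟨ cong (λ s → q ⊕ apply H s) t≡𝟘 ⟩
    q ⊕ apply H 𝟘    ≡⟨ cong (q ⊕_) (Linear.homo-𝟘 (apply-linear H)) ⟩
    q ⊕ 𝟘            ≡⟨ ⊕-identityʳ q ⟩
    q                ∎
    where
    open ≡-Reasoning
    m = det H
    k = adj H p
    l = adj H q
    k≡ : ∀ i → lookup k i ≡ lookup l i ℤ.+ + m ℤ.* lookup t i
    k≡ i = begin
      lookup k i
        ≡⟨ cong (λ x → lookup (adj H x) i) p≡q+Ht ⟩
      lookup (adj H (q ⊕ apply H t)) i
        ≡⟨ cong (λ x → lookup x i) (trans (Linear.homo-⊕ (adj-linear H) q (apply H t)) (cong (l ⊕_) (adj-apply H t))) ⟩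
      lookup (l ⊕ + m ⊙ t) i
        ≡⟨ trans (lookup-⊕ l (+ m ⊙ t) i) (cong (λ z → lookup l i ℤ.+ z) (lookup-⊙ (+ m) t i)) ⟩
      lookup l i ℤ.+ + m ℤ.* lookup t i ∎
    close : ∀ i → m * ∣ lookup t i ∣ < m * 1
    close i = subst₂ _<_ difference (sym (*-identityʳ m)) (digit-close m {{det-nonZero H}} (lookup k i) (lookup l i) (p≤ i) (q≤ i)
        (funToFin-injective (λ i → digit m (lookup k i)) (λ i → digit m (lookup l i)) eqdigits i))
      where
      lemma : ∀ a b → a ℤ.+ b ℤ.- a ≡ b
      lemma = ℤ-Solver.solve-∀
      difference : ∣ lookup k i ℤ.- lookup l i ∣ ≡ m * ∣ lookup t i ∣
      difference = trans (cong ∣_∣ (trans (cong (λ z → z ℤ.- lookup l i) (k≡ i)) (lemma (lookup l i) _)))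
        (ℤ.abs-* (+ m) (lookup t i))
    t≡𝟘 : t ≡ 𝟘
    t≡𝟘 = lookup-ext λ i → trans (ℤ.∣i∣≡0⇒i≡0 (n<1⇒n≡0 (*-cancelˡ-< m _ 1 (close i)))) (sym (lookup-𝟘 i))

  indicator : ∀ {n K} → (Fin n → Fin K) → Fin K → Fin 2
  indicator c b = if does (any? (λ j → c j ≟ b)) then suc zero else zero

  -- Only the set of values is recorded, so repetitions, order and length of a list of points leave
  -- no trace.
  encode-set : ∀ {n K} → (Fin n → Fin K) → Fin (2 ^ K)
  encode-set c = funToFin (indicator c)

  encode-set-≡⇒ : ∀ {n n′ K} (c : Fin n → Fin K) (c′ : Fin n′ → Fin K) →
    encode-set c ≡ encode-set c′ → ∀ j → ∃ λ k → c′ k ≡ c j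
  encode-set-≡⇒ c c′ eq j = member (any? (λ k → c′ k ≟ c j)) (trans (sym in-c) same)
    where
    same : indicator c (c j) ≡ indicator c′ (c j)
    same = funToFin-injective (indicator c) (indicator c′) eq (c j)
    in-c : indicator c (c j) ≡ suc zero
    in-c = cong (λ b → if b then suc zero else zero) (dec-true (any? (λ k → c k ≟ c j)) (j , refl))
    member : (dec : Dec (∃ λ k → c′ k ≡ c j)) → suc zero ≡ (if does dec then suc {1} zero else zero) → ∃ λ k → c′ k ≡ c j
    member (yes found) _ = found
    member (no  _)     ()

  -- The bound `X` replaces the individual determinants so that the codes of all polytopes share one
  -- type, in which they can be compared.
  record Normalised {d n} (X : ℕ) (w : Fin n → Vec ℤ d) : Set where
    field
      iso     : Iso d
      form    : Tri d
      det≤X   : det form ≤ X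
      bounded : ∀ j → Bounded form (Iso.to iso (w j))

    scaled≤ : 3 ^ d * det form ≤ 3 ^ d * X
    scaled≤ = *-monoʳ-≤ (3 ^ d) det≤X

    point-code : Fin n → Fin (3 ^ d * X)
    point-code j = inject≤ (encode-point form (Iso.to iso (w j))) scaled≤

    code : Fin (X ^ suc d * 2 ^ (3 ^ d * X))
    code = combine (encode form X det≤X) (encode-set point-code)

  open Normalised using (code)

  code-≡⇒ : ∀ {d n n′ X} {w : Fin n → Vec ℤ d} {w′ : Fin n′ → Vec ℤ d}
    (N : Normalised X w) (N′ : Normalised X w′) → code N ≡ code N′ →
    ∀ j → ∃ λ k → Iso.to (Normalised.iso N′) (w′ k) ≡ Iso.to (Normalised.iso N) (w j)
  code-≡⇒ {X = X} {w} {w′} N N′ eq j with combine-injective (encode N.form X N.det≤X) _ (encode N′.form X N′.det≤X) _ eq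
    where
    module N  = Normalised N
    module N′ = Normalised N′
  ... | eq-form , eq-set
    with refl ← encode-injective (Normalised.form N) (Normalised.form N′) X _ _ eq-form
    with encode-set-≡⇒ (Normalised.point-code N) (Normalised.point-code N′) eq-set j
  ... | k , eqk = k , encode-point-injective (Normalised.form N′) _ _ (Normalised.bounded N′ k) (Normalised.bounded N j)
    (inject≤-injective (Normalised.scaled≤ N′) (Normalised.scaled≤ N) _ _ eqk)

-- Convex hulls over an abstract ring with a notion of nonnegativity.

module Geometry where

  open import Level using (0ℓ)
  open import Algebra.Bundles using (CommutativeRing)
  open import Data.Fin.Base using (Fin; zero; suc)
  import Data.Integer.Base as ℤ
  open ℤ using (ℤ; +_; 0ℤ; 1ℤ)
  import Data.Integer.Properties as ℤ
  import Data.Nat.Base as ℕ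
  open ℕ using (ℕ; zero; suc)
  open import Data.Product.Base using (∃; _×_; _,_; proj₁; proj₂)
  import Data.Rational.Base as ℚ
  open ℚ using (ℚ; 0ℚ; 1ℚ; ½)
  import Data.Rational.Properties as ℚ
  open import Data.Vec.Base using (Vec; []; _∷_; lookup; map; tabulate)
  open import Data.Vec.Properties using (lookup-map)
  open import Data.Vec.Functional using (Vector)
  open import Function.Base using (_∘_)
  open import Relation.Binary.PropositionalEquality as ≡ using (_≡_; cong; subst; subst₂)
  open import Relation.Unary using (Pred; _∈_)
  open Minkowski using (norm)
  open LatticeBases using (dot)
  open IntegerLinearAlgebra using (comb; e; 𝟘; lookup-𝟘; lookup-⊕; lookup-⊙; _⊙_)

  -- What is needed of the real numbers, kept abstract because Agda unfolds
  -- the operations on Cauchy sequences too eagerly.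
  record Scalars : Set₁ where
    field
      commutativeRing : CommutativeRing 0ℓ 0ℓ
    open CommutativeRing commutativeRing public
    field
      NonNegative : Carrier → Set
      0≤-resp     : ∀ {x y} → x ≈ y → NonNegative x → NonNegative y
      0≤-+        : ∀ {x y} → NonNegative x → NonNegative y → NonNegative (x + y)
      0≤-*        : ∀ {x y} → NonNegative x → NonNegative y → NonNegative (x * y)
      fromℚ       : ℚ → Carrier
      fromℚ-+     : ∀ p q → fromℚ (p ℚ.+ q) ≈ fromℚ p + fromℚ q
      fromℚ-*     : ∀ p q → fromℚ (p ℚ.* q) ≈ fromℚ p * fromℚ q
      fromℚ-0     : fromℚ 0ℚ ≈ 0#
      fromℚ-1     : fromℚ 1ℚ ≈ 1#
      0≤-fromℚ    : ∀ {q} → 0ℚ ℚ.≤ q → NonNegative (fromℚ q)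
      ι           : ℤ → ℚ
      ι-+         : ∀ a b → ι (a ℤ.+ b) ≡ ι a ℚ.+ ι b
      ι-*         : ∀ a b → ι (a ℤ.* b) ≡ ι a ℚ.* ι b
      ι-0         : ι 0ℤ ≡ 0ℚ
      ι-1         : ι 1ℤ ≡ 1ℚ
      ι-mono      : ∀ {a b} → a ℤ.≤ b → ι a ℚ.≤ ι b

  module Convexity (𝕂 : Scalars) where

    open Scalars 𝕂 hiding (zero)
    open import Algebra.Properties.Semiring.Sum semiring
      using (sum; sum-cong-≋; ∑-distrib-+; ∑-comm; *-distribˡ-sum; *-distribʳ-sum; sum-replicate-zero)
    open import Algebra.Properties.Ring ring using (-‿distribˡ-*; -‿distribʳ-*; -‿involutive; -‿+-comm; -0#≈0#)
    open import Algebra.Solver.Ring.NaturalCoefficients.Default commutativeSemiring using (solve; con; _:+_; _:*_; _:=_)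
    open import Relation.Binary.Reasoning.Setoid setoid


    0≤-ι : ∀ {a} → 0ℤ ℤ.≤ a → 0ℚ ℚ.≤ ι a
    0≤-ι {a} 0≤a = subst (ℚ._≤ ι a) ι-0 (ι-mono 0≤a)

    fromℤ : ℤ → Carrier
    fromℤ z = fromℚ (ι z)

    ≡⇒≈ : ∀ {x y} → x ≡ y → x ≈ y
    ≡⇒≈ ≡.refl = refl

    fromℤ-0 : fromℤ 0ℤ ≈ 0#
    fromℤ-0 = trans (≡⇒≈ (cong fromℚ ι-0)) fromℚ-0

    fromℤ-1 : fromℤ 1ℤ ≈ 1#
    fromℤ-1 = trans (≡⇒≈ (cong fromℚ ι-1)) fromℚ-1

    fromℤ-+ : ∀ a b → fromℤ (a ℤ.+ b) ≈ fromℤ a + fromℤ b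
    fromℤ-+ a b = trans (≡⇒≈ (cong fromℚ (ι-+ a b))) (fromℚ-+ (ι a) (ι b))

    fromℤ-* : ∀ a b → fromℤ (a ℤ.* b) ≈ fromℤ a * fromℤ b
    fromℤ-* a b = trans (≡⇒≈ (cong fromℚ (ι-* a b))) (fromℚ-* (ι a) (ι b))

    fromℚ-product : ∀ {p q r} → p ℚ.* q ≡ r → fromℚ p * fromℚ q ≈ fromℚ r
    fromℚ-product {p} {q} eq = trans (sym (fromℚ-* p q)) (≡⇒≈ (cong fromℚ eq))

    ∑-zero : ∀ {n} {f : Vector Carrier n} → (∀ i → f i ≈ 0#) → sum f ≈ 0#
    ∑-zero {n} f≈0 = trans (sum-cong-≋ f≈0) (sum-replicate-zero n)

    ∑-e : ∀ {n} (i : Fin n) (f : Vector Carrier n) → sum (λ k → fromℤ (lookup (e i) k) * f k) ≈ f i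
    ∑-e zero f = begin
      fromℤ 1ℤ * f zero + sum (λ k → fromℤ (lookup 𝟘 k) * f (suc k))
        ≈⟨ +-cong (trans (*-congʳ fromℤ-1) (*-identityˡ _)) (∑-zero {f = λ k → fromℤ (lookup 𝟘 k) * f (suc k)} λ k →
             trans (*-congʳ (trans (≡⇒≈ (cong fromℤ (lookup-𝟘 k))) fromℤ-0)) (zeroˡ _)) ⟩
      f zero + 0#
        ≈⟨ +-identityʳ _ ⟩
      f zero ∎
    ∑-e (suc i) f = begin
      fromℤ 0ℤ * f zero + sum (λ k → fromℤ (lookup (e i) k) * f (suc k))
        ≈⟨ +-cong (trans (*-congʳ fromℤ-0) (zeroˡ _)) (∑-e i (f ∘ suc)) ⟩
      0# + f (suc i)
        ≈⟨ +-identityˡ _ ⟩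
      f (suc i) ∎

    e-sym : ∀ {n} (i k : Fin n) → lookup (e i) k ≡ lookup (e k) i
    e-sym zero    zero    = ≡.refl
    e-sym zero    (suc k) = lookup-𝟘 k
    e-sym (suc i) zero    = ≡.sym (lookup-𝟘 i)
    e-sym (suc i) (suc k) = e-sym i k

    fromℤ-comb : ∀ {m n} (V : Fin m → Vec ℤ n) a l →
      fromℤ (lookup (comb V a) l) ≈ sum (λ i → fromℤ (lookup a i) * fromℤ (lookup (V i) l))
    fromℤ-comb V []      l = trans (≡⇒≈ (cong fromℤ (lookup-𝟘 l))) fromℤ-0
    fromℤ-comb V (k ∷ a) l = begin
      fromℤ (lookup (comb V (k ∷ a)) l)
        ≈⟨ ≡⇒≈ (cong fromℤ (≡.trans (lookup-⊕ (k ⊙ V zero) _ l) (cong (ℤ._+ _) (lookup-⊙ k (V zero) l)))) ⟩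
      fromℤ (k ℤ.* lookup (V zero) l ℤ.+ lookup (comb (V ∘ suc) a) l)
        ≈⟨ fromℤ-+ (k ℤ.* lookup (V zero) l) (lookup (comb (V ∘ suc) a) l) ⟩
      fromℤ (k ℤ.* lookup (V zero) l) + fromℤ (lookup (comb (V ∘ suc) a) l)
        ≈⟨ +-cong (fromℤ-* k (lookup (V zero) l)) (fromℤ-comb (V ∘ suc) a l) ⟩
      fromℤ k * fromℤ (lookup (V zero) l) + sum (λ i → fromℤ (lookup a i) * fromℤ (lookup (V (suc i)) l)) ∎

    0≤-sum : ∀ {n} (f : Vector Carrier n) → (∀ i → NonNegative (f i)) → NonNegative (sum f)
    0≤-sum {zero}  f 0≤f = 0≤-resp fromℚ-0 (0≤-fromℚ ℚ.≤-refl)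
    0≤-sum {suc n} f 0≤f = 0≤-+ (0≤f zero) (0≤-sum (f ∘ suc) (0≤f ∘ suc))

    Point : ℕ → Set
    Point d = Vector Carrier d

    infix 4 _≋_
    _≋_ : ∀ {d} → Point d → Point d → Set
    x ≋ y = ∀ k → x k ≈ y k

    conv : ∀ {d n} → Vector (Point d) n → Pred (Point d) 0ℓ
    conv v x = ∃ λ c →
      (∀ i → NonNegative (c i)) × (sum c ≈ 1#) × (x ≋ λ k → sum λ i → c i * v i k)

    conv-resp : ∀ {d n} {v : Vector (Point d) n} {x y} → y ≋ x → x ∈ conv v → y ∈ conv v
    conv-resp y≋x (c , 0≤c , ∑c≈1 , x≋) = c , 0≤c , ∑c≈1 , λ k → trans (y≋x k) (x≋ k)

    vertex∈conv : ∀ {d n} (v : Vector (Point d) n) i → v i ∈ conv v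
    vertex∈conv v i =
      (λ k → fromℤ (lookup (e i) k)) , (λ k → 0≤-fromℚ (0≤-ι (0≤e i k))) ,
      trans (sum-cong-≋ {x = λ k → fromℤ (lookup (e i) k)} λ k → sym (*-identityʳ _)) (∑-e i (λ _ → 1#)) ,
      λ l → sym (∑-e i (λ k → v k l))
      where
      0≤e : ∀ {n} (i k : Fin n) → 0ℤ ℤ.≤ lookup (e i) k
      0≤e zero    zero    = ℤ.+≤+ ℕ.z≤n
      0≤e zero    (suc k) = ℤ.≤-reflexive (≡.sym (lookup-𝟘 k))
      0≤e (suc i) zero    = ℤ.≤-refl
      0≤e (suc i) (suc k) = 0≤e i k

    sum-assoc : ∀ {m n} (c : Vector Carrier m) (Λ : Fin m → Fin n → Carrier) (x : Vector Carrier n) →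
      sum (λ i → c i * sum (λ k → Λ i k * x k)) ≈ sum (λ k → sum (λ i → c i * Λ i k) * x k)
    sum-assoc c Λ x = begin
      sum (λ i → c i * sum (λ k → Λ i k * x k))      ≈⟨ sum-cong-≋ (λ i → *-distribˡ-sum (c i) (λ k → Λ i k * x k)) ⟩
      sum (λ i → sum λ k → c i * (Λ i k * x k))      ≈⟨ ∑-comm (λ i k → c i * (Λ i k * x k)) ⟩
      sum (λ k → sum λ i → c i * (Λ i k * x k))      ≈⟨ sum-cong-≋ (λ k → sum-cong-≋ λ i → sym (*-assoc (c i) (Λ i k) (x k))) ⟩
      sum (λ k → sum λ i → c i * Λ i k * x k)        ≈⟨ sum-cong-≋ (λ k → sym (*-distribʳ-sum (x k) (λ i → c i * Λ i k))) ⟩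
      sum (λ k → sum (λ i → c i * Λ i k) * x k)      ∎

    -- Convex coefficients of convex combinations multiply like stochastic matrices.
    conv-trans : ∀ {d m n} {u : Vector (Point d) m} {v : Vector (Point d) n} →
      (∀ i → u i ∈ conv v) → ∀ {y} → y ∈ conv u → y ∈ conv v
    conv-trans {n = n} {u} {v} u∈ {y} (c , 0≤c , ∑c≈1 , y≋) =
      (λ k → sum λ i → c i * Λ i k) ,
      (λ k → 0≤-sum (λ i → c i * Λ i k) λ i → 0≤-* (0≤c i) (proj₁ (proj₂ (u∈ i)) k)) ,
      (begin
        sum (λ k → sum λ i → c i * Λ i k)         ≈⟨ sum-cong-≋ {n} (λ k → sym (*-identityʳ _)) ⟩
        sum (λ k → sum (λ i → c i * Λ i k) * 1#)  ≈⟨ sum-assoc c Λ (λ _ → 1#) ⟨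
        sum (λ i → c i * sum (λ k → Λ i k * 1#))  ≈⟨ sum-cong-≋ (λ i → trans (*-congˡ (trans (sum-cong-≋ {n} (λ k → *-identityʳ (Λ i k)))
                                                       (proj₁ (proj₂ (proj₂ (u∈ i)))))) (*-identityʳ (c i))) ⟩
        sum c                                     ≈⟨ ∑c≈1 ⟩
        1#                                        ∎) ,
      λ l → begin
        y l                                          ≈⟨ y≋ l ⟩
        sum (λ i → c i * u i l)                      ≈⟨ sum-cong-≋ (λ i → *-congˡ (proj₂ (proj₂ (proj₂ (u∈ i))) l)) ⟩
        sum (λ i → c i * sum (λ k → Λ i k * v k l))  ≈⟨ sum-assoc c Λ (λ k → v k l) ⟩
        sum (λ k → sum (λ i → c i * Λ i k) * v k l)  ∎
      where
      Λ : ∀ i → Vector Carrier _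
      Λ i = proj₁ (u∈ i)

    -- The weights are (1 + t) / 2 at x and (1 - t) / 2 at -x; no decision on the sign of `t` is
    -- made.
    segment : ∀ {d n} {v : Vector (Point d) n} {x : Point d} t → x ∈ conv v → (λ k → - x k) ∈ conv v →
      NonNegative (1# + t) → NonNegative (1# - t) → (λ k → t * x k) ∈ conv v
    segment {d} {v = v} {x} t x∈ -x∈ 0≤1+t 0≤1-t = conv-trans {u = ends} ends∈
      (weights , 0≤weights , trans (weights-sum h t (- t)) (trans (+-cong h+h≈1 (trans (*-congˡ (-‿inverseʳ t)) (zeroʳ h))) (+-identityʳ 1#)) , λ k → sym (position (x k)))
      where
      h : Carrier
      h = fromℚ ½
      h+h≈1 : h + h ≈ 1#
      h+h≈1 = trans (sym (fromℚ-+ ½ ½)) fromℚ-1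
      ends : Vector (Point d) 2
      ends zero    = x
      ends (suc _) = λ k → - x k
      ends∈ : ∀ i → ends i ∈ conv v
      ends∈ zero    = x∈
      ends∈ (suc _) = -x∈
      weights : Vector Carrier 2
      weights zero    = h * (1# + t)
      weights (suc _) = h * (1# - t)
      0≤h : NonNegative h
      0≤h = 0≤-fromℚ (ℚ.<⇒≤ (ℚ.positive⁻¹ ½))
      0≤weights : ∀ i → NonNegative (weights i)
      0≤weights zero    = 0≤-* 0≤h 0≤1+t
      0≤weights (suc _) = 0≤-* 0≤h 0≤1-t
      weights-sum : ∀ h t s → h * (1# + t) + (h * (1# + s) + 0#) ≈ (h + h) + h * (t + s)
      weights-sum = solve 3 (λ h t s → h :* (con 1 :+ t) :+ (h :* (con 1 :+ s) :+ con 0) := (h :+ h) :+ h :* (t :+ s)) refl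
      regroup : ∀ h t s x y → h * (1# + t) * x + (h * (1# + s) * y + 0#) ≈ h * (x + y) + h * (t * x + s * y)
      regroup = solve 5 (λ h t s x y → h :* (con 1 :+ t) :* x :+ (h :* (con 1 :+ s) :* y :+ con 0) :=
        h :* (x :+ y) :+ h :* (t :* x :+ s :* y)) refl
      neg*neg : ∀ x y → - x * - y ≈ x * y
      neg*neg x y = trans (sym (-‿distribˡ-* x (- y))) (trans (-‿cong (sym (-‿distribʳ-* x y))) (-‿involutive (x * y)))
      position : ∀ x → h * (1# + t) * x + (h * (1# - t) * (- x) + 0#) ≈ t * x
      position x = begin
        h * (1# + t) * x + (h * (1# - t) * (- x) + 0#)    ≈⟨ regroup h t (- t) x (- x) ⟩
        h * (x - x) + h * (t * x + - t * - x)             ≈⟨ +-cong (trans (*-congˡ (-‿inverseʳ x)) (zeroʳ h)) (*-congˡ (+-congˡ (neg*neg t x))) ⟩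
        0# + h * (t * x + t * x)                          ≈⟨ trans (+-identityˡ _) (solve 2 (λ h y → h :* (y :+ y) := (h :+ h) :* y) refl h (t * x)) ⟩
        (h + h) * (t * x)                                 ≈⟨ trans (*-congʳ h+h≈1) (*-identityˡ _) ⟩
        t * x                                             ∎

    row-conv : ∀ {d n} (f : Vector Carrier d) (c : Vector Carrier n) (v : Vector (Point d) n) →
      sum (λ l → f l * sum (λ i → c i * v i l)) ≈ sum (λ i → c i * sum (λ l → f l * v i l))
    row-conv {d} {n} f c v = begin
      sum (λ l → f l * sum (λ i → c i * v i l))      ≈⟨ sum-cong-≋ {d} (λ l → *-distribˡ-sum (f l) (λ i → c i * v i l)) ⟩
      sum (λ l → sum λ i → f l * (c i * v i l))      ≈⟨ ∑-comm (λ l i → f l * (c i * v i l)) ⟩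
      sum (λ i → sum λ l → f l * (c i * v i l))      ≈⟨ sum-cong-≋ {n} (λ i → sum-cong-≋ {d} λ l → exchange (f l) (c i) (v i l)) ⟩
      sum (λ i → sum λ l → c i * (f l * v i l))      ≈⟨ sum-cong-≋ {n} (λ i → sym (*-distribˡ-sum (c i) (λ l → f l * v i l))) ⟩
      sum (λ i → c i * sum (λ l → f l * v i l))      ∎
      where
      exchange : ∀ a b x → a * (b * x) ≈ b * (a * x)
      exchange = solve 3 (λ a b x → a :* (b :* x) := b :* (a :* x)) refl

    vanish-conv : ∀ {d n} {v : Vector (Point d) n} (f : Vector Carrier d) →
      (∀ i → sum (λ l → f l * v i l) ≈ 0#) → ∀ {x} → x ∈ conv v → sum (λ l → f l * x l) ≈ 0#
    vanish-conv {d} {n} {v} f vanish {x} (c , _ , _ , x≋) = begin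
      sum (λ l → f l * x l)                          ≈⟨ sum-cong-≋ {d} (λ l → *-congˡ (x≋ l)) ⟩
      sum (λ l → f l * sum (λ i → c i * v i l))      ≈⟨ row-conv f c v ⟩
      sum (λ i → c i * sum (λ l → f l * v i l))      ≈⟨ ∑-zero {n} {λ i → c i * sum (λ l → f l * v i l)} (λ i → trans (*-congˡ (vanish i)) (zeroʳ (c i))) ⟩
      0#                                             ∎

    image-conv : ∀ {d n n′} (M : Fin d → Fin d → Carrier) (v : Vector (Point d) n) (v′ : Vector (Point d) n′)
      (σ : Fin n → Fin n′) → (∀ i k → sum (λ l → M k l * v i l) ≈ v′ (σ i) k) →
      ∀ {x y} → x ∈ conv v → (∀ k → y k ≈ sum (λ l → M k l * x l)) → y ∈ conv v′
    image-conv {d} {n} M v v′ σ image {x} {y} (c , 0≤c , ∑c≈1 , x≋) y≋ =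
      conv-trans {u = v′ ∘ σ} (λ i → vertex∈conv v′ (σ i)) (c , 0≤c , ∑c≈1 , λ k → begin
        y k                                              ≈⟨ y≋ k ⟩
        sum (λ l → M k l * x l)                          ≈⟨ sum-cong-≋ {d} (λ l → *-congˡ (x≋ l)) ⟩
        sum (λ l → M k l * sum (λ i → c i * v i l))      ≈⟨ row-conv (M k) c v ⟩
        sum (λ i → c i * sum (λ l → M k l * v i l))      ≈⟨ sum-cong-≋ {n} (λ i → *-congˡ (image i k)) ⟩
        sum (λ i → c i * v′ (σ i) k)                     ∎)

    -- The preimage is found without inverting `M`: the convex coefficients with respect to `v′` are
    -- reused on the points that `τ` selects from `v`.
    preimage-conv : ∀ {d n n′} (M : Fin d → Fin d → Carrier) (v : Vector (Point d) n) (v′ : Vector (Point d) n′)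
      (τ : Fin n′ → Fin n) → (∀ j k → sum (λ l → M k l * v (τ j) l) ≈ v′ j k) →
      ∀ {y} → y ∈ conv v′ → ∃ λ x → x ∈ conv v × (∀ k → y k ≈ sum (λ l → M k l * x l))
    preimage-conv {n′ = n′} M v v′ τ image {y} (c , 0≤c , ∑c≈1 , y≋) =
      (λ l → sum (λ j → c j * v (τ j) l)) ,
      conv-trans {u = v ∘ τ} (λ j → vertex∈conv v (τ j)) (c , 0≤c , ∑c≈1 , λ _ → refl) ,
      λ k → begin
        y k                                                   ≈⟨ y≋ k ⟩
        sum (λ j → c j * v′ j k)                              ≈⟨ sum-cong-≋ {n′} (λ j → *-congˡ (sym (image j k))) ⟩
        sum (λ j → c j * sum (λ l → M k l * v (τ j) l))       ≈⟨ row-conv (M k) c (v ∘ τ) ⟨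
        sum (λ l → M k l * sum (λ j → c j * v (τ j) l))       ∎

    -- The bound ∣x∣ ≤ q as two conditions, since nonnegativity is the only order relation among the
    -- scalars.
    Within : Carrier → ℚ → Set
    Within x q = NonNegative (fromℚ q + x) × NonNegative (fromℚ q - x)

    within-resp : ∀ {x y q} → x ≈ y → Within x q → Within y q
    within-resp x≈y (lo , hi) = 0≤-resp (+-congˡ x≈y) lo , 0≤-resp (+-congˡ (-‿cong x≈y)) hi

    within-+ : ∀ {x y p q} → Within x p → Within y q → Within (x + y) (p ℚ.+ q)
    within-+ {x} {y} {p} {q} (lo₁ , hi₁) (lo₂ , hi₂) =
      0≤-resp (combine x y) (0≤-+ lo₁ lo₂) ,
      0≤-resp (trans (combine (- x) (- y)) (+-congˡ (-‿+-comm x y))) (0≤-+ hi₁ hi₂)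
      where
      combine : ∀ x y → (fromℚ p + x) + (fromℚ q + y) ≈ fromℚ (p ℚ.+ q) + (x + y)
      combine x y = trans (solve 4 (λ p q x y → (p :+ x) :+ (q :+ y) := (p :+ q) :+ (x :+ y)) refl (fromℚ p) (fromℚ q) x y)
        (+-congʳ (sym (fromℚ-+ p q)))

    within-neg : ∀ {x q} → Within x q → Within (- x) q
    within-neg {x} (lo , hi) = hi , 0≤-resp (+-congˡ (sym (-‿involutive x))) lo

    within-* : ∀ {x q} r → 0ℚ ℚ.≤ r → Within x q → Within (fromℚ r * x) (r ℚ.* q)
    within-* {x} {q} r 0≤r (lo , hi) =
      0≤-resp (scale x) (0≤-* (0≤-fromℚ 0≤r) lo) ,
      0≤-resp (trans (scale (- x)) (+-congˡ (sym (-‿distribʳ-* (fromℚ r) x)))) (0≤-* (0≤-fromℚ 0≤r) hi)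
      where
      scale : ∀ x → fromℚ r * (fromℚ q + x) ≈ fromℚ (r ℚ.* q) + fromℚ r * x
      scale x = trans (distribˡ (fromℚ r) (fromℚ q) x) (+-congʳ (sym (fromℚ-* r q)))

    within-mono : ∀ {x p q} → p ℚ.≤ q → Within x p → Within x q
    within-mono {x} {p} {q} p≤q (lo , hi) = enlarge x lo , enlarge (- x) hi
      where
      0≤q-p : 0ℚ ℚ.≤ q ℚ.- p
      0≤q-p = subst (ℚ._≤ q ℚ.- p) (ℚ.+-inverseʳ p) (ℚ.+-monoˡ-≤ (ℚ.- p) p≤q)
      q≡ : q ℚ.- p ℚ.+ p ≡ q
      q≡ = ≡.trans (ℚ.+-assoc q (ℚ.- p) p) (≡.trans (cong (q ℚ.+_) (ℚ.+-inverseˡ p)) (ℚ.+-identityʳ q))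
      enlarge : ∀ x → NonNegative (fromℚ p + x) → NonNegative (fromℚ q + x)
      enlarge x lo = 0≤-resp (trans (sym (+-assoc _ _ x))
        (+-congʳ (trans (sym (fromℚ-+ (q ℚ.- p) p)) (≡⇒≈ (cong fromℚ q≡))))) (0≤-+ (0≤-fromℚ 0≤q-p) lo)

    fromℤ-neg : ∀ k → fromℤ (ℤ.- k) ≈ - fromℤ k
    fromℤ-neg k = begin
      fromℤ (ℤ.- k)                                    ≈⟨ +-identityˡ _ ⟨
      0# + fromℤ (ℤ.- k)                               ≈⟨ +-congʳ (-‿inverseˡ (fromℤ k)) ⟨
      (- fromℤ k + fromℤ k) + fromℤ (ℤ.- k)            ≈⟨ +-assoc _ _ _ ⟩
      - fromℤ k + (fromℤ k + fromℤ (ℤ.- k))            ≈⟨ +-congˡ (sym (fromℤ-+ k (ℤ.- k))) ⟩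
      - fromℤ k + fromℤ (k ℤ.- k)                      ≈⟨ +-congˡ (trans (≡⇒≈ (cong fromℤ (ℤ.+-inverseʳ k))) fromℤ-0) ⟩
      - fromℤ k + 0#                                   ≈⟨ +-identityʳ _ ⟩
      - fromℤ k                                        ∎

    within-ℤ* : ∀ {x q} k → Within x q → Within (fromℤ k * x) (ι (+ ℤ.∣ k ∣) ℚ.* q)
    within-ℤ* (+ n) w = within-* (ι (+ n)) (0≤-ι (ℤ.+≤+ ℕ.z≤n)) w
    within-ℤ* {x} ℤ.-[1+ n ] w = within-resp
      (trans (-‿distribˡ-* _ x) (*-congʳ (sym (fromℤ-neg ℤ.+[1+ n ]))))
      (within-neg (within-* (ι ℤ.+[1+ n ]) (0≤-ι (ℤ.+≤+ ℕ.z≤n)) w))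

    within-dot : ∀ {n q} (row : Fin n → ℤ) (δ : Vector Carrier n) → (∀ k → Within (δ k) q) →
      Within (sum (λ k → fromℤ (row k) * δ k)) (ι (+ norm (tabulate row)) ℚ.* q)
    within-dot {zero}  {q} row δ δ≤ = subst (Within 0#) (≡.sym (≡.trans (cong (ℚ._* q) ι-0) (ℚ.*-zeroˡ q)))
      (0≤-resp (sym (+-identityʳ _)) (0≤-fromℚ ℚ.≤-refl) ,
       0≤-resp (sym (trans (+-congˡ -0#≈0#) (+-identityʳ _))) (0≤-fromℚ ℚ.≤-refl))
    within-dot {suc n} {q} row δ δ≤ = subst (Within _) bound
      (within-+ (within-ℤ* (row zero) (δ≤ zero)) (within-dot (row ∘ suc) (δ ∘ suc) (δ≤ ∘ suc)))
      where
      rest = norm (tabulate (row ∘ suc))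
      bound : ι (+ ℤ.∣ row zero ∣) ℚ.* q ℚ.+ ι (+ rest) ℚ.* q ≡ ι (+ (ℤ.∣ row zero ∣ ℕ.+ rest)) ℚ.* q
      bound = ≡.trans (≡.sym (ℚ.*-distribʳ-+ q (ι (+ ℤ.∣ row zero ∣)) (ι (+ rest)))) (cong (ℚ._* q) (≡.sym (ι-+ (+ ℤ.∣ row zero ∣) (+ rest))))

    within-fromℤ : ∀ k → Within (fromℤ k) (ι (+ ℤ.∣ k ∣))
    within-fromℤ k = within-resp (*-identityʳ _) (subst (Within _) (ℚ.*-identityʳ _) (within-ℤ* k
      (0≤-resp (+-congˡ fromℚ-1) (0≤-+ 0≤1 0≤1) ,
       0≤-resp (trans fromℚ-0 (trans (sym (-‿inverseʳ 1#)) (+-congʳ (sym fromℚ-1)))) (0≤-fromℚ {0ℚ} ℚ.≤-refl))))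
      where
      0≤1 : NonNegative (fromℚ 1ℚ)
      0≤1 = 0≤-fromℚ (ℚ.<⇒≤ (ℚ.positive⁻¹ 1ℚ))

    fromℤ-norm : ∀ {n} (x : Vec ℤ n) → sum (λ i → fromℤ (+ ℤ.∣ lookup x i ∣)) ≈ fromℤ (+ norm x)
    fromℤ-norm []      = sym fromℤ-0
    fromℤ-norm (a ∷ x) = trans (+-congˡ (fromℤ-norm x)) (sym (fromℤ-+ (+ ℤ.∣ a ∣) (+ norm x)))

    -- A point near z lies in the polytope if z = Σ (aᵢ / N) Vᵢ with
    -- Σ ∣aᵢ∣ < N: it is Σ sᵢ (tᵢ Vᵢ) with ∣tᵢ∣ ≤ 1 and weights
    -- sᵢ = (D ∣aᵢ∣ + G) / (D N), which add up to 1 if D G + D Σ ∣aᵢ∣ = D N.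
    -- The columns of W are m times the coordinates of the unit vectors, and
    -- rS, rQ, rm are the reciprocals of D ∣aᵢ∣ + G, of Q = D N and of m.
    module _ {d n} (v : Vector (Point d) n) (V W : Fin d → Vec ℤ d) (a z : Vec ℤ d) (m N D G : ℕ)
      (comb-a : comb V a ≡ + N ⊙ z) (comb-W : ∀ k → comb V (W k) ≡ + m ⊙ e k)
      (V∈  : ∀ i → (λ l → fromℤ (lookup (V i) l)) ∈ conv v)
      (-V∈ : ∀ i → (λ l → - fromℤ (lookup (V i) l)) ∈ conv v) where

      S : Fin d → ℕ
      S i = D ℕ.* ℤ.∣ lookup a i ∣ ℕ.+ G

      Q : ℕ
      Q = D ℕ.* N

      near-point∈conv : (rS : Fin d → ℚ) (rQ rm ε : ℚ) → (∀ i → 0ℚ ℚ.≤ rS i) → 0ℚ ℚ.≤ rQ → 0ℚ ℚ.≤ rm →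
        (∀ i → ι (+ S i) ℚ.* rS i ≡ 1ℚ) → ι (+ Q) ℚ.* rQ ≡ 1ℚ → ι (+ m) ℚ.* rm ≡ 1ℚ →
        1 ℕ.≤ G → norm (map (λ k → + (D ℕ.* ℤ.∣ k ∣ ℕ.+ G)) a) ≡ Q →
        (∀ i → ι (+ Q) ℚ.* rm ℚ.* (ι (+ norm (tabulate (λ k → lookup (W k) i))) ℚ.* ε) ℚ.≤ 1ℚ) →
        ∀ {y} → (∀ k → Within (y k - fromℤ (lookup z k)) ε) → y ∈ conv v
      near-point∈conv rS rQ rm ε 0≤rS 0≤rQ 0≤rm S*rS Q*rQ m*rm 1≤G ∑S≡Q small {y} near =
        conv-trans {u = λ i l → t i * V′ i l}
          (λ i → segment (t i) (V∈ i) (-V∈ i) (0≤-resp (+-congʳ fromℚ-1) (proj₁ (∣t∣≤1 i))) (0≤-resp (+-congʳ fromℚ-1) (proj₂ (∣t∣≤1 i))))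
          (s , 0≤s , ∑s≈1 , λ l → sym (representation l))
        where
        δ : Point d
        δ k = y k - fromℤ (lookup z k)
        V′ : Fin d → Point d
        V′ i l = fromℤ (lookup (V i) l)
        w : Fin d → Fin d → Carrier
        w k i = fromℤ (lookup (W k) i)
        X A t s : Vector Carrier d
        X i = sum (λ k → w k i * δ k)
        A i = fromℤ (+ D ℤ.* lookup a i)
        -- `X i` divided by m is the i-th coordinate of the deviation `δ`. The definition is such
        -- that sᵢ tᵢ = aᵢ / N + Xᵢ / m, and the two summands yield z and `δ` separately.
        t i = fromℚ (rS i) * (A i + fromℚ (ι (+ Q) ℚ.* rm) * X i)
        s i = fromℚ (ι (+ S i) ℚ.* rQ)
        ρ μ κ : Carrier
        ρ = fromℚ rQ
        μ = fromℚ rm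
        κ = fromℤ (+ Q)
        0≤ι+ : ∀ n → 0ℚ ℚ.≤ ι (+ n)
        0≤ι+ n = 0≤-ι (ℤ.+≤+ ℕ.z≤n)
        0≤ℚ* : ∀ {p q} → 0ℚ ℚ.≤ p → 0ℚ ℚ.≤ q → 0ℚ ℚ.≤ p ℚ.* q
        0≤ℚ* {p} {q} 0≤p 0≤q = subst (ℚ._≤ p ℚ.* q) (ℚ.*-zeroʳ p) (ℚ.*-monoˡ-≤-nonNeg p {{ℚ.nonNegative 0≤p}} 0≤q)
        0≤s : ∀ i → NonNegative (s i)
        0≤s i = 0≤-fromℚ (0≤ℚ* (0≤ι+ (S i)) 0≤rQ)
        κ*ρ : κ * ρ ≈ 1#
        κ*ρ = trans (fromℚ-product Q*rQ) fromℚ-1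
        ∑s≈1 : sum s ≈ 1#
        ∑s≈1 = begin
          sum s                                     ≈⟨ sum-cong-≋ {d} (λ i → trans (fromℚ-* (ι (+ S i)) rQ) (*-congʳ (≡⇒≈ (cong (λ k → fromℤ (+ ℤ.∣ k ∣)) (≡.sym (lookup-map i _ a)))))) ⟩
          sum (λ i → fromℤ (+ ℤ.∣ lookup S′ i ∣) * ρ)
                                                    ≈⟨ *-distribʳ-sum ρ (λ i → fromℤ (+ ℤ.∣ lookup S′ i ∣)) ⟨
          sum (λ i → fromℤ (+ ℤ.∣ lookup S′ i ∣)) * ρ
                                                    ≈⟨ *-congʳ (trans (fromℤ-norm S′) (≡⇒≈ (cong (λ n → fromℤ (+ n)) ∑S≡Q))) ⟩
          κ * ρ                                     ≈⟨ κ*ρ ⟩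
          1#                                        ∎
          where
          S′ : Vec ℤ d
          S′ = map (λ k → + (D ℕ.* ℤ.∣ k ∣ ℕ.+ G)) a
        -- `small` bounds the part due to the deviation by 1, and the slack G ≥ 1 in `S i` makes
        -- room for it beside D ∣aᵢ∣.
        ∣t∣≤1 : ∀ i → Within (t i) 1ℚ
        ∣t∣≤1 i = subst (Within (t i)) (≡.trans (ℚ.*-comm (rS i) _) (S*rS i)) (within-* (rS i) (0≤rS i)
          (within-mono bound (within-+ (within-fromℤ (+ D ℤ.* lookup a i))
            (within-mono (small i) (within-* _ (0≤ℚ* (0≤ι+ Q) 0≤rm) (within-dot (λ k → lookup (W k) i) δ near))))))
          where
          c = D ℕ.* ℤ.∣ lookup a i ∣
          ∣Da∣ : ℤ.∣ + D ℤ.* lookup a i ∣ ≡ c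
          ∣Da∣ = ℤ.abs-* (+ D) (lookup a i)
          1≤ιG : 1ℚ ℚ.≤ ι (+ G)
          1≤ιG = subst (ℚ._≤ ι (+ G)) ι-1 (ι-mono (ℤ.+≤+ 1≤G))
          bound : ι (+ ℤ.∣ + D ℤ.* lookup a i ∣) ℚ.+ 1ℚ ℚ.≤ ι (+ S i)
          bound = subst₂ ℚ._≤_ (cong (λ n → ι (+ n) ℚ.+ 1ℚ) (≡.sym ∣Da∣)) (≡.sym (ι-+ (+ c) (+ G)))
            (ℚ.+-monoʳ-≤ (ι (+ c)) 1≤ιG)
        term : ∀ i l → s i * (t i * V′ i l) ≈ (ρ * fromℤ (+ D)) * (fromℤ (lookup a i) * V′ i l) + μ * (X i * V′ i l)
        term i l = begin
          s i * (t i * V′ i l)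
            ≈⟨ *-cong (fromℚ-* (ι (+ S i)) rQ) (*-congʳ (*-congˡ (+-cong (fromℤ-* (+ D) (lookup a i)) (*-congʳ (fromℚ-* (ι (+ Q)) rm))))) ⟩
          (σ * ρ) * (τ * (fromℤ (+ D) * α + κ * μ * X i) * V′ i l)
            ≈⟨ solve 9 (λ σ ρ τ D α κ μ X V → (σ :* ρ) :* (τ :* (D :* α :+ κ :* μ :* X) :* V) :=
                 (σ :* τ) :* ((ρ :* D) :* (α :* V) :+ (κ :* ρ) :* (μ :* (X :* V)))) refl
                 σ ρ τ (fromℤ (+ D)) α κ μ (X i) (V′ i l) ⟩
          (σ * τ) * ((ρ * fromℤ (+ D)) * (α * V′ i l) + (κ * ρ) * (μ * (X i * V′ i l)))
            ≈⟨ trans (*-congʳ (trans (fromℚ-product (S*rS i)) fromℚ-1)) (trans (*-identityˡ _)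
                 (+-congˡ (trans (*-congʳ κ*ρ) (*-identityˡ _)))) ⟩
          (ρ * fromℤ (+ D)) * (α * V′ i l) + μ * (X i * V′ i l) ∎
          where
          σ = fromℤ (+ S i)
          τ = fromℚ (rS i)
          α = fromℤ (lookup a i)
        lattice-part : ∀ l → (ρ * fromℤ (+ D)) * sum (λ i → fromℤ (lookup a i) * V′ i l) ≈ fromℤ (lookup z l)
        lattice-part l = begin
          (ρ * fromℤ (+ D)) * sum (λ i → fromℤ (lookup a i) * V′ i l)
            ≈⟨ *-congˡ (trans (sym (fromℤ-comb V a l)) (trans (≡⇒≈ (cong fromℤ (≡.trans (cong (λ x → lookup x l) comb-a) (lookup-⊙ (+ N) z l))))
                 (fromℤ-* (+ N) (lookup z l)))) ⟩
          (ρ * fromℤ (+ D)) * (fromℤ (+ N) * fromℤ (lookup z l))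
            ≈⟨ solve 4 (λ ρ D N z → (ρ :* D) :* (N :* z) := ((D :* N) :* ρ) :* z) refl ρ (fromℤ (+ D)) (fromℤ (+ N)) (fromℤ (lookup z l)) ⟩
          ((fromℤ (+ D) * fromℤ (+ N)) * ρ) * fromℤ (lookup z l)
            ≈⟨ *-congʳ (*-congʳ (trans (sym (fromℤ-* (+ D) (+ N))) (≡⇒≈ (cong fromℤ (≡.sym (ℤ.pos-* D N)))))) ⟩
          (κ * ρ) * fromℤ (lookup z l)
            ≈⟨ trans (*-congʳ κ*ρ) (*-identityˡ _) ⟩
          fromℤ (lookup z l) ∎
        deviation : ∀ l → μ * sum (λ i → X i * V′ i l) ≈ δ l
        deviation l = begin
          μ * sum (λ i → X i * V′ i l)
            ≈⟨ *-congˡ (sum-cong-≋ {d} (λ i → *-congʳ (sum-cong-≋ {d} (λ k → *-comm (w k i) (δ k))))) ⟩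
          μ * sum (λ i → sum (λ k → δ k * w k i) * V′ i l)
            ≈⟨ *-congˡ (sum-assoc δ w (λ i → V′ i l)) ⟨
          μ * sum (λ k → δ k * sum (λ i → w k i * V′ i l))
            ≈⟨ *-congˡ (sum-cong-≋ {d} (λ k → trans (*-congˡ (unit k)) (solve 3 (λ δ m e → δ :* (m :* e) := m :* (e :* δ)) refl (δ k) (fromℤ (+ m)) (fromℤ (lookup (e l) k))))) ⟩
          μ * sum (λ k → fromℤ (+ m) * (fromℤ (lookup (e l) k) * δ k))
            ≈⟨ *-congˡ (trans (sym (*-distribˡ-sum (fromℤ (+ m)) (λ k → fromℤ (lookup (e l) k) * δ k))) (*-congˡ (∑-e l δ))) ⟩
          μ * (fromℤ (+ m) * δ l)
            ≈⟨ trans (solve 3 (λ μ m x → μ :* (m :* x) := (m :* μ) :* x) refl μ (fromℤ (+ m)) (δ l))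
                 (trans (*-congʳ (trans (fromℚ-product m*rm) fromℚ-1)) (*-identityˡ _)) ⟩
          δ l ∎
          where
          unit : ∀ k → sum (λ i → w k i * V′ i l) ≈ fromℤ (+ m) * fromℤ (lookup (e l) k)
          unit k = trans (sym (fromℤ-comb V (W k) l)) (trans (≡⇒≈ (cong fromℤ (≡.trans (cong (λ x → lookup x l) (comb-W k))
            (≡.trans (lookup-⊙ (+ m) (e k) l) (cong (+ m ℤ.*_) (e-sym k l)))))) (fromℤ-* (+ m) (lookup (e l) k)))
        representation : ∀ l → sum (λ i → s i * (t i * V′ i l)) ≈ y l
        representation l = begin
          sum (λ i → s i * (t i * V′ i l))
            ≈⟨ sum-cong-≋ {d} (λ i → term i l) ⟩
          sum (λ i → (ρ * fromℤ (+ D)) * (fromℤ (lookup a i) * V′ i l) + μ * (X i * V′ i l))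
            ≈⟨ ∑-distrib-+ {d} (λ i → (ρ * fromℤ (+ D)) * (fromℤ (lookup a i) * V′ i l)) (λ i → μ * (X i * V′ i l)) ⟩
          sum (λ i → (ρ * fromℤ (+ D)) * (fromℤ (lookup a i) * V′ i l)) + sum (λ i → μ * (X i * V′ i l))
            ≈⟨ +-cong (sym (*-distribˡ-sum (ρ * fromℤ (+ D)) (λ i → fromℤ (lookup a i) * V′ i l))) (sym (*-distribˡ-sum μ (λ i → X i * V′ i l))) ⟩
          (ρ * fromℤ (+ D)) * sum (λ i → fromℤ (lookup a i) * V′ i l) + μ * sum (λ i → X i * V′ i l)
            ≈⟨ +-cong (lattice-part l) (deviation l) ⟩
          fromℤ (lookup z l) + (y l - fromℤ (lookup z l))
            ≈⟨ trans (+-congˡ (+-comm (y l) _)) (trans (sym (+-assoc _ _ _)) (trans (+-congʳ (-‿inverseʳ _)) (+-identityˡ _))) ⟩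
          y l ∎

    fromℤ-dot : ∀ {n} (f : Vec ℤ n) (g : Fin n → ℤ) →
      fromℤ (dot f (tabulate g)) ≈ sum (λ l → fromℤ (lookup f l) * fromℤ (g l))
    fromℤ-dot []      g = fromℤ-0
    fromℤ-dot (a ∷ f) g = trans (fromℤ-+ (a ℤ.* g zero) (dot f (tabulate (g ∘ suc))))
      (+-cong (fromℤ-* a (g zero)) (fromℤ-dot f (g ∘ suc)))

    -- A functional that vanishes on the generators vanishes on the hull, in particular at x and at
    -- x + h e_k; the difference of the two values is f_k h.
    vanishing-functional : ∀ {d n} (v : Vector (Point d) n) (vℤ : Fin n → Fin d → ℤ) →
      (∀ i l → v i l ≈ fromℤ (vℤ i l)) → (f : Vec ℤ d) → (∀ i → dot f (tabulate (vℤ i)) ≡ 0ℤ) →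
      ∀ k h {x y} → x ∈ conv v → y ∈ conv v → (∀ l → y l ≈ x l + fromℤ (lookup (e k) l) * h) →
      fromℤ (lookup f k) * h ≈ 0#
    vanishing-functional {d} v vℤ v≈ f vanish k h {x} {y} x∈ y∈ y≈ = begin
      fromℤ (lookup f k) * h
        ≈⟨ *-comm _ h ⟩
      h * fromℤ (lookup f k)
        ≈⟨ *-congˡ (∑-e k (λ l → fromℤ (lookup f l))) ⟨
      h * sum (λ l → fromℤ (lookup (e k) l) * fromℤ (lookup f l))
        ≈⟨ *-distribˡ-sum h (λ l → fromℤ (lookup (e k) l) * fromℤ (lookup f l)) ⟩
      sum step
        ≈⟨ +-identityˡ _ ⟨
      0# + sum step
        ≈⟨ +-congʳ (vanish-conv φ vanishes x∈) ⟨
      sum (λ l → φ l * x l) + sum step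
        ≈⟨ ∑-distrib-+ {d} (λ l → φ l * x l) step ⟨
      sum (λ l → φ l * x l + step l)
        ≈⟨ sum-cong-≋ {d} (λ l → trans (factor (φ l) (x l) (fromℤ (lookup (e k) l)) h) (*-congˡ (sym (y≈ l)))) ⟩
      sum (λ l → φ l * y l)
        ≈⟨ vanish-conv φ vanishes y∈ ⟩
      0# ∎
      where
      φ step : Vector Carrier d
      φ l = fromℤ (lookup f l)
      step l = h * (fromℤ (lookup (e k) l) * fromℤ (lookup f l))
      vanishes : ∀ i → sum (λ l → φ l * v i l) ≈ 0#
      vanishes i = trans (sum-cong-≋ {d} (λ l → *-congˡ (v≈ i l)))
        (trans (sym (fromℤ-dot f (vℤ i))) (trans (≡⇒≈ (cong fromℤ (vanish i))) fromℤ-0))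
      factor : ∀ f x c h → f * x + h * (c * f) ≈ f * (x + c * h)
      factor = solve 4 (λ f x c h → f :* x :+ h :* (c :* f) := f :* (x :+ c :* h)) refl

open import Defs

-- Cauchy sequences of rationals as a model of the scalars.

module RealNumbers where

  open import Level using (0ℓ)
  open import Algebra.Bundles using (CommutativeRing)
  open import Data.Fin.Base using (suc)
  import Data.Integer.Base as ℤ
  open ℤ using (ℤ; +_; 0ℤ)
  import Data.Integer.Properties as ℤ
  import Data.Nat.Base as ℕ
  open ℕ using (ℕ; suc; _⊔_)
  import Data.Nat.Properties as ℕ
  open import Data.Nat.Coprimality using (1-coprimeTo) renaming (sym to coprime-sym)
  open import Data.Product.Base using (∃; _×_; _,_)
  import Data.Rational.Base as ℚ
  open ℚ using (ℚ; 0ℚ; 1ℚ; ½; mkℚ)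
  import Data.Rational.Properties as ℚ
  open import Data.Rational.Solver using (module +-*-Solver)
  open import Data.Sum.Base using (inj₁; inj₂)
  open import Relation.Binary.PropositionalEquality as ≡ using (_≡_; refl; cong; cong₂; subst; subst₂)

  ι : ℤ → ℚ
  ι z = z ℚ./ 1

  -- Division by 1 is normalised through a gcd that is stuck for a variable z. The explicit fraction
  -- lets the rational operations reduce.
  ι-mkℚ : ∀ z → ι z ≡ mkℚ z 0 (coprime-sym (1-coprimeTo ℤ.∣ z ∣))
  ι-mkℚ z = ℚ.↥p/↧p≡p (mkℚ z 0 (coprime-sym (1-coprimeTo ℤ.∣ z ∣)))

  ι-+ : ∀ a b → ι (a ℤ.+ b) ≡ ι a ℚ.+ ι b
  ι-+ a b = ≡.sym (≡.trans (cong₂ ℚ._+_ (ι-mkℚ a) (ι-mkℚ b))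
    (cong ι (cong₂ ℤ._+_ (ℤ.*-identityʳ a) (ℤ.*-identityʳ b))))

  ι-* : ∀ a b → ι (a ℤ.* b) ≡ ι a ℚ.* ι b
  ι-* a b = ≡.sym (cong₂ ℚ._*_ (ι-mkℚ a) (ι-mkℚ b))

  ι-mono-≤ : ∀ {a b} → a ℤ.≤ b → ι a ℚ.≤ ι b
  ι-mono-≤ {a} {b} a≤b = subst₂ ℚ._≤_ (≡.sym (ι-mkℚ a)) (≡.sym (ι-mkℚ b))
    (ℚ.*≤* (ℤ.*-monoʳ-≤-nonNeg (+ 1) a≤b))

  ι-injective : ∀ {a b} → ι a ≡ ι b → a ≡ b
  ι-injective {a} {b} eq = cong ℚ.↥_ (≡.trans (≡.sym (ι-mkℚ a)) (≡.trans eq (ι-mkℚ b)))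

  ι-nonZero : ∀ {a} → a ≡.≢ 0ℤ → ι a ≡.≢ 0ℚ
  ι-nonZero a≢0 eq = a≢0 (ι-injective eq)

  ι-pos : ∀ n .{{_ : ℕ.NonZero n}} → 0ℚ ℚ.< ι (+ n)
  ι-pos (suc n) = ℚ.positive⁻¹ (ι (+ suc n)) {{ℚ.normalize-pos (suc n) 1}}

  reciprocal : ∀ q → 0ℚ ℚ.< q → ∃ λ r → 0ℚ ℚ.< r × q ℚ.* r ≡ 1ℚ
  reciprocal q 0<q = ℚ.1/ q , ℚ.positive⁻¹ (ℚ.1/ q) {{ℚ.1/pos⇒pos q}} , ℚ.*-inverseʳ q
    where
    instance
      q-positive : ℚ.Positive q
      q-positive = ℚ.positive 0<q
      q-nonZero : ℚ.NonZero q
      q-nonZero = ℚ.pos⇒nonZero q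

  *-pos : ∀ {p q} → 0ℚ ℚ.< p → 0ℚ ℚ.< q → 0ℚ ℚ.< p ℚ.* q
  *-pos {p} {q} 0<p 0<q = ℚ.positive⁻¹ (p ℚ.* q) {{ℚ.pos*pos⇒pos p {{ℚ.positive 0<p}} q {{ℚ.positive 0<q}}}}

  p≤∣p∣ : ∀ p → p ℚ.≤ ℚ.∣ p ∣
  p≤∣p∣ p with ℚ.≤-total 0ℚ p
  ... | inj₁ 0≤p = ℚ.≤-reflexive (≡.sym (ℚ.0≤p⇒∣p∣≡p 0≤p))
  ... | inj₂ p≤0 = ℚ.≤-trans p≤0 (ℚ.0≤∣p∣ p)

  divide : ∀ C ε → 0ℚ ℚ.< C → 0ℚ ℚ.< ε → ∃ λ δ → 0ℚ ℚ.< δ × C ℚ.* δ ≡ ε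
  divide C ε 0<C 0<ε with reciprocal C 0<C
  ... | r , 0<r , C*r≡1 = r ℚ.* ε , *-pos 0<r 0<ε ,
    ≡.trans (≡.sym (ℚ.*-assoc C r ε)) (≡.trans (cong (ℚ._* ε) C*r≡1) (ℚ.*-identityˡ ε))

  halve : ∀ ε → 0ℚ ℚ.< ε → ∃ λ δ → 0ℚ ℚ.< δ × δ ℚ.+ δ ≡ ε
  halve ε 0<ε = ½ ℚ.* ε , *-pos (ℚ.positive⁻¹ ½) 0<ε ,
    ≡.trans (≡.sym (ℚ.*-distribʳ-+ ε ½ ½)) (ℚ.*-identityˡ ε)

  Eventually : (ℕ → Set) → Set
  Eventually P = ∃ λ N → ∀ n → N ℕ.≤ n → P n

  always : ∀ {P : ℕ → Set} → (∀ n → P n) → Eventually P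
  always p = 0 , λ n _ → p n

  eventually : ∀ {P Q : ℕ → Set} → (∀ n → P n → Q n) → Eventually P → Eventually Q
  eventually f (N , p) = N , λ n N≤n → f n (p n N≤n)

  eventually₂ : ∀ {P Q R : ℕ → Set} → (∀ n → P n → Q n → R n) → Eventually P → Eventually Q → Eventually R
  eventually₂ f (M , p) (N , q) = M ⊔ N , λ n le →
    f n (p n (ℕ.m⊔n≤o⇒m≤o M N le)) (q n (ℕ.m⊔n≤o⇒n≤o M N le))

  bounded : ∀ x → ∃ λ A → 0ℚ ℚ.< A × Eventually (λ n → ℚ.∣ seq x n ∣ ℚ.≤ A)
  bounded x with cauchy x 1ℚ (ℚ.positive⁻¹ 1ℚ)
  ... | N , close = ℚ.∣ seq x N ∣ ℚ.+ 1ℚ , ℚ.+-mono-≤-< (ℚ.0≤∣p∣ (seq x N)) (ℚ.positive⁻¹ 1ℚ) , N , λ n N≤n → begin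
    ℚ.∣ seq x n ∣                                       ≡⟨ cong ℚ.∣_∣ (lemma (seq x n) (seq x N)) ⟩
    ℚ.∣ seq x N ℚ.+ (seq x n ℚ.- seq x N) ∣             ≤⟨ ℚ.∣p+q∣≤∣p∣+∣q∣ (seq x N) _ ⟩
    ℚ.∣ seq x N ∣ ℚ.+ ℚ.∣ seq x n ℚ.- seq x N ∣         ≤⟨ ℚ.+-monoʳ-≤ ℚ.∣ seq x N ∣ (ℚ.<⇒≤ (close n N N≤n ℕ.≤-refl)) ⟩
    ℚ.∣ seq x N ∣ ℚ.+ 1ℚ                                ∎
    where
    open ℚ.≤-Reasoning
    open +-*-Solver
    lemma : ∀ a b → a ≡ b ℚ.+ (a ℚ.- b)
    lemma = solve 2 (λ a b → a := b :+ (a :- b)) refl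

  ≃-pointwise : ∀ x y → (∀ n → seq x n ≡ seq y n) → x ≃ y
  ≃-pointwise x y eq ε 0<ε = always λ n → subst (ℚ._< ε)
    (≡.sym (cong ℚ.∣_∣ (≡.trans (cong (ℚ._- seq y n) (eq n)) (ℚ.+-inverseʳ (seq y n))))) 0<ε

  ≃-sym : ∀ {x y} → x ≃ y → y ≃ x
  ≃-sym {x} {y} x≃y ε 0<ε = eventually (λ n → subst (ℚ._< ε) (≡.trans (≡.sym (ℚ.∣-p∣≡∣p∣ _))
    (cong ℚ.∣_∣ (lemma (seq x n) (seq y n))))) (x≃y ε 0<ε)
    where
    open +-*-Solver
    lemma : ∀ a b → ℚ.- (a ℚ.- b) ≡ b ℚ.- a
    lemma = solve 2 (λ a b → :- (a :- b) := b :- a) refl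

  ∣+∣< : ∀ {a b δ ε} c → a ℚ.+ b ≡ c → δ ℚ.+ δ ≡ ε → ℚ.∣ a ∣ ℚ.< δ → ℚ.∣ b ∣ ℚ.< δ → ℚ.∣ c ∣ ℚ.< ε
  ∣+∣< {a} {b} _ refl refl a<δ b<δ = ℚ.≤-<-trans (ℚ.∣p+q∣≤∣p∣+∣q∣ a b) (ℚ.+-mono-< a<δ b<δ)

  ≃-trans : ∀ {x y z} → x ≃ y → y ≃ z → x ≃ z
  ≃-trans {x} {y} {z} x≃y y≃z ε 0<ε with halve ε 0<ε
  ... | δ , 0<δ , δ+δ≡ε = eventually₂ (λ n → ∣+∣< _ (lemma (seq x n) (seq y n) (seq z n)) δ+δ≡ε)
    (x≃y δ 0<δ) (y≃z δ 0<δ)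
    where
    open +-*-Solver
    lemma : ∀ a b c → (a ℚ.- b) ℚ.+ (b ℚ.- c) ≡ a ℚ.- c
    lemma = solve 3 (λ a b c → (a :- b) :+ (b :- c) := a :- c) refl

  +-cong : ∀ {x x′ y y′} → x ≃ x′ → y ≃ y′ → x + y ≃ x′ + y′
  +-cong {x} {x′} {y} {y′} x≃ y≃ ε 0<ε with halve ε 0<ε
  ... | δ , 0<δ , δ+δ≡ε = eventually₂ (λ n → ∣+∣< _ (lemma (seq x n) (seq x′ n) (seq y n) (seq y′ n)) δ+δ≡ε)
    (x≃ δ 0<δ) (y≃ δ 0<δ)
    where
    open +-*-Solver
    lemma : ∀ a b c d → (a ℚ.- b) ℚ.+ (c ℚ.- d) ≡ (a ℚ.+ c) ℚ.- (b ℚ.+ d)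
    lemma = solve 4 (λ a b c d → (a :- b) :+ (c :- d) := (a :+ c) :- (b :+ d)) refl

  neg-cong : ∀ {x y} → x ≃ y → - x ≃ - y
  neg-cong {x} {y} x≃y ε 0<ε = eventually (λ n → subst (ℚ._< ε) (≡.trans (≡.sym (ℚ.∣-p∣≡∣p∣ _))
    (cong ℚ.∣_∣ (lemma (seq x n) (seq y n))))) (x≃y ε 0<ε)
    where
    open +-*-Solver
    lemma : ∀ a b → ℚ.- (a ℚ.- b) ≡ ℚ.- a ℚ.- ℚ.- b
    lemma = solve 2 (λ a b → :- (a :- b) := :- a :- :- b) refl

  *-small : ∀ {A a b δ ε} → 0ℚ ℚ.< A → A ℚ.* δ ≡ ε → ℚ.∣ a ∣ ℚ.≤ A → ℚ.∣ b ∣ ℚ.< δ → ℚ.∣ a ℚ.* b ∣ ℚ.< ε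
  *-small {A} {a} {b} {δ} {ε} 0<A Aδ≡ε a≤A b<δ = begin-strict
    ℚ.∣ a ℚ.* b ∣         ≡⟨ ℚ.∣p*q∣≡∣p∣*∣q∣ a b ⟩
    ℚ.∣ a ∣ ℚ.* ℚ.∣ b ∣   ≤⟨ ℚ.*-monoʳ-≤-nonNeg ℚ.∣ b ∣ {{ℚ.nonNegative (ℚ.0≤∣p∣ b)}} a≤A ⟩
    A ℚ.* ℚ.∣ b ∣         <⟨ ℚ.*-monoʳ-<-pos A {{ℚ.positive 0<A}} b<δ ⟩
    A ℚ.* δ               ≡⟨ Aδ≡ε ⟩
    ε                     ∎
    where open ℚ.≤-Reasoning

  *-congˡ : ∀ x {y y′} → y ≃ y′ → x * y ≃ x * y′
  *-congˡ x {y} {y′} y≃ ε 0<ε =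
    let A , 0<A , x≤A    = bounded x
        δ , 0<δ , Aδ≡ε = divide A ε 0<A 0<ε
    in eventually₂ (λ n x≤A y<δ → subst (λ q → ℚ.∣ q ∣ ℚ.< ε) (lemma (seq x n) (seq y n) (seq y′ n))
         (*-small {A} {seq x n} {seq y n ℚ.- seq y′ n} {δ} 0<A Aδ≡ε x≤A y<δ)) x≤A (y≃ δ 0<δ)
    where
    open +-*-Solver
    lemma : ∀ a b c → a ℚ.* (b ℚ.- c) ≡ a ℚ.* b ℚ.- a ℚ.* c
    lemma = solve 3 (λ a b c → a :* (b :- c) := a :* b :- a :* c) refl

  *-comm : ∀ x y → x * y ≃ y * x
  *-comm x y = ≃-pointwise (x * y) (y * x) λ n → ℚ.*-comm (seq x n) (seq y n)

  *-cong : ∀ {x x′ y y′} → x ≃ x′ → y ≃ y′ → x * y ≃ x′ * y′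
  *-cong {x} {x′} {y} {y′} x≃ y≃ =
    ≃-trans {x * y} {x * y′} {x′ * y′} (*-congˡ x {y} {y′} y≃)
      (≃-trans {x * y′} {y′ * x} {x′ * y′} (*-comm x y′)
        (≃-trans {y′ * x} {y′ * x′} {x′ * y′} (*-congˡ y′ {x} {x′} x≃) (*-comm y′ x′)))

  ℝ-commutativeRing : CommutativeRing 0ℓ 0ℓ
  ℝ-commutativeRing = record
    { Carrier = ℝ ; _≈_ = _≃_ ; _+_ = _+_ ; _*_ = _*_ ; -_ = -_ ; 0# = 0ℝ ; 1# = 1ℝ
    ; isCommutativeRing = record
      { isRing = record
        { +-isAbelianGroup = record
          { isGroup = record
            { isMonoid = record
              { isSemigroup = record
                { isMagma = record
                  { isEquivalence = record
                    { refl  = λ {x} → ≃-pointwise x x λ _ → refl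
                    ; sym   = λ {x y} → ≃-sym {x} {y}
                    ; trans = λ {x y z} → ≃-trans {x} {y} {z} }
                  ; ∙-cong = λ {x y u v} → +-cong {x} {y} {u} {v} }
                ; assoc = λ x y z → ≃-pointwise (x + y + z) (x + (y + z)) λ n → ℚ.+-assoc (seq x n) (seq y n) (seq z n) }
              ; identity = (λ x → ≃-pointwise (0ℝ + x) x λ n → ℚ.+-identityˡ (seq x n)) ,
                           (λ x → ≃-pointwise (x + 0ℝ) x λ n → ℚ.+-identityʳ (seq x n)) }
            ; inverse = (λ x → ≃-pointwise (- x + x) 0ℝ λ n → ℚ.+-inverseˡ (seq x n)) ,
                        (λ x → ≃-pointwise (x - x) 0ℝ λ n → ℚ.+-inverseʳ (seq x n))
            ; ⁻¹-cong = λ {x y} → neg-cong {x} {y} }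
          ; comm = λ x y → ≃-pointwise (x + y) (y + x) λ n → ℚ.+-comm (seq x n) (seq y n) }
        ; *-cong = λ {x y u v} → *-cong {x} {y} {u} {v}
        ; *-assoc = λ x y z → ≃-pointwise (x * y * z) (x * (y * z)) λ n → ℚ.*-assoc (seq x n) (seq y n) (seq z n)
        ; *-identity = (λ x → ≃-pointwise (1ℝ * x) x λ n → ℚ.*-identityˡ (seq x n)) ,
                       (λ x → ≃-pointwise (x * 1ℝ) x λ n → ℚ.*-identityʳ (seq x n))
        ; distrib = (λ x y z → ≃-pointwise (x * (y + z)) (x * y + x * z) λ n → ℚ.*-distribˡ-+ (seq x n) (seq y n) (seq z n))
                  , (λ x y z → ≃-pointwise ((y + z) * x) (y * x + z * x) λ n → ℚ.*-distribʳ-+ (seq x n) (seq y n) (seq z n)) }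
      ; *-comm = *-comm } }

  0≤-pointwise : ∀ {x} → Eventually (λ n → 0ℚ ℚ.≤ seq x n) → 0ℝ ≤ x
  0≤-pointwise {x} 0≤x ε 0<ε = eventually (λ n 0≤xn → ℚ.+-mono-≤-< 0≤xn 0<ε) 0≤x

  0≤-+ : ∀ {x y} → 0ℝ ≤ x → 0ℝ ≤ y → 0ℝ ≤ x + y
  0≤-+ {x} {y} 0≤x 0≤y ε 0<ε with halve ε 0<ε
  ... | δ , 0<δ , δ+δ≡ε = eventually₂ (λ n 0<x+δ 0<y+δ → subst (0ℚ ℚ.<_)
      (≡.trans (lemma (seq x n) (seq y n) δ) (cong (seq x n ℚ.+ seq y n ℚ.+_) δ+δ≡ε)) (ℚ.+-mono-< 0<x+δ 0<y+δ))
      (0≤x δ 0<δ) (0≤y δ 0<δ)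
    where
    open +-*-Solver
    lemma : ∀ a b d → (a ℚ.+ d) ℚ.+ (b ℚ.+ d) ≡ a ℚ.+ b ℚ.+ (d ℚ.+ d)
    lemma = solve 3 (λ a b d → (a :+ d) :+ (b :+ d) := a :+ b :+ (d :+ d)) refl

  -- (x + η) (y + δ) > 0, where δ and η are such that the mixed terms
  -- x δ + η δ and η y are each at most ε / 2.
  0≤-* : ∀ {x y} → 0ℝ ≤ x → 0ℝ ≤ y → 0ℝ ≤ x * y
  0≤-* {x} {y} 0≤x 0≤y ε 0<ε =
    let A , 0<A , x≤A       = bounded x
        B , 0<B , y≤B       = bounded y
        ε/2 , 0<ε/2 , ε≡    = halve ε 0<ε
        η , 0<η , Bη≡       = divide B ε/2 0<B 0<ε/2
        δ , 0<δ , A+ηδ≡     = divide (A ℚ.+ η) ε/2 (ℚ.+-mono-< 0<A 0<η) 0<ε/2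
    in eventually₂ (λ n (x≤A , y≤B) (0<x+η , 0<y+δ) →
           product-bound (seq x n) (seq y n) (ℚ.<⇒≤ 0<δ) (ℚ.<⇒≤ 0<η)
             (≡.trans (cong₂ ℚ._+_ A+ηδ≡ Bη≡) ε≡) x≤A y≤B 0<x+η 0<y+δ)
         (eventually₂ (λ n → _,_) x≤A y≤B) (eventually₂ (λ n → _,_) (0≤x η 0<η) (0≤y δ 0<δ))
    where
    expand : ∀ a b δ η → (a ℚ.+ η) ℚ.* (b ℚ.+ δ) ≡ a ℚ.* b ℚ.+ ((a ℚ.+ η) ℚ.* δ ℚ.+ b ℚ.* η)
    expand = solve 4 (λ a b δ η → (a :+ η) :* (b :+ δ) := a :* b :+ ((a :+ η) :* δ :+ b :* η)) refl
      where open +-*-Solver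
    product-bound : ∀ a b {A B δ η ε} → 0ℚ ℚ.≤ δ → 0ℚ ℚ.≤ η → (A ℚ.+ η) ℚ.* δ ℚ.+ B ℚ.* η ≡ ε →
      ℚ.∣ a ∣ ℚ.≤ A → ℚ.∣ b ∣ ℚ.≤ B → 0ℚ ℚ.< a ℚ.+ η → 0ℚ ℚ.< b ℚ.+ δ → 0ℚ ℚ.< a ℚ.* b ℚ.+ ε
    product-bound a b {A} {B} {δ} {η} {ε} 0≤δ 0≤η ε≡ a≤A b≤B 0<a+η 0<b+δ = begin-strict
      0ℚ                                                  <⟨ *-pos {a ℚ.+ η} {b ℚ.+ δ} 0<a+η 0<b+δ ⟩
      (a ℚ.+ η) ℚ.* (b ℚ.+ δ)                             ≡⟨ expand a b δ η ⟩
      a ℚ.* b ℚ.+ ((a ℚ.+ η) ℚ.* δ ℚ.+ b ℚ.* η)           ≤⟨ ℚ.+-monoʳ-≤ (a ℚ.* b) (ℚ.+-mono-≤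
        (ℚ.*-monoʳ-≤-nonNeg δ {{ℚ.nonNegative 0≤δ}} (ℚ.+-monoˡ-≤ η (ℚ.≤-trans (p≤∣p∣ a) a≤A)))
        (ℚ.*-monoʳ-≤-nonNeg η {{ℚ.nonNegative 0≤η}} (ℚ.≤-trans (p≤∣p∣ b) b≤B))) ⟩
      a ℚ.* b ℚ.+ ((A ℚ.+ η) ℚ.* δ ℚ.+ B ℚ.* η)           ≡⟨ cong (a ℚ.* b ℚ.+_) ε≡ ⟩
      a ℚ.* b ℚ.+ ε                                       ∎
      where open ℚ.≤-Reasoning

  0≤-resp : ∀ {x y} → x ≃ y → 0ℝ ≤ x → 0ℝ ≤ y
  0≤-resp {x} {y} x≃y 0≤x ε 0<ε =
    let δ , 0<δ , δ+δ≡ε = halve ε 0<ε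
    in eventually₂ (λ n → positive (seq x n) (seq y n) δ+δ≡ε) (0≤x δ 0<δ) (x≃y δ 0<δ)
    where
    positive : ∀ a b {δ ε} → δ ℚ.+ δ ≡ ε → 0ℚ ℚ.< a ℚ.+ δ → ℚ.∣ a ℚ.- b ∣ ℚ.< δ → 0ℚ ℚ.< b ℚ.+ ε
    positive a b {δ} refl 0<a+δ a-b<δ = begin-strict
      0ℚ                                <⟨ 0<a+δ ⟩
      a ℚ.+ δ                           ≡⟨ lemma a b δ ⟩
      b ℚ.+ ((a ℚ.- b) ℚ.+ δ)           ≤⟨ ℚ.+-monoʳ-≤ b (ℚ.+-monoˡ-≤ δ (ℚ.≤-trans (p≤∣p∣ (a ℚ.- b)) (ℚ.<⇒≤ a-b<δ))) ⟩
      b ℚ.+ (δ ℚ.+ δ)                   ∎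
      where
      open ℚ.≤-Reasoning
      open +-*-Solver
      lemma : ∀ a b d → a ℚ.+ d ≡ b ℚ.+ ((a ℚ.- b) ℚ.+ d)
      lemma = solve 3 (λ a b d → a :+ d := b :+ ((a :- b) :+ d)) refl

  -- Constant sequences at distance q - p > 0 cannot come closer than that distance, so it serves as
  -- the tolerance that refutes `≃`.
  fromℚ-≃⇒≡ : ∀ {p q} → fromℚ p ≃ fromℚ q → p ≡ q
  fromℚ-≃⇒≡ {p} {q} p≃q = ℚ.≤-antisym (ℚ.≮⇒≥ (λ q<p → absurd q p q<p (≃-sym {fromℚ p} {fromℚ q} p≃q)))
                            (ℚ.≮⇒≥ (λ p<q → absurd p q p<q p≃q))
    where
    open import Data.Empty using (⊥)
    absurd : ∀ p q → p ℚ.< q → fromℚ p ≃ fromℚ q → ⊥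
    absurd p q p<q p≃q with p≃q (q ℚ.- p) (subst (ℚ._< q ℚ.- p) (ℚ.+-inverseʳ p) (ℚ.+-monoˡ-< (ℚ.- p) p<q))
    ... | N , close = ℚ.<-irrefl (≡.trans (≡.sym (ℚ.∣-p∣≡∣p∣ (p ℚ.- q))) (≡.trans (cong ℚ.∣_∣ (lemma p q))
        (ℚ.0≤p⇒∣p∣≡p (ℚ.<⇒≤ (subst (ℚ._< q ℚ.- p) (ℚ.+-inverseʳ p) (ℚ.+-monoˡ-< (ℚ.- p) p<q)))))) (close N ℕ.≤-refl)
      where
      open +-*-Solver
      lemma : ∀ a b → ℚ.- (a ℚ.- b) ≡ b ℚ.- a
      lemma = solve 2 (λ a b → :- (a :- b) := b :- a) refl

  ℝ-scalars : Geometry.Scalars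
  ℝ-scalars = record
    { commutativeRing = ℝ-commutativeRing
    ; NonNegative = 0ℝ ≤_
    ; 0≤-resp  = λ {x} {y} → 0≤-resp {x} {y}
    ; 0≤-+     = λ {x} {y} → 0≤-+ {x} {y}
    ; 0≤-*     = λ {x} {y} → 0≤-* {x} {y}
    ; fromℚ    = fromℚ
    ; fromℚ-+  = λ p q → ≃-pointwise (fromℚ (p ℚ.+ q)) (fromℚ p + fromℚ q) λ _ → refl
    ; fromℚ-*  = λ p q → ≃-pointwise (fromℚ (p ℚ.* q)) (fromℚ p * fromℚ q) λ _ → refl
    ; fromℚ-0  = ≃-pointwise 0ℝ 0ℝ λ _ → refl
    ; fromℚ-1  = ≃-pointwise 1ℝ 1ℝ λ _ → refl
    ; 0≤-fromℚ = λ {q} 0≤q → 0≤-pointwise {fromℚ q} (always λ _ → 0≤q)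
    ; ι = ι ; ι-+ = ι-+ ; ι-* = ι-* ; ι-0 = refl ; ι-1 = refl ; ι-mono = ι-mono-≤ }

-- From regions of real space to integer data, and back to orbits.

module LatticePolytopes where

  open import Data.Fin.Base using (Fin; zero; suc)
  import Data.Fin.Properties as Fin
  import Data.Integer.Base as ℤ
  open ℤ using (ℤ; +_; 0ℤ; 1ℤ)
  import Data.Integer.Properties as ℤ
  import Data.Nat.Base as ℕ
  open ℕ using (ℕ; zero; suc; _!)
  import Data.Nat.Properties as ℕ
  import Data.Nat.Tactic.RingSolver as ℕ-Solver
  open import Data.Product.Base using (∃; _×_; _,_; proj₁; proj₂)
  import Data.Rational.Base as ℚ
  open ℚ using (ℚ; 0ℚ; 1ℚ)
  import Data.Rational.Properties as ℚ
  open import Data.Rational.Solver using (module +-*-Solver)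
  open import Data.Sum.Base using ([_,_]′)
  open import Data.Vec.Base using (Vec; []; _∷_; lookup; map; tabulate)
  open import Data.Vec.Properties using (≡-dec; lookup∘tabulate)
  open import Data.Vec.Functional using (Vector)
  open import Function.Base using (_∘_)
  open import Relation.Binary.PropositionalEquality as ≡ using (_≡_; _≢_; refl; sym; trans; cong; cong₂; subst)
  open import Relation.Nullary using (yes; no; contradiction)
  open import Relation.Nullary.Decidable using (decidable-stable)
  open import Relation.Unary using (_∈_; _≐_)
  open IntegerLinearAlgebra
  open TriangularMatrices
  open Minkowski
  open LatticeBases
  open Codes
  open Normalised using (code)
  open RealNumbers
  module ℝᵈ = Geometry.Convexity ℝ-scalars

  lookup-comb : ∀ {m n} (V : Fin m → Vec ℤ n) x l → lookup (comb V x) l ≡ ∑ℤ (λ k → lookup (V k) l ℤ.* lookup x k)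
  lookup-comb V []       l = lookup-𝟘 l
  lookup-comb V (k ∷ ks) l = trans (lookup-⊕ (k ⊙ V zero) (comb (V ∘ suc) ks) l)
    (cong₂ ℤ._+_ (trans (lookup-⊙ k (V zero) l) (ℤ.*-comm k _)) (lookup-comb (V ∘ suc) ks l))

  lookup-e : ∀ {n} (i j : Fin n) → lookup (e j) i ≡ 𝟙 i j
  lookup-e i j with i Fin.≟ j
  ... | yes refl = same i
    where
    same : ∀ {n} (i : Fin n) → lookup (e i) i ≡ 1ℤ
    same zero    = refl
    same (suc i) = same i
  ... | no i≢j = different i j i≢j
    where
    different : ∀ {n} (i j : Fin n) → i ≢ j → lookup (e j) i ≡ 0ℤ
    different zero    zero    i≢j = contradiction refl i≢j
    different (suc i) zero    i≢j = lookup-𝟘 i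
    different zero    (suc j) i≢j = refl
    different (suc i) (suc j) i≢j = different i j (i≢j ∘ cong suc)

  toMatrix : ∀ {d} → (Vec ℤ d → Vec ℤ d) → Matrix d
  toMatrix f i j = lookup (f (e j)) i

  toMatrix-inverse : ∀ {d} {f g : Vec ℤ d → Vec ℤ d} → Linear g → (∀ x → g (f x) ≡ x) →
    ∀ i j → (toMatrix g ⊡ toMatrix f) i j ≡ 𝟙 i j
  toMatrix-inverse {f = f} {g} g-linear g∘f i j = begin
    ∑ℤ (λ k → lookup (g (e k)) i ℤ.* lookup (f (e j)) k)    ≡⟨ lookup-comb (g ∘ e) (f (e j)) i ⟨
    lookup (comb (g ∘ e) (f (e j))) i                       ≡⟨ cong (λ x → lookup x i) (linear-comb g-linear (f (e j))) ⟨
    lookup (g (f (e j))) i                                  ≡⟨ cong (λ x → lookup x i) (g∘f (e j)) ⟩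
    lookup (e j) i                                          ≡⟨ lookup-e i j ⟩
    𝟙 i j                                                   ∎
    where open ≡.≡-Reasoning

  toGL : ∀ {d} → Iso d → GL d
  toGL T = record
    { matrix   = toMatrix to ; inverse = toMatrix from
    ; inverseˡ = toMatrix-inverse from-linear from∘to
    ; inverseʳ = toMatrix-inverse linear to∘from }
    where open Iso T

  vecs : ∀ {d n} → Vector (ℤ^ d) n → Fin n → Vec ℤ d
  vecs v i = tabulate (v i)

  -- Stated for a sequence x of reals, so that Agda does not have to compare
  -- products of reals up to unfolding.
  seq-∑ : ∀ {d} (a b : Fin d → ℤ) (x : Vector ℝ d) n → (∀ m → seq (x m) n ≡ ι (b m)) →
    seq (∑ (λ m → fromℤ (a m) * x m)) n ≡ ι (∑ℤ (λ m → a m ℤ.* b m))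
  seq-∑ {zero}  a b x n eq = refl
  seq-∑ {suc d} a b x n eq = begin
    ι (a zero) ℚ.* seq (x zero) n ℚ.+ seq (∑ (λ m → fromℤ (a (suc m)) * x (suc m))) n
      ≡⟨ cong₂ (λ p q → ι (a zero) ℚ.* p ℚ.+ q) (eq zero) (seq-∑ (a ∘ suc) (b ∘ suc) (x ∘ suc) n (eq ∘ suc)) ⟩
    ι (a zero) ℚ.* ι (b zero) ℚ.+ ι (∑ℤ (λ m → a (suc m) ℤ.* b (suc m)))
      ≡⟨ cong (ℚ._+ ι (∑ℤ (λ m → a (suc m) ℤ.* b (suc m)))) (ι-* (a zero) (b zero)) ⟨
    ι (a zero ℤ.* b zero) ℚ.+ ι (∑ℤ (λ m → a (suc m) ℤ.* b (suc m)))
      ≡⟨ ι-+ (a zero ℤ.* b zero) (∑ℤ (λ m → a (suc m) ℤ.* b (suc m))) ⟨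
    ι (a zero ℤ.* b zero ℤ.+ ∑ℤ (λ m → a (suc m) ℤ.* b (suc m))) ∎
    where open ≡.≡-Reasoning

  Maps : ∀ {d} → GL d → ℤ^ d → ℤ^ d → Set
  Maps U x y = ∀ l → ∑ℤ (λ m → GL.matrix U l m ℤ.* x m) ≡ y l

  -- The lists may differ in length and have repetitions, so matching goes both ways: `σ` puts the
  -- image of P inside Q, and `τ` puts Q inside that image.
  same-orbit : ∀ {d n n′} {P Q : Region d} (v : Vector (ℤ^ d) n) (v′ : Vector (ℤ^ d) n′) →
    P ≐ conv (λ i → embed (v i)) → Q ≐ conv (λ i → embed (v′ i)) → (U : GL d) →
    (∀ j → ∃ λ k → Maps U (v j) (v′ k)) → (∀ k → ∃ λ j → Maps U (v j) (v′ k)) → SameOrbit P Q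
  same-orbit {P = P} {Q} v v′ (P⊆ , ⊆P) (Q⊆ , ⊆Q) U σ τ = U , Q⊆UP , UP⊆Q
    where
    image : ∀ j k → Maps U (v j) (v′ k) → ∀ l → ∑ (λ m → fromℤ (GL.matrix U l m) * embed (v j) m) ≃ embed (v′ k) l
    image j k maps l = ≃-pointwise (∑ (λ m → fromℤ (GL.matrix U l m) * embed (v j) m)) (embed (v′ k) l) λ n →
      trans (seq-∑ (GL.matrix U l) (v j) (embed (v j)) n (λ _ → refl)) (cong ι (maps l))
    Q⊆UP : ∀ {y} → y ∈ Q → y ∈ U ·ᴿ P
    Q⊆UP {y} y∈Q =
      let x , x∈ , y≋ = ℝᵈ.preimage-conv (λ k l → fromℤ (GL.matrix U k l)) (λ i → embed (v i)) (λ i → embed (v′ i))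
            (λ k → proj₁ (τ k)) (λ k → image (proj₁ (τ k)) k (proj₂ (τ k))) {y} (Q⊆ y∈Q)
      in x , ⊆P x∈ , y≋
    UP⊆Q : ∀ {y} → y ∈ U ·ᴿ P → y ∈ Q
    UP⊆Q {y} (x , x∈P , y≋) = ⊆Q (ℝᵈ.image-conv (λ k l → fromℤ (GL.matrix U k l)) (λ i → embed (v i)) (λ i → embed (v′ i))
      (λ j → proj₁ (σ j)) (λ j → image j (proj₁ (σ j)) (proj₂ (σ j))) {x} {y} (P⊆ x∈P) y≋)

  ∑ℤ-cong : ∀ {n} {f g : Vector ℤ n} → (∀ i → f i ≡ g i) → ∑ℤ f ≡ ∑ℤ g
  ∑ℤ-cong {zero}  eq = refl
  ∑ℤ-cong {suc n} eq = cong₂ ℤ._+_ (eq zero) (∑ℤ-cong (eq ∘ suc))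

  iso-maps : ∀ {d} (T : Iso d) (x y : ℤ^ d) → Iso.to T (tabulate x) ≡ tabulate y → Maps (toGL T) x y
  iso-maps T x y eq l = begin
    ∑ℤ (λ m → lookup (to (e m)) l ℤ.* x m)                      ≡⟨ ∑ℤ-cong (λ m → cong (lookup (to (e m)) l ℤ.*_) (lookup∘tabulate x m)) ⟨
    ∑ℤ (λ m → lookup (to (e m)) l ℤ.* lookup (tabulate x) m)    ≡⟨ lookup-comb (to ∘ e) (tabulate x) l ⟨
    lookup (comb (to ∘ e) (tabulate x)) l                       ≡⟨ cong (λ z → lookup z l) (linear-comb linear (tabulate x)) ⟨
    lookup (to (tabulate x)) l                                  ≡⟨ trans (cong (λ z → lookup z l) eq) (lookup∘tabulate y l) ⟩
    y l                                                         ∎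
    where
    open Iso T
    open ≡.≡-Reasoning

  const-≃-0 : ∀ x {q} → (∀ n → seq x n ≡ q) → x ≃ 0ℝ → q ≡ 0ℚ
  const-≃-0 x {q} x≡q x≃0 = fromℚ-≃⇒≡ (≃-trans {fromℚ q} {x} {0ℝ} (≃-pointwise (fromℚ q) x (λ n → sym (x≡q n))) x≃0)

  -- The points x and x + h e_k of the interior would take different values
  -- under a functional f with f_k ≠ 0.
  no-vanishing-functional : ∀ {d n} {P : Region d} (v : Vector (ℤ^ d) n) → P ≐ conv (λ i → embed (v i)) →
    FullDimensional P → ∀ f → (∀ j → dot f (vecs v j) ≡ 0ℤ) → ∀ k → lookup f k ≡ 0ℤ
  no-vanishing-functional {P = P} v (P⊆ , ⊆P) (x , ε , (η , 0<η , 0+η<ε) , ball) f vanish k =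
    decidable-stable (lookup f k ℤ.≟ 0ℤ) λ fk≢0 → ι-nonZero fk≢0 fk≡0
    where
    -- Strict inequality of reals demands a rational margin. One half of η is the step along e_k,
    -- the other half remains as the margin.
    half = halve η 0<η
    h = proj₁ half
    0<h = proj₁ (proj₂ half)
    h+h≡η = proj₂ (proj₂ half)
    y : ℝ^ _
    y l = x l + fromℚ (ι (lookup (e k) l) ℚ.* h)
    0≤e≤1 : ∀ {n} (k l : Fin n) → 0ℤ ℤ.≤ lookup (e k) l × lookup (e k) l ℤ.≤ 1ℤ
    0≤e≤1 zero    zero    = ℤ.+≤+ ℕ.z≤n , ℤ.≤-refl
    0≤e≤1 zero    (suc l) = subst (λ z → 0ℤ ℤ.≤ z × z ℤ.≤ 1ℤ) (sym (lookup-𝟘 l)) (ℤ.≤-refl , ℤ.+≤+ ℕ.z≤n)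
    0≤e≤1 (suc k) zero    = ℤ.≤-refl , ℤ.+≤+ ℕ.z≤n
    0≤e≤1 (suc k) (suc l) = 0≤e≤1 k l
    between : ∀ {c} → 0ℚ ℚ.≤ c → c ℚ.≤ 1ℚ → 0ℚ ℚ.≤ c ℚ.* h × c ℚ.* h ℚ.≤ h
    between {c} 0≤c c≤1 = subst (ℚ._≤ c ℚ.* h) (ℚ.*-zeroˡ h) (ℚ.*-monoʳ-≤-nonNeg h {{ℚ.nonNegative (ℚ.<⇒≤ 0<h)}} 0≤c) ,
                          subst (c ℚ.* h ℚ.≤_) (ℚ.*-identityˡ h) (ℚ.*-monoʳ-≤-nonNeg h {{ℚ.nonNegative (ℚ.<⇒≤ 0<h)}} c≤1)
    step : ∀ l → 0ℚ ℚ.≤ ι (lookup (e k) l) ℚ.* h × ι (lookup (e k) l) ℚ.* h ℚ.≤ h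
    step l = between (ι-mono-≤ (proj₁ (0≤e≤1 k l))) (ι-mono-≤ (proj₂ (0≤e≤1 k l)))
    lower : ∀ a b s → 0ℚ ℚ.≤ s → 0ℚ ℚ.+ η ℚ.< b → (a ℚ.- b) ℚ.+ h ℚ.< a ℚ.+ s
    lower a b s 0≤s η<b = begin-strict
      (a ℚ.- b) ℚ.+ h      ≡⟨ ℚ.+-assoc a (ℚ.- b) h ⟩
      a ℚ.+ (ℚ.- b ℚ.+ h)  <⟨ ℚ.+-monoʳ-< a (ℚ.+-monoʳ-< (ℚ.- b) h<b) ⟩
      a ℚ.+ (ℚ.- b ℚ.+ b)  ≡⟨ cong (a ℚ.+_) (ℚ.+-inverseˡ b) ⟩
      a ℚ.+ 0ℚ             ≤⟨ ℚ.+-monoʳ-≤ a 0≤s ⟩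
      a ℚ.+ s              ∎
      where
      open ℚ.≤-Reasoning
      h<b : h ℚ.< b
      h<b = begin-strict
        h           ≡⟨ ℚ.+-identityˡ h ⟨
        0ℚ ℚ.+ h    <⟨ ℚ.+-monoˡ-< h 0<h ⟩
        h ℚ.+ h     ≡⟨ trans h+h≡η (sym (ℚ.+-identityˡ η)) ⟩
        0ℚ ℚ.+ η    <⟨ η<b ⟩
        b           ∎
    upper : ∀ a b s → s ℚ.≤ h → 0ℚ ℚ.+ η ℚ.< b → (a ℚ.+ s) ℚ.+ h ℚ.< a ℚ.+ b
    upper a b s s≤h η<b = begin-strict
      (a ℚ.+ s) ℚ.+ h      ≡⟨ ℚ.+-assoc a s h ⟩
      a ℚ.+ (s ℚ.+ h)      ≤⟨ ℚ.+-monoʳ-≤ a (ℚ.+-monoˡ-≤ h s≤h) ⟩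
      a ℚ.+ (h ℚ.+ h)      ≡⟨ cong (a ℚ.+_) (trans h+h≡η (sym (ℚ.+-identityˡ η))) ⟩
      a ℚ.+ (0ℚ ℚ.+ η)     <⟨ ℚ.+-monoʳ-< a η<b ⟩
      a ℚ.+ b              ∎
      where open ℚ.≤-Reasoning
    y∈P : y ∈ P
    y∈P = ball y λ l →
      (h , 0<h , eventually (λ n → lower (seq (x l) n) (seq ε n) _ (proj₁ (step l))) 0+η<ε) ,
      (h , 0<h , eventually (λ n → upper (seq (x l) n) (seq ε n) _ (proj₂ (step l))) 0+η<ε)
    x∈P : x ∈ P
    x∈P = ball x λ l →
      (h , 0<h , eventually (λ n η<ε → subst ((seq (x l) n ℚ.- seq ε n) ℚ.+ h ℚ.<_) (ℚ.+-identityʳ (seq (x l) n))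
        (lower (seq (x l) n) (seq ε n) 0ℚ ℚ.≤-refl η<ε)) 0+η<ε) ,
      (h , 0<h , eventually (λ n η<ε → subst (λ q → q ℚ.+ h ℚ.< seq (x l) n ℚ.+ seq ε n) (ℚ.+-identityʳ (seq (x l) n))
        (upper (seq (x l) n) (seq ε n) 0ℚ (ℚ.<⇒≤ 0<h) η<ε)) 0+η<ε)
    fk*h≡0 : ι (lookup f k) ℚ.* h ≡ 0ℚ
    fk*h≡0 = const-≃-0 (ℝᵈ.fromℤ (lookup f k) * fromℚ h) (λ _ → refl) (ℝᵈ.vanishing-functional (λ i → embed (v i)) v
      (λ i l → ≃-pointwise (embed (v i) l) (ℝᵈ.fromℤ (v i l)) (λ _ → refl)) f vanish k (fromℚ h) {x} {y} (P⊆ x∈P) (P⊆ y∈P)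
      (λ l → ≃-pointwise (y l) (x l + ℝᵈ.fromℤ (lookup (e k) l) * fromℚ h) (λ _ → refl)))
    fk≡0 : ι (lookup f k) ≡ 0ℚ
    fk≡0 = begin
      ι (lookup f k)                      ≡⟨ ℚ.*-identityʳ _ ⟨
      ι (lookup f k) ℚ.* 1ℚ               ≡⟨ cong (ι (lookup f k) ℚ.*_) (proj₂ (proj₂ (reciprocal h 0<h))) ⟨
      ι (lookup f k) ℚ.* (h ℚ.* r)        ≡⟨ ℚ.*-assoc (ι (lookup f k)) h r ⟨
      ι (lookup f k) ℚ.* h ℚ.* r          ≡⟨ cong (ℚ._* r) fk*h≡0 ⟩
      0ℚ ℚ.* r                            ≡⟨ ℚ.*-zeroˡ r ⟩
      0ℚ                                  ∎
      where
      open ≡.≡-Reasoning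
      r = proj₁ (reciprocal h 0<h)

  norm-affine : ∀ {d} D G (a : Vec ℤ d) → norm (map (λ k → + (D ℕ.* ℤ.∣ k ∣ ℕ.+ G)) a) ≡ D ℕ.* norm a ℕ.+ d ℕ.* G
  norm-affine D G []      = sym (trans (ℕ.+-identityʳ (D ℕ.* 0)) (ℕ.*-zeroʳ D))
  norm-affine {suc d} D G (k ∷ a) = trans (cong (λ t → D ℕ.* ℤ.∣ k ∣ ℕ.+ G ℕ.+ t) (norm-affine D G a)) (lemma D ℤ.∣ k ∣ G (norm a) d)
    where
    lemma : ∀ D k G n d → D ℕ.* k ℕ.+ G ℕ.+ (D ℕ.* n ℕ.+ d ℕ.* G) ≡ D ℕ.* (k ℕ.+ n) ℕ.+ (G ℕ.+ d ℕ.* G)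
    lemma = ℕ-Solver.solve-∀

  ∣lookup∣≤norm : ∀ {d} (x : Vec ℤ d) i → ℤ.∣ lookup x i ∣ ℕ.≤ norm x
  ∣lookup∣≤norm (k ∷ x) zero    = ℕ.m≤m+n _ _
  ∣lookup∣≤norm (k ∷ x) (suc i) = ℕ.≤-trans (∣lookup∣≤norm x i) (ℕ.m≤n+m _ _)

  -- By symmetry P contains the cross polytope on the frame. Since Σ ∣aᵢ∣ stays below N, a whole box
  -- around z can be written with coefficients whose absolute values still sum to at most 1.
  interior : ∀ {d n} {P : Region (suc d)} (v : Vector (ℤ^ suc d) n) → P ≐ conv (λ i → embed (v i)) → Symmetric P →
    (F : Frame (vecs v)) → ∀ N a z → comb (vecs v ∘ Frame.idx F) a ≡ + N ⊙ z → norm a ℕ.< N →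
    embed (lookup z) ∈ Interior P
  interior {d} {n} {P} v (P⊆ , ⊆P) (P⊆⊖P , ⊖P⊆P) F N a z comb-a norm<N =
    fromℚ ε , (proj₁ (halve ε 0<ε) , proj₁ (proj₂ (halve ε 0<ε)) , always (λ _ → half<)) , λ y close →
      ⊆P (ℝᵈ.near-point∈conv (λ i → embed (v i)) V W a z m N (suc d) G comb-a comb-W V∈ -V∈
        rS rQ rm ε (λ i → ℚ.<⇒≤ (proj₁ (proj₂ (S⁻¹ i)))) (ℚ.<⇒≤ (proj₁ (proj₂ Q⁻¹))) (ℚ.<⇒≤ (proj₁ (proj₂ m⁻¹)))
        (λ i → proj₂ (proj₂ (S⁻¹ i))) (proj₂ (proj₂ Q⁻¹)) (proj₂ (proj₂ m⁻¹)) 1≤G ∑S≡Q small {y} (near y close))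
    where
    open Frame F
    V W : Fin (suc d) → Vec ℤ (suc d)
    V = vecs v ∘ idx
    W k = coords (e k)
    m G Q B : ℕ
    m = det form
    -- The slack, given equally to all indices. With D the dimension, the `S i` sum to D · norm a +
    -- D · G = D · N.
    G = N ℕ.∸ norm a
    Q = suc d ℕ.* N
    row : Fin (suc d) → ℕ
    row i = norm (tabulate (λ k → lookup (W k) i))
    B = suc (norm (tabulate (λ i → + row i)))
    1≤G : 1 ℕ.≤ G
    1≤G = ℕ.m<n⇒0<n∸m norm<N
    S : Fin (suc d) → ℕ
    S i = suc d ℕ.* ℤ.∣ lookup a i ∣ ℕ.+ G
    0<ι : ∀ n → 1 ℕ.≤ n → 0ℚ ℚ.< ι (+ n)
    0<ι n 1≤n = ι-pos n {{ℕ.>-nonZero 1≤n}}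
    S⁻¹ : ∀ i → ∃ λ r → 0ℚ ℚ.< r × ι (+ S i) ℚ.* r ≡ 1ℚ
    S⁻¹ i = reciprocal (ι (+ S i)) (0<ι (S i) (ℕ.≤-trans 1≤G (ℕ.m≤n+m G _)))
    Q⁻¹ : ∃ λ r → 0ℚ ℚ.< r × ι (+ Q) ℚ.* r ≡ 1ℚ
    Q⁻¹ = reciprocal (ι (+ Q)) (0<ι Q (ℕ.≤-trans (ℕ.≤-trans (ℕ.s≤s ℕ.z≤n) norm<N) (ℕ.m≤n*m N (suc d))))
    m⁻¹ : ∃ λ r → 0ℚ ℚ.< r × ι (+ m) ℚ.* r ≡ 1ℚ
    m⁻¹ = reciprocal (ι (+ m)) 0<m
      where
      0<m : 0ℚ ℚ.< ι (+ m)
      0<m = ι-pos m {{det-nonZero form}}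
    B⁻¹ : ∃ λ r → 0ℚ ℚ.< r × ι (+ B) ℚ.* r ≡ 1ℚ
    B⁻¹ = reciprocal (ι (+ B)) (ι-pos B)
    rS : Fin (suc d) → ℚ
    rS i = proj₁ (S⁻¹ i)
    rQ rm rB ε : ℚ
    rQ = proj₁ Q⁻¹
    rm = proj₁ m⁻¹
    rB = proj₁ B⁻¹
    -- This is m / (Q B), where `B` is positive and at least the norm of every row of `W`; the
    -- deviation then contributes at most 1 to each numerator, as `small` asks.
    ε = ι (+ m) ℚ.* (rQ ℚ.* rB)
    0<ε : 0ℚ ℚ.< ε
    0<ε = *-pos {ι (+ m)} {rQ ℚ.* rB} (ι-pos m {{det-nonZero form}}) (*-pos {rQ} {rB} (proj₁ (proj₂ Q⁻¹)) (proj₁ (proj₂ B⁻¹)))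
    half< : 0ℚ ℚ.+ proj₁ (halve ε 0<ε) ℚ.< ε
    half< = subst (0ℚ ℚ.+ proj₁ (halve ε 0<ε) ℚ.<_) (proj₂ (proj₂ (halve ε 0<ε)))
      (ℚ.+-monoˡ-< (proj₁ (halve ε 0<ε)) (proj₁ (proj₂ (halve ε 0<ε))))
    comb-W : ∀ k → comb V (W k) ≡ + m ⊙ e k
    comb-W k = comb-coords (e k)
    ∑S≡Q : norm (map (λ k → + (suc d ℕ.* ℤ.∣ k ∣ ℕ.+ G)) a) ≡ Q
    ∑S≡Q = trans (norm-affine (suc d) G a) (trans (sym (ℕ.*-distribˡ-+ (suc d) (norm a) G))
      (cong (suc d ℕ.*_) (ℕ.m+[n∸m]≡n (ℕ.<⇒≤ norm<N))))
    small : ∀ i → ι (+ Q) ℚ.* rm ℚ.* (ι (+ row i) ℚ.* ε) ℚ.≤ 1ℚ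
    small i = begin
      ι (+ Q) ℚ.* rm ℚ.* (ι (+ row i) ℚ.* (ι (+ m) ℚ.* (rQ ℚ.* rB)))
        ≡⟨ regroup (ι (+ Q)) rm (ι (+ row i)) (ι (+ m)) rQ rB ⟩
      (ι (+ Q) ℚ.* rQ) ℚ.* ((ι (+ m) ℚ.* rm) ℚ.* (ι (+ row i) ℚ.* rB))
        ≡⟨ cong₂ (λ p q → p ℚ.* (q ℚ.* (ι (+ row i) ℚ.* rB))) (proj₂ (proj₂ Q⁻¹)) (proj₂ (proj₂ m⁻¹)) ⟩
      1ℚ ℚ.* (1ℚ ℚ.* (ι (+ row i) ℚ.* rB))
        ≡⟨ trans (ℚ.*-identityˡ _) (ℚ.*-identityˡ _) ⟩
      ι (+ row i) ℚ.* rB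
        ≤⟨ ℚ.*-monoʳ-≤-nonNeg rB {{ℚ.nonNegative (ℚ.<⇒≤ (proj₁ (proj₂ B⁻¹)))}} (ι-mono-≤ (ℤ.+≤+ row≤B)) ⟩
      ι (+ B) ℚ.* rB
        ≡⟨ proj₂ (proj₂ B⁻¹) ⟩
      1ℚ ∎
      where
      open ℚ.≤-Reasoning
      row≤B : row i ℕ.≤ B
      row≤B = ℕ.m≤n⇒m≤1+n (subst (ℕ._≤ norm (tabulate (λ i → + row i))) (cong ℤ.∣_∣ (lookup∘tabulate (λ i → + row i) i))
        (∣lookup∣≤norm (tabulate (λ i → + row i)) i))
      regroup : ∀ Q r b m q s → Q ℚ.* r ℚ.* (b ℚ.* (m ℚ.* (q ℚ.* s))) ≡ (Q ℚ.* q) ℚ.* ((m ℚ.* r) ℚ.* (b ℚ.* s))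
      regroup = solve 6 (λ Q r b m q s → Q :* r :* (b :* (m :* (q :* s))) := (Q :* q) :* ((m :* r) :* (b :* s))) refl
        where open +-*-Solver
    V-entry : ∀ i l → ι (lookup (V i) l) ≡ ι (v (idx i) l)
    V-entry i l = cong ι (lookup∘tabulate (v (idx i)) l)
    V∈ : ∀ i → (λ l → ℝᵈ.fromℤ (lookup (V i) l)) ∈ ℝᵈ.conv (λ i → embed (v i))
    V∈ i = ℝᵈ.conv-resp {v = λ i → embed (v i)} {x = embed (v (idx i))} {y = λ l → ℝᵈ.fromℤ (lookup (V i) l)} (λ l → ≃-pointwise (ℝᵈ.fromℤ (lookup (V i) l)) (embed (v (idx i)) l) (λ _ → V-entry i l))
      (ℝᵈ.vertex∈conv (λ i → embed (v i)) (idx i))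
    -v∈P : ∀ j → (λ l → - embed (v j) l) ∈ P
    -v∈P j = ⊖P⊆P {λ l → - embed (v j) l} (embed (v j) , ⊆P {embed (v j)} (ℝᵈ.vertex∈conv (λ i → embed (v i)) j) , λ l → ≃-pointwise (- embed (v j) l) (- embed (v j) l) (λ _ → refl))
    -V∈ : ∀ i → (λ l → - ℝᵈ.fromℤ (lookup (V i) l)) ∈ ℝᵈ.conv (λ i → embed (v i))
    -V∈ i = ℝᵈ.conv-resp {v = λ i → embed (v i)} {x = λ l → - embed (v (idx i)) l} {y = λ l → - ℝᵈ.fromℤ (lookup (V i) l)}
      (λ l → ≃-pointwise (- ℝᵈ.fromℤ (lookup (V i) l)) (- embed (v (idx i)) l) (λ _ → cong ℚ.-_ (V-entry i l)))
      (P⊆ {λ l → - embed (v (idx i)) l} (-v∈P (idx i)))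
    above : ∀ z ε η y → 0ℚ ℚ.< η → (z ℚ.- ε) ℚ.+ η ℚ.< y → 0ℚ ℚ.≤ ε ℚ.+ (y ℚ.- z)
    above z ε η y 0<η lt = ℚ.<⇒≤ (begin-strict
      0ℚ                                   <⟨ 0<η ⟩
      η                                    ≡⟨ cancel z ε η ⟩
      ε ℚ.+ (((z ℚ.- ε) ℚ.+ η) ℚ.- z)      <⟨ ℚ.+-monoʳ-< ε (ℚ.+-monoˡ-< (ℚ.- z) lt) ⟩
      ε ℚ.+ (y ℚ.- z)                      ∎)
      where
      open ℚ.≤-Reasoning
      cancel : ∀ z ε η → η ≡ ε ℚ.+ (((z ℚ.- ε) ℚ.+ η) ℚ.- z)
      cancel = solve 3 (λ z ε η → η := ε :+ (((z :- ε) :+ η) :- z)) refl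
        where open +-*-Solver
    below : ∀ z ε η y → 0ℚ ℚ.< η → y ℚ.+ η ℚ.< z ℚ.+ ε → 0ℚ ℚ.≤ ε ℚ.- (y ℚ.- z)
    below z ε η y 0<η lt = ℚ.<⇒≤ (begin-strict
      0ℚ                                   <⟨ 0<η ⟩
      η                                    ≡⟨ cancel₁ y η ⟩
      (y ℚ.+ η) ℚ.- y                      <⟨ ℚ.+-monoˡ-< (ℚ.- y) lt ⟩
      (z ℚ.+ ε) ℚ.- y                      ≡⟨ cancel₂ y z ε ⟩
      ε ℚ.- (y ℚ.- z)                      ∎)
      where
      open ℚ.≤-Reasoning
      cancel₁ : ∀ y η → η ≡ (y ℚ.+ η) ℚ.- y
      cancel₁ = solve 2 (λ y η → η := (y :+ η) :- y) refl
        where open +-*-Solver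
      cancel₂ : ∀ y z ε → (z ℚ.+ ε) ℚ.- y ≡ ε ℚ.- (y ℚ.- z)
      cancel₂ = solve 3 (λ y z ε → (z :+ ε) :- y := ε :- (y :- z)) refl
        where open +-*-Solver
    near : ∀ y → (∀ k → embed (lookup z) k - fromℚ ε < y k × y k < embed (lookup z) k + fromℚ ε) →
      ∀ k → ℝᵈ.Within (y k - ℝᵈ.fromℤ (lookup z k)) ε
    near y close k =
      0≤-pointwise {fromℚ ε + (y k - ℝᵈ.fromℤ (lookup z k))}
        (eventually (λ n → above (ι (lookup z k)) ε (proj₁ (proj₁ (close k))) (seq (y k) n) (proj₁ (proj₂ (proj₁ (close k))))) (proj₂ (proj₂ (proj₁ (close k))))) ,
      0≤-pointwise {fromℚ ε - (y k - ℝᵈ.fromℤ (lookup z k))}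
        (eventually (λ n → below (ι (lookup z k)) ε (proj₁ (proj₂ (close k))) (seq (y k) n) (proj₁ (proj₂ (proj₂ (close k))))) (proj₂ (proj₂ (proj₂ (close k)))))

  record Presentation {d} (P : Region d) : Set where
    field
      {size}      : ℕ
      v           : Vector (ℤ^ d) size
      P≐conv      : P ≐ conv (λ i → embed (v i))
      normalised  : Normalised (d !) (vecs v)

  -- The form describes the frame after the unimodular change of coordinates, so z is first moved
  -- back by `from`. Decidable equality of integer vectors turns the refutation of z ≠ 0 into z = 0.
  no-small-multiple : ∀ {d n} {P : Region (suc d)} (v : Vector (ℤ^ suc d) n) → P ≐ conv (λ i → embed (v i)) → Symmetric P →
    NoNonzeroInteriorLatticePoint P → (F : Frame (vecs v)) → NoSmallMultiple (Frame.form F)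
  no-small-multiple {d} {n} {P} v P≐ symmetric free F N a z eq norm<N = decidable-stable (≡-dec ℤ._≟_ z 𝟘) λ z≢𝟘 →
    free (lookup (from z)) (λ from-z≡0 → z≢𝟘 (z≡𝟘 from-z≡0)) z-interior
    where
    open Frame F
    open Iso iso
    z≡𝟘 : (∀ k → lookup (from z) k ≡ 0ℤ) → z ≡ 𝟘
    z≡𝟘 from-z≡0 = trans (sym (to∘from z))
        (trans (cong to (lookup-ext (λ k → trans (from-z≡0 k) (sym (lookup-𝟘 k))))) homo-𝟘)
    multiple : comb (vecs v ∘ idx) a ≡ + N ⊙ from z
    multiple = to-injective (trans (isHermite a) (trans eq
      (trans (cong (+ N ⊙_) (sym (to∘from z))) (sym (homo-⊙ (+ N) (from z))))))
    z-interior : embed (lookup (from z)) ∈ Interior P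
    z-interior = interior {d} {n} {P} v P≐ symmetric F N a (from z) multiple norm<N

  -- The index bound holds for every frame. It thus both stops the exchange process and bounds the
  -- determinant of the frame found; maximality is exactly the condition `Bounded`.
  present : ∀ {d n} {P : Region (suc d)} (v : Vector (ℤ^ suc d) n) → P ≐ conv (λ i → embed (v i)) →
    FullDimensional P → Symmetric P → NoNonzeroInteriorLatticePoint P → Presentation P
  present {d} {n} {P} v P≐ full symmetric free = normalise (maximal-frame (vecs v) (suc d !) bound frame)
    where
    bound : ∀ F → det (Frame.form F) ℕ.≤ suc d !
    bound F = minkowski (Frame.form F) (no-small-multiple {d} {n} {P} v P≐ symmetric free F)
    frame : Frame (vecs v)
    frame = [ from-independent , from-vanishing ]′ (independent-or-vanishing (vecs v))
      where
      from-independent : (∃ λ (idx : Fin (suc d) → Fin n) → Injective₀ (comb (vecs v ∘ idx))) → Frame (vecs v)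
      from-independent (idx , injective) =
        let T , H , eq = hermite (vecs v ∘ idx) injective
        in record { idx = idx ; iso = T ; form = H ; isHermite = eq }
      from-vanishing : (∃ λ f → f ≢ 𝟘 × ∀ j → dot f (vecs v j) ≡ 0ℤ) → Frame (vecs v)
      from-vanishing (f , f≢𝟘 , vanish) = contradiction
        (lookup-ext (λ k → trans (no-vanishing-functional {suc d} {n} {P} v P≐ full f vanish k) (sym (lookup-𝟘 k)))) f≢𝟘
    normalise : ∃ (Maximal (vecs v)) → Presentation P
    normalise (F , maximal) = record
      { size = n ; v = v ; P≐conv = P≐ ; normalised = record
        { iso = iso ; form = form ; det≤X = bound F ; bounded = maximal } }
      where open Frame F

  equal-codes⇒same-orbit : ∀ {d} {P Q : Region d} (p : Presentation P) (q : Presentation Q) →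
    code (Presentation.normalised p) ≡ code (Presentation.normalised q) → SameOrbit P Q
  equal-codes⇒same-orbit {d} {P} {Q} p q eq = same-orbit {d} {p.size} {q.size} {P} {Q} p.v q.v p.P≐conv q.P≐conv (toGL T)
    (λ j → let k , eqk = code-≡⇒ p.normalised q.normalised eq j in k , maps j k (sym eqk))
    (λ k → let j , eqj = code-≡⇒ q.normalised p.normalised (sym eq) k in j , maps j k eqj)
    where
    module p = Presentation p
    module q = Presentation q
    module Iₚ = Iso (Normalised.iso p.normalised)
    module I_q = Iso (Normalised.iso q.normalised)
    T : Iso d
    -- Both polytopes have the same points after their normalising maps, so one map followed by the
    -- inverse of the other matches the generators.
    T = Normalised.iso q.normalised ⁻¹ ∙ Normalised.iso p.normalised
    maps : ∀ j k → Iₚ.to (vecs p.v j) ≡ I_q.to (vecs q.v k) → Maps (toGL T) (p.v j) (q.v k)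
    maps j k eq = iso-maps T (p.v j) (q.v k) (trans (cong I_q.from eq) (I_q.from∘to (vecs q.v k)))

-- The pigeonhole conclusion.

open import Data.Nat.Base using (ℕ; suc; s≤s; _!; _^_) renaming (_+_ to _+ℕ_; _*_ to _*ℕ_; _≤_ to _≤ℕ_)
import Data.Nat.Properties as ℕ
open import Data.Fin.Properties using (pigeonhole; <⇒≢)
open import Data.Product.Base using (_×_; _,_; proj₁; proj₂)
open import Relation.Binary.PropositionalEquality using (_≡_; cong)
open Codes using (module Normalised)
open LatticePolytopes

theorem11p1 : ∀ (d : ℕ) → 1 ≤ℕ d →
    AtMostOrbits {d} (((d !) ^ (d +ℕ 1)) *ℕ (2 ^ ((3 ^ d) *ℕ (d !))))
    (λ P → IsLatticePolytope P × FullDimensional P × Symmetric P ×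
    NoNonzeroInteriorLatticePoint P)
theorem11p1 d@(suc _) _ P properties =
  let i , j , i<j , eq = pigeonhole (s≤s (ℕ.≤-reflexive bound≡)) (λ i → Normalised.code (Presentation.normalised (presentation i)))
  in i , j , <⇒≢ i<j , equal-codes⇒same-orbit (presentation i) (presentation j) eq
  where
  bound≡ : (d !) ^ suc d *ℕ 2 ^ (3 ^ d *ℕ d !) ≡ (d !) ^ (d +ℕ 1) *ℕ 2 ^ (3 ^ d *ℕ d !)
  bound≡ = cong (λ k → (d !) ^ k *ℕ 2 ^ (3 ^ d *ℕ d !)) (ℕ.+-comm 1 d)
  presentation : ∀ i → Presentation (P i)
  presentation i = let lattice , full , symmetric , free = properties i in present (proj₁ (proj₂ lattice)) (proj₂ (proj₂ lattice)) full symmetric free
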